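{- Let $G\in\mathcal{F}_{3s}(n)$ be bipartite. Then $\chi''_{(as)}(G)\le \Delta(G)+3$, and $\chi''_{(s)}(G)\le \chi'_s(G)+\varepsilon$, where $\varepsilon=1$ if $\chi'_s(G)>\Delta(G)$ and $\varepsilon=2$ otherwise.
   Context: All graphs are finite, simple and undirected. $\mathcal{F}_{3s}(n)$ denotes the set of simple graphs with $n\ge 3$ vertices, no isolated edges and at most one isolated vertex. $N_e(u)$ is the set of edges incident to $u$. A proper total $k$-coloring of $G$ is a map $f:V(G)\cup E(G)\to\{1,\dots,k\}$ such that adjacent vertices receive distinct colors, edges sharing an end receive distinct colors, and each edge receives a color distinct from the colors of its two ends. $C(f,u)=\{f(e):e\in N_e(u)\}$. $\chi''_{(s)}(G)$ (resp. $\chi''_{(as)}(G)$) is the least $k$ such that $G$ has a proper total $k$-coloring with $C(f,u)\ne C(f,v)$ for all distinct vertices $u,v$ (resp. for the two ends of every edge). $\chi'_s(G)$ is the least number of colors in a proper edge coloring of $G$ in which the sets of colors on edges incident to $u$ and to $v$ differ for all distinct vertices $u,v$. $\Delta(G)$ is the maximum degree. -}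

module Defs where

open import Data.Nat using (ℕ; zero; suc; _+_; _≤_; _<_; _⊔_)
open import Data.Fin using (Fin)
open import Data.Bool using (Bool; true; false; if_then_else_)
open import Data.List using (List; map; foldr; allFin)
open import Data.Nat.ListAction using (sum)
open import Data.Product using (Σ; ∃; ∃-syntax; _×_; _,_)
open import Relation.Nullary using (¬_)
open import Relation.Binary.PropositionalEquality using (_≡_; _≢_)
open import Function.Bundles using (_⇔_)

record Graph (n : ℕ) : Set where
  field
    adj     : Fin n → Fin n → Bool
    adj-sym : ∀ u v → adj u v ≡ adj v u
    adj-irr : ∀ u → adj u u ≡ false
open Graph public

Adj : ∀ {n} → Graph n → Fin n → Fin n → Set
Adj G u v = adj G u v ≡ true

deg : ∀ {n} → Graph n → Fin n → ℕ
deg {n} G u = sum (map (λ v → if adj G u v then 1 else 0) (allFin n))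

maxDeg : ∀ {n} → Graph n → ℕ
maxDeg {n} G = foldr _⊔_ 0 (map (deg G) (allFin n))

Bipartite : ∀ {n} → Graph n → Set
Bipartite {n} G = Σ (Fin n → Bool) λ side → ∀ u v → Adj G u v → side u ≢ side v

InF3s : ∀ {n} → Graph n → Set
InF3s {n} G =
  (3 ≤ n)
  × (∀ u v → Adj G u v → ¬ (deg G u ≡ 1 × deg G v ≡ 1))
  × (∀ u v → deg G u ≡ 0 → deg G v ≡ 0 → u ≡ v)

record EdgeCol {n} (G : Graph n) (k : ℕ) : Set where
  field
    ec     : Fin n → Fin n → Fin k
    ec-sym : ∀ u v → Adj G u v → ec u v ≡ ec v u
open EdgeCol public

ProperEdge : ∀ {n} {G : Graph n} {k} → EdgeCol G k → Set
ProperEdge {n} {G} c =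
  ∀ u v w → Adj G u v → Adj G u w → v ≢ w → ec c u v ≢ ec c u w

InC : ∀ {n} {G : Graph n} {k} → EdgeCol G k → Fin n → Fin k → Set
InC {G = G} c u col = ∃[ v ] (Adj G u v × ec c u v ≡ col)

DiffSets : ∀ {n} {G : Graph n} {k} → EdgeCol G k → Fin n → Fin n → Set
DiffSets {k = k} c u v = ¬ (∀ (col : Fin k) → InC c u col ⇔ InC c v col)

record TotalCol {n} (G : Graph n) (k : ℕ) : Set where
  field
    vc    : Fin n → Fin k
    edges : EdgeCol G k
    vc-proper : ∀ u v → Adj G u v → vc u ≢ vc v
    ec-proper : ProperEdge edges
    ev-proper : ∀ u v → Adj G u v → ec edges u v ≢ vc u
open TotalCol public

TotalVD : ∀ {n} → Graph n → ℕ → Set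
TotalVD G k = Σ (TotalCol G k) λ f → ∀ u v → u ≢ v → DiffSets (edges f) u v

TotalAVD : ∀ {n} → Graph n → ℕ → Set
TotalAVD G k = Σ (TotalCol G k) λ f → ∀ u v → Adj G u v → DiffSets (edges f) u v

EdgeVD : ∀ {n} → Graph n → ℕ → Set
EdgeVD G k = Σ (EdgeCol G k) λ c → ProperEdge c × (∀ u v → u ≢ v → DiffSets c u v)

IsLeast : (ℕ → Set) → ℕ → Set
IsLeast P k = P k × (∀ j → P j → k ≤ j)

-- χ''_(s)(G) ≤ m, χ''_(as)(G) ≤ m : the least k admitting such a colouring
-- is ≤ m, i.e. some k ≤ m admits such a colouring
χ''s≤ : ∀ {n} → Graph n → ℕ → Set
χ''s≤ G m = ∃[ k ] (k ≤ m × TotalVD G k)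

χ''as≤ : ∀ {n} → Graph n → ℕ → Set
χ''as≤ G m = ∃[ k ] (k ≤ m × TotalAVD G k)

eps : ℕ → ℕ → ℕ
eps s Δ with Δ Data.Nat.<ᵇ s
... | true  = 1
... | false = 2

{-# OPTIONS --safe #-}

-- The first bound.  Let A and B be the two sides.  Delete a matching m of edges between vertices of
-- equal degree and split the remaining edges into two classes H and N.  Call a vertex odd if its
-- remaining degree is odd.  A multigraph elimination gives a splitting in which the classes differ
-- in size by 1 at odd vertices, by 0 at even vertices of A and by 2 at even vertices of B, except at
-- one root of each component without odd vertices.  Adjacent even vertices thus see different
-- numbers of colours of H or N, and the exceptions are absorbed by exchanging the classes on the
-- component of a root or by moving its matching edge.  Toggling edges of m makes any two adjacent
-- odd vertices of the same degree and the same status in m the only odd vertices of their components;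
-- such a pair is separated by the last edge inserted into a König colouring when Δ is even, and by one
-- extra colour when Δ is odd.  Every class leaves enough slack for most vertices to take a colour of
-- H or N missing at them.
-- The second bound.  Keep the edge colouring; B takes a new colour, and A takes missing colours if
-- there are more than Δ colours, a second new colour otherwise.
module Submission where

open import Defs
open import Data.Nat using (ℕ; zero; suc; _+_; _≤_; _<_; _⊔_; z≤n; s≤s)
import Data.Nat as ℕ
import Data.Nat.Properties as ℕₚ
open import Data.Nat.ListAction using () renaming (sum to sumᴸ)
open import Data.Integer using (ℤ)
import Data.Integer as Int
import Data.Integer.Properties as ℤₚ
open import Data.Integer.Tactic.RingSolver using (solve-∀)
open import Data.Fin using (Fin; zero; suc)
import Data.Fin as F
import Data.Fin.Properties as Fₚ
open import Data.Bool using (Bool; true; false; if_then_else_; _∧_; _∨_; not; _xor_; T)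
import Data.Bool.Properties as Bₚ
open import Data.Maybe using (Maybe; just; nothing; is-just) renaming (map to mapᴹ)
import Data.Maybe.Properties as Mₚ
open import Data.List using (List; []; _∷_; _++_; map; foldr; tabulate; allFin; cartesianProduct; concat)
import Data.List.Properties as Lₚ
open import Data.List.Membership.Propositional using (_∈_)
open import Data.List.Membership.Propositional.Properties using (∈-allFin; ∈-cartesianProduct⁺; ∈-tabulate⁺; ∈-concat⁺′)
open import Data.List.Relation.Unary.Any using (here; there)
import Data.List.Relation.Unary.All
open Data.List.Relation.Unary.All using (All; []; _∷_)
open import Data.Product as Product using (Σ; ∃-syntax; _×_; _,_; proj₁; proj₂)
open import Data.Sum using (_⊎_; inj₁; inj₂; [_,_]′)
open import Data.Unit using (⊤; tt)
open import Data.Empty using (⊥; ⊥-elim)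
open import Function using (_∘_; id)
open import Function.Bundles using (mk⇔; Equivalence)
open import Relation.Nullary using (¬_; Dec; yes; no; does)
open import Relation.Nullary.Decidable using (_×-dec_; _⊎-dec_; _→-dec_; dec-true; dec-false)
open import Relation.Binary.PropositionalEquality
  using (_≡_; _≢_; refl; sym; trans; cong; cong₂; subst; subst₂; module ≡-Reasoning)
open import Algebra.Properties.CommutativeMonoid.Sum ℕₚ.+-0-commutativeMonoid
  using (sum; sum-cong-≗; ∑-distrib-+; ∑-comm)
import Algebra.Properties.CommutativeMonoid.Sum ℤₚ.+-0-commutativeMonoid as ℤΣ

-- Only adjacent vertices of equal degree can see the same set of colours, and what is compared is
-- mostly cardinalities: how many colours of each class are seen, and whether that of the matching
-- is. König's theorem colours a class with any number of colours not below its maximum degree, so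
-- only class sizes have to be designed. The budget is t + 1 colours for each class and one for the
-- matching when Δ = 2t, and one colour more when Δ = 2t + 1; both make Δ + 3. The differences 0 and
-- ±2 tell even vertices of A from those of B, but an odd vertex has difference ±1 on either side.
-- This obstacle shapes the proof; the matching meets it because membership in it changes parity. In
-- a component without odd vertices the differences have the same sum over both sides, so the values
-- prescribed elsewhere fix the last one modulo 4, and an exception cannot be avoided in general.
-- The exceptional vertex is unmatched if possible, and then has no unmatched neighbour of its
-- degree once no toggle remains; otherwise it lies in A, and its partner in a component with odd
-- vertices.

true≢false : ∀ {b} → b ≡ true → b ≡ false → ⊥
true≢false refl ()

¬true : ∀ {b} → b ≢ true → b ≡ false
¬true {false} _ = refl
¬true {true} h = ⊥-elim (h refl)

true⊎false : ∀ b → b ≡ true ⊎ b ≡ false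
true⊎false true = inj₁ refl
true⊎false false = inj₂ refl

∧-true : ∀ {a b} → a ∧ b ≡ true → a ≡ true × b ≡ true
∧-true {true} {true} _ = refl , refl

∧-intro : ∀ {a b} → a ≡ true → b ≡ true → a ∧ b ≡ true
∧-intro refl refl = refl

∨-true : ∀ {a b} → a ∨ b ≡ true → a ≡ true ⊎ b ≡ true
∨-true {true} _ = inj₁ refl
∨-true {false} h = inj₂ h

∨-introˡ : ∀ {a b} → a ≡ true → a ∨ b ≡ true
∨-introˡ refl = refl

∨-introʳ : ∀ {a b} → b ≡ true → a ∨ b ≡ true
∨-introʳ {true} _ = refl
∨-introʳ {false} h = h

not-true : ∀ {a} → not a ≡ true → a ≡ false
not-true {false} _ = refl

not-false : ∀ {a} → a ≡ false → not a ≡ true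
not-false refl = refl

bool-ext : ∀ {a b : Bool} → (a ≡ true → b ≡ true) → (b ≡ true → a ≡ true) → a ≡ b
bool-ext {true} f g = sym (f refl)
bool-ext {false} {true} f g = g refl
bool-ext {false} {false} f g = refl

does-true : ∀ {A : Set} (d : Dec A) → does d ≡ true → A
does-true (yes a) _ = a

infix 7 _==_
_==_ : ∀ {n} → Fin n → Fin n → Bool
i == j = does (i F.≟ j)

==-refl : ∀ {n} (i : Fin n) → (i == i) ≡ true
==-refl i = dec-true (i F.≟ i) refl

==-≡ : ∀ {n} {i j : Fin n} → (i == j) ≡ true → i ≡ j
==-≡ {i = i} {j} = does-true (i F.≟ j)

==-≢ : ∀ {n} {i j : Fin n} → i ≢ j → (i == j) ≡ false
==-≢ {i = i} {j} = dec-false (i F.≟ j)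

-- Counting decidable subsets of `Fin n`.

b2n : Bool → ℕ
b2n b = if b then 1 else 0

# : ∀ {n} → (Fin n → Bool) → ℕ
# f = sum (λ i → b2n (f i))

#-cong : ∀ {n} {f g : Fin n → Bool} → (∀ i → f i ≡ g i) → # f ≡ # g
#-cong h = sum-cong-≗ (λ i → cong b2n (h i))

#-mono : ∀ {n} {f g : Fin n → Bool} → (∀ i → f i ≡ true → g i ≡ true) → # f ≤ # g
#-mono {zero} h = z≤n
#-mono {suc n} {f} {g} h = ℕₚ.+-mono-≤ (go (f zero) (g zero) (h zero)) (#-mono (λ i → h (suc i)))
  where
  go : ∀ a b → (a ≡ true → b ≡ true) → b2n a ≤ b2n b
  go true b k rewrite k refl = ℕₚ.≤-refl
  go false b k = z≤n

#-split : ∀ {n} (f g : Fin n → Bool) → # f ≡ # (λ i → f i ∧ g i) + # (λ i → f i ∧ not (g i))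
#-split f g = trans (sum-cong-≗ (λ i → go (f i) (g i)))
  (∑-distrib-+ (λ i → b2n (f i ∧ g i)) (λ i → b2n (f i ∧ not (g i))))
  where
  go : ∀ a b → b2n a ≡ b2n (a ∧ b) + b2n (a ∧ not b)
  go true true = refl
  go true false = refl
  go false _ = refl

#-zero : ∀ {n} {f : Fin n → Bool} → (∀ i → f i ≡ false) → # f ≡ 0
#-zero {zero} h = refl
#-zero {suc n} h rewrite h zero = #-zero (h ∘ suc)

#-all : ∀ {n} {f : Fin n → Bool} → (∀ i → f i ≡ true) → # f ≡ n
#-all {zero} h = refl
#-all {suc n} h rewrite h zero = cong suc (#-all (h ∘ suc))

suc-== : ∀ {n} (i j : Fin n) → (Fin.suc i == suc j) ≡ (i == j)
suc-== i j with i F.≟ j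
... | yes _ = refl
... | no _ = refl

#-single : ∀ {n} (y : Fin n) → # (_== y) ≡ 1
#-single (zero {n}) = cong suc (#-zero {n} {λ i → Fin.suc i == zero} (λ i → refl))
#-single (suc y) = trans (#-cong (λ i → suc-== i y)) (#-single y)

#-remove : ∀ {n} {f : Fin n → Bool} (y : Fin n) → f y ≡ true → # f ≡ suc (# (λ i → f i ∧ not (i == y)))
#-remove {f = f} y fy = trans (#-split f (_== y)) (cong (_+ # (λ i → f i ∧ not (i == y)))
  (trans (#-cong (λ i → bool-ext (proj₂ ∘ ∧-true {f i})
     (λ e → ∧-intro (trans (cong f (==-≡ e)) fy) e))) (#-single y)))

#-strict : ∀ {n} {f g : Fin n → Bool} (y : Fin n) → (∀ i → f i ≡ true → g i ≡ true) →
           f y ≡ false → g y ≡ true → # f < # g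
#-strict {f = f} {g} y h fy gy rewrite #-remove {f = g} y gy =
  s≤s (#-mono (λ i fi → ∧-intro (h i fi) (not-false (==-≢ {i = i} {y} λ e → true≢false (trans (cong f (sym e)) fi) fy))))

#-witness : ∀ {n} {f : Fin n → Bool} → 1 ≤ # f → ∃[ i ] f i ≡ true
#-witness {f = f} h with Fₚ.any? (λ i → f i Bₚ.≟ true)
... | yes p = p
... | no ¬p = ⊥-elim (ℕₚ.<-irrefl refl (subst (1 ≤_) (#-zero (λ i → ¬true (λ e → ¬p (i , e)))) h))

#-other : ∀ {n} {f : Fin n → Bool} (y : Fin n) → 2 ≤ # f → ∃[ i ] (f i ≡ true × i ≢ y)
#-other {f = f} y h = go (#-witness {f = λ i → f i ∧ not (i == y)} (lem (true⊎false (f y))))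
  where
  lem : f y ≡ true ⊎ f y ≡ false → 1 ≤ # (λ i → f i ∧ not (i == y))
  lem (inj₁ fy) = ℕ.s≤s⁻¹ (subst (2 ≤_) (#-remove {f = f} y fy) h)
  lem (inj₂ fy) = ℕₚ.≤-trans (ℕₚ.≤-trans (ℕₚ.n≤1+n 1) h)
    (#-mono (λ i fi → ∧-intro fi (not-false (==-≢ {i = i} {y} λ e → true≢false (trans (cong f (sym e)) fi) fy))))
  go : ∃[ i ] (f i ∧ not (i == y) ≡ true) → ∃[ i ] (f i ≡ true × i ≢ y)
  go (i , e) = let (a , b) = ∧-true e in
    i , a , λ { refl → true≢false (==-refl i) (not-true b) }

deg-# : ∀ {n} (G : Graph n) u → deg G u ≡ # (adj G u)
deg-# G u = trans (cong sumᴸ (Lₚ.map-tabulate id (λ v → b2n (adj G u v)))) (go (λ v → b2n (adj G u v)))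
  where
  go : ∀ {n} (f : Fin n → ℕ) → sumᴸ (tabulate f) ≡ sum f
  go {zero} f = refl
  go {suc n} f = cong (f zero +_) (go (f ∘ suc))

deg≤maxDeg : ∀ {n} (G : Graph n) u → deg G u ≤ maxDeg G
deg≤maxDeg G u = subst (deg G u ≤_) (cong (foldr _⊔_ 0) (sym (Lₚ.map-tabulate id (deg G)))) (go (deg G) u)
  where
  go : ∀ {n} (f : Fin n → ℕ) i → f i ≤ foldr _⊔_ 0 (tabulate f)
  go f zero = ℕₚ.m≤m⊔n _ _
  go f (suc i) = ℕₚ.≤-trans (go (f ∘ suc) i) (ℕₚ.m≤n⊔m (f zero) _)

find : ∀ {n} → (Fin n → Bool) → Maybe (Fin n)
find {zero} f = nothing
find {suc n} f = if f zero then just zero else mapᴹ suc (find (f ∘ suc))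

-- Vertices of one component have pointwise equal reachability predicates, so they all select the
-- same vertex.
find-cong : ∀ {n} {f g : Fin n → Bool} → (∀ i → f i ≡ g i) → find f ≡ find g
find-cong {zero} h = refl
find-cong {suc n} h rewrite h zero | find-cong (h ∘ suc) = refl

find-just : ∀ {n} (f : Fin n → Bool) {i} → find f ≡ just i → f i ≡ true
find-just {suc n} f e with f zero in e₀
find-just {suc n} f refl | true = e₀
... | false with find (f ∘ suc) in e₁
find-just {suc n} f refl | false | just j = find-just (f ∘ suc) e₁

find-nothing : ∀ {n} (f : Fin n → Bool) → find f ≡ nothing → ∀ i → f i ≡ false
find-nothing {suc n} f e i with f zero in e₀
... | false with find (f ∘ suc) in e₁
find-nothing {suc n} f e zero | false | nothing = e₀
find-nothing {suc n} f e (suc i) | false | nothing = find-nothing (f ∘ suc) e₁ i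

-- Reachability.

data Path {n} (R : Fin n → Fin n → Bool) (v : Fin n) : Fin n → Set where
  stop : Path R v v
  step : ∀ {x y} → Path R v x → R x y ≡ true → Path R v y

-- The reached set grows by one vertex at a time; the number of vertices still outside is the fuel.
reach : ∀ {n} (R : Fin n → Fin n → Bool) (v : Fin n) →
        Σ (Fin n → Bool) λ S → (∀ y → S y ≡ true → Path R v y) × (∀ y → Path R v y → S y ≡ true)
reach {n} R v = grow _ (_== v) ℕₚ.≤-refl (==-refl v) (λ y e → subst (Path R v) (sym (==-≡ e)) stop)
  where
  grow : ∀ k (S : Fin n → Bool) → # (not ∘ S) ≤ k → S v ≡ true → (∀ y → S y ≡ true → Path R v y) →
         Σ (Fin n → Bool) λ S → (∀ y → S y ≡ true → Path R v y) × (∀ y → Path R v y → S y ≡ true)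
  grow k S le Sv snd with Fₚ.any? (λ x → Fₚ.any? (λ y → (S x ∧ R x y ∧ not (S y)) Bₚ.≟ true))
  ... | no ¬p = S , snd , cl
    where
    cl : ∀ y → Path R v y → S y ≡ true
    cl y stop = Sv
    cl y (step {x} p r) with true⊎false (S y)
    ... | inj₁ t = t
    ... | inj₂ f = ⊥-elim (¬p (x , y , ∧-intro (cl x p) (∧-intro r (not-false f))))
  ... | yes (x , y , e) = next k le
    where
    Sx = proj₁ (∧-true {S x} e)
    Rxy = proj₁ (∧-true {R x y} (proj₂ (∧-true {S x} e)))
    Sy = proj₂ (∧-true {R x y} (proj₂ (∧-true {S x} e)))
    S′ : Fin n → Bool
    S′ z = S z ∨ (z == y)
    less : # (not ∘ S′) < # (not ∘ S)
    less = #-strict y (λ i h → not-false (¬true λ t → true≢false (∨-introˡ {b = i == y} t) (not-true h)))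
             (cong not (∨-introʳ {S y} (==-refl y))) Sy
    next : ∀ k → # (not ∘ S) ≤ k → _
    next zero le = ⊥-elim (ℕₚ.n≮0 (ℕₚ.<-≤-trans less le))
    next (suc k) le = grow k S′ (ℕ.s≤s⁻¹ (ℕₚ.<-≤-trans less le)) (∨-introˡ Sv)
      (λ z h → [ snd z , (λ e → subst (Path R v) (sym (==-≡ e)) (step (snd x Sx) Rxy)) ]′ (∨-true h))

-- Edge colourings of bipartite graphs and König's theorem.

Rel : ℕ → Set
Rel n = Fin n → Fin n → Bool

#-unique : ∀ {n} {f : Fin n → Bool} (i : Fin n) → f i ≡ true → (∀ j → f j ≡ true → j ≡ i) → # f ≡ 1
#-unique {f = f} i fi h = trans (#-cong (λ j → bool-ext (λ e → trans (cong (_== i) (h j e)) (==-refl i))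
  (λ e → trans (cong f (==-≡ {i = j} {i} e)) fi))) (#-single i)

-- An edge colouring, presented as one matching per colour.
record Col {n} (R : Rel n) (C : Set) : Set where
  field
    nb       : Fin n → C → Maybe (Fin n)
    nb-sym   : ∀ {u v c} → nb u c ≡ just v → nb v c ≡ just u
    sound    : ∀ {u v c} → nb u c ≡ just v → R u v ≡ true
    complete : ∀ {u v} → R u v ≡ true → ∃[ c ] nb u c ≡ just v
    unique   : ∀ {u v c d} → nb u c ≡ just v → nb u d ≡ just v → c ≡ d
  seen : Fin n → C → Bool
  seen u c = is-just (nb u c)
open Col public

Bip : ∀ {n} → (Fin n → Bool) → Rel n → Set
Bip side R = ∀ x y → R x y ≡ true → side x ≢ side y

Symm : ∀ {n} → Rel n → Set
Symm R = ∀ x y → R x y ≡ R y x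

is-just-true : ∀ {A : Set} {m : Maybe A} → is-just m ≡ true → ∃[ x ] m ≡ just x
is-just-true {m = just x} _ = x , refl

is-just-false : ∀ {A : Set} {m : Maybe A} → is-just m ≡ false → m ≡ nothing
is-just-false {m = nothing} _ = refl

just≢nothing : ∀ {A : Set} {m : Maybe A} {x} → m ≡ just x → m ≡ nothing → ⊥
just≢nothing refl ()

Col-resp : ∀ {n} {R R′ : Rel n} {C} → (∀ x y → R x y ≡ R′ x y) → (φ : Col R C) →
           Σ (Col R′ C) λ φ′ → nb φ′ ≡ nb φ
Col-resp h φ = record
  { nb = nb φ ; nb-sym = nb-sym φ ; unique = unique φ
  ; sound = λ e → trans (sym (h _ _)) (sound φ e)
  ; complete = λ e → complete φ (trans (h _ _) e) } , refl

is : ∀ {n} → Maybe (Fin n) → Fin n → Bool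
is m v = does (Mₚ.≡-dec F._≟_ m (just v))

is-≡ : ∀ {n} {m : Maybe (Fin n)} {v} → is m v ≡ true → m ≡ just v
is-≡ {m = m} {v} = does-true (Mₚ.≡-dec F._≟_ m (just v))

≡-is : ∀ {n} {m : Maybe (Fin n)} {v} → m ≡ just v → is m v ≡ true
≡-is {m = m} {v} = dec-true (Mₚ.≡-dec F._≟_ m (just v))

≢-is : ∀ {n} {m : Maybe (Fin n)} {v} → m ≢ just v → is m v ≡ false
≢-is {m = m} {v} = dec-false (Mₚ.≡-dec F._≟_ m (just v))

#-is-just : ∀ {n} (m : Maybe (Fin n)) → # (is m) ≡ b2n (is-just m)
#-is-just {n} nothing = #-zero {n} {is nothing} (λ i → refl)
#-is-just (just y) = #-unique {f = is (just y)} y (≡-is {m = just y} refl) (λ j e → sym (Mₚ.just-injective (is-≡ {m = just y} e)))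

#-seen : ∀ {n q} {R : Rel n} (φ : Col R (Fin q)) u → # (seen φ u) ≡ # (R u)
#-seen {n} {q} {R} φ u = begin
  -- Double counting of pairs of a colour and the neighbour it leads to: a colour leads to at most
  -- one neighbour, and an edge has exactly one colour.
  sum (λ c → b2n (is-just (nb φ u c)))    ≡⟨ sum-cong-≗ (λ c → sym (#-is-just (nb φ u c))) ⟩
  sum (λ c → sum (λ v → b2n (hit c v)))   ≡⟨ ∑-comm (λ c v → b2n (hit c v)) ⟩
  sum (λ v → sum (λ c → b2n (hit c v)))   ≡⟨ sum-cong-≗ col ⟩
  sum (λ v → b2n (R u v))                 ∎
  where
  open ≡-Reasoning
  hit : Fin q → Fin n → Bool
  hit c v = is (nb φ u c) v
  col : ∀ v → sum (λ c → b2n (hit c v)) ≡ b2n (R u v)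
  col v with true⊎false (R u v)
  ... | inj₁ t rewrite t = let (c , e) = complete φ t in
    #-unique {f = λ c → hit c v} c (≡-is e) (λ d e′ → unique φ (is-≡ {m = nb φ u d} e′) e)
  ... | inj₂ f rewrite f = #-zero {f = λ c → hit c v} (λ c → ¬true (λ e → true≢false (sound φ (is-≡ {m = nb φ u c} e)) f))

#-seen-not : ∀ {n q} {R : Rel n} (φ : Col R (Fin q)) u → # (R u) + # (λ c → not (seen φ u c)) ≡ q
#-seen-not {q = q} φ u = trans (cong (_+ # (λ c → not (seen φ u c))) (sym (#-seen φ u)))
  (trans (sym (#-split {q} (λ _ → true) (seen φ u))) (#-all (λ _ → refl)))

missing : ∀ {n q} {R : Rel n} (φ : Col R (Fin q)) u → # (R u) < q → ∃[ c ] nb φ u c ≡ nothing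
missing {q = q} {R} φ u h = let (c , e) = #-witness (ℕₚ.+-cancelˡ-≤ (# (R u)) 1 _
                                  (subst (# (R u) + 1 ≤_) (sym (#-seen-not φ u)) (subst (_≤ q) (ℕₚ.+-comm 1 _) h)))
                  in c , is-just-false (not-true e)

missing-≢ : ∀ {n q} {R : Rel n} (φ : Col R (Fin q)) u → 2 + # (R u) ≤ q → ∀ d →
            ∃[ c ] (nb φ u c ≡ nothing × c ≢ d)
missing-≢ {q = q} {R} φ u h d = let (c , e , ne) = #-other d (ℕₚ.+-cancelˡ-≤ (# (R u)) 2 _
                                      (subst (# (R u) + 2 ≤_) (sym (#-seen-not φ u)) (subst (_≤ q) (ℕₚ.+-comm 2 _) h)))
                    in c , is-just-false (not-true e) , ne

swap : ∀ {q} → Fin q → Fin q → Fin q → Fin q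
swap a b c = if c == a then b else if c == b then a else c

swap-a : ∀ {q} (a b : Fin q) → swap a b a ≡ b
swap-a a b rewrite ==-refl a = refl

swap-b : ∀ {q} (a b : Fin q) → swap a b b ≡ a
swap-b a b with b F.≟ a
... | yes refl = refl
... | no _ rewrite ==-refl b = refl

swap-other : ∀ {q} (a b c : Fin q) → c ≢ a → c ≢ b → swap a b c ≡ c
swap-other a b c h k rewrite ==-≢ h | ==-≢ k = refl

swap-inv : ∀ {q} (a b c : Fin q) → swap a b (swap a b c) ≡ c
swap-inv a b c with c F.≟ a
... | yes refl = swap-b a b
... | no h with c F.≟ b
... | yes refl = swap-a a b
... | no k = swap-other a b c h k

swap-cases : ∀ {q} (a b c : Fin q) → (c ≡ a) ⊎ (c ≡ b) ⊎ (swap a b c ≡ c × c ≢ a × c ≢ b)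
swap-cases a b c with c F.≟ a
... | yes e = inj₁ e
... | no h with c F.≟ b
... | yes e = inj₂ (inj₁ e)
... | no k = inj₂ (inj₂ (refl , h , k))

edge : ∀ {n} → Fin n → Fin n → Rel n
edge v w x y = (x == v ∧ y == w) ∨ (x == w ∧ y == v)

edge-cases : ∀ {n} {v w x y : Fin n} → edge v w x y ≡ true → (x ≡ v × y ≡ w) ⊎ (x ≡ w × y ≡ v)
edge-cases {v = v} {w} {x} {y} h with ∨-true {x == v ∧ y == w} h
... | inj₁ e = let (a , b) = ∧-true {x == v} e in inj₁ (==-≡ a , ==-≡ b)
... | inj₂ e = let (a , b) = ∧-true {x == w} e in inj₂ (==-≡ a , ==-≡ b)

edge-vw : ∀ {n} (v w : Fin n) → edge v w v w ≡ true
edge-vw v w rewrite ==-refl v | ==-refl w = refl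

edge-wv : ∀ {n} (v w : Fin n) → edge v w w v ≡ true
edge-wv v w rewrite ==-refl v | ==-refl w = ∨-introʳ {w == v ∧ v == w} refl

infixr 6 _∪_
_∪_ : ∀ {n} → Rel n → Rel n → Rel n
(R ∪ S) x y = R x y ∨ S x y

module _ {n} {R : Rel n} {q} (φ : Col R (Fin q)) (v w : Fin n) (a : Fin q)
         (new : R v w ≡ false) (v≢w : v ≢ w) (va : nb φ v a ≡ nothing) (wa : nb φ w a ≡ nothing) where

  private
    nb′ : Fin n → Fin q → Maybe (Fin n)
    nb′ x c = if (c == a) ∧ (x == v) then just w else if (c == a) ∧ (x == w) then just v else nb φ x c

    old : ∀ {x c y} → nb φ x c ≡ just y → nb′ x c ≡ just y
    old {x} {c} e with c F.≟ a | x F.≟ v | x F.≟ w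
    ... | yes refl | yes refl | _ = ⊥-elim (just≢nothing e va)
    ... | yes refl | no _ | yes refl = ⊥-elim (just≢nothing e wa)
    ... | yes refl | no _ | no _ = e
    ... | no _ | _ | _ = e

    new-v : nb′ v a ≡ just w
    new-v rewrite ==-refl a | ==-refl v = refl

    new-w : nb′ w a ≡ just v
    new-w rewrite ==-refl a | ==-refl w | ==-≢ {i = w} {v} (v≢w ∘ sym) = refl

    inv : ∀ {x c y} → nb′ x c ≡ just y → (c ≡ a × x ≡ v × y ≡ w) ⊎ (c ≡ a × x ≡ w × y ≡ v) ⊎ nb φ x c ≡ just y
    inv {x} {c} e with c F.≟ a | x F.≟ v | x F.≟ w
    ... | yes refl | yes refl | _ = inj₁ (refl , refl , sym (Mₚ.just-injective e))
    ... | yes refl | no _ | yes refl = inj₂ (inj₁ (refl , refl , sym (Mₚ.just-injective e)))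
    ... | yes refl | no _ | no _ = inj₂ (inj₂ e)
    ... | no _ | _ | _ = inj₂ (inj₂ e)

    new′ : R w v ≡ false
    new′ = ¬true (λ e → let (c , h) = complete φ e in true≢false (sound φ (nb-sym φ h)) new)

    sd : ∀ {x c y} → nb′ x c ≡ just y → (R ∪ edge v w) x y ≡ true
    sd {x} {c} {y} e with inv {x} {c} {y} e
    ... | inj₁ (_ , refl , refl) = ∨-introʳ {R x y} (edge-vw v w)
    ... | inj₂ (inj₁ (_ , refl , refl)) = ∨-introʳ {R x y} (edge-wv v w)
    ... | inj₂ (inj₂ h) = ∨-introˡ (sound φ h)

    uq : ∀ {x y c d} → nb′ x c ≡ just y → nb′ x d ≡ just y → c ≡ d
    uq {x} {y} {c} {d} e f with inv {x} {c} e | inv {x} {d} f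
    ... | inj₁ (p , _ , _) | inj₁ (r , _ , _) = trans p (sym r)
    ... | inj₁ (p , _ , _) | inj₂ (inj₁ (r , _ , _)) = trans p (sym r)
    ... | inj₁ (_ , refl , refl) | inj₂ (inj₂ h) = ⊥-elim (true≢false (sound φ h) new)
    ... | inj₂ (inj₁ (p , _ , _)) | inj₁ (r , _ , _) = trans p (sym r)
    ... | inj₂ (inj₁ (p , _ , _)) | inj₂ (inj₁ (r , _ , _)) = trans p (sym r)
    ... | inj₂ (inj₁ (_ , refl , refl)) | inj₂ (inj₂ h) = ⊥-elim (true≢false (sound φ h) new′)
    ... | inj₂ (inj₂ h) | inj₁ (_ , refl , refl) = ⊥-elim (true≢false (sound φ h) new)
    ... | inj₂ (inj₂ h) | inj₂ (inj₁ (_ , refl , refl)) = ⊥-elim (true≢false (sound φ h) new′)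
    ... | inj₂ (inj₂ h) | inj₂ (inj₂ k) = unique φ h k

  -- With a colour free at both ends nothing else has to be recoloured; `kempe` reduces the general
  -- insertion to this one.
  insert-common : Σ (Col (R ∪ edge v w) (Fin q)) λ φ′ →
      (∀ c → seen φ′ v c ≡ seen φ v c ∨ (c == a))
      × (∀ x → x ≢ v → x ≢ w → ∀ c → seen φ′ x c ≡ seen φ x c)
  insert-common = record
    { nb = nb′
    ; nb-sym = λ {x} {y} {c} e → [ (λ { (refl , refl , refl) → new-w }) , [ (λ { (refl , refl , refl) → new-v })
               , (λ h → old {y} {c} (nb-sym φ h)) ]′ ]′ (inv {x} {c} {y} e)
    ; sound = λ {x} {y} {c} → sd {x} {c} {y}
    ; complete = λ {x} {y} e → [ (λ r → let (c , h) = complete φ r in c , old {x} {c} h)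
               , (λ r → [ (λ { (refl , refl) → a , new-v }) , (λ { (refl , refl) → a , new-w }) ]′ (edge-cases {v = v} {w} {x} {y} r)) ]′ (∨-true {R x y} e)
    ; unique = λ {x} {y} {c} {d} → uq {x} {y} {c} {d}
    } , at-v , other
    where
    at-v : ∀ c → is-just (nb′ v c) ≡ is-just (nb φ v c) ∨ (c == a)
    at-v c with c F.≟ a
    ... | yes refl rewrite ==-refl v = sym (∨-introʳ {is-just (nb φ v a)} refl)
    ... | no _ = sym (Bₚ.∨-identityʳ _)
    other : ∀ x → x ≢ v → x ≢ w → ∀ c → is-just (nb′ x c) ≡ is-just (nb φ x c)
    other x h k c rewrite ==-≢ h | ==-≢ k with c == a
    ... | true = refl
    ... | false = refl

≢-≢ : ∀ {a b c : Bool} → a ≢ b → b ≢ c → a ≡ c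
≢-≢ {true} {true} h k = ⊥-elim (h refl)
≢-≢ {true} {false} {true} h k = refl
≢-≢ {true} {false} {false} h k = ⊥-elim (k refl)
≢-≢ {false} {false} h k = ⊥-elim (h refl)
≢-≢ {false} {true} {true} h k = ⊥-elim (k refl)
≢-≢ {false} {true} {false} h k = refl

-- Kempe change along the alternating (a, b)-path that starts at w.  Orienting the colour a away
-- from the side of w and b towards it, that path is a forward orbit, which cannot enter v.
kempe : ∀ {n} {R : Rel n} {q} (side : Fin n → Bool) → Bip side R →
        (φ : Col R (Fin q)) (v w : Fin n) → side v ≢ side w → (a b : Fin q) → nb φ v a ≡ nothing → nb φ w b ≡ nothing →
        Σ (Col R (Fin q)) λ φ′ → (∀ c → nb φ′ v c ≡ nb φ v c) × nb φ′ w a ≡ nothing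
          × (∀ x → (∀ c → nb φ′ x c ≡ nb φ x c) ⊎ (∀ c → nb φ′ x c ≡ nb φ x (swap a b c)))
kempe {n} {R} {q} side bip φ v w sv≢sw a b va wb = φ′ , at-v , at-w , cases
  where
  dir : Fin n → Fin q
  dir x = if does (side x Bₚ.≟ side w) then a else b
  F : Rel n
  F x y = does (Mₚ.≡-dec F._≟_ (nb φ x (dir x)) (just y))
  F-≡ : ∀ {x y} → F x y ≡ true → nb φ x (dir x) ≡ just y
  F-≡ {x} {y} = does-true (Mₚ.≡-dec F._≟_ (nb φ x (dir x)) (just y))
  S = proj₁ (reach F w)
  S-path = proj₁ (proj₂ (reach F w))
  path-S = proj₂ (proj₂ (reach F w))
  dir-w : ∀ {x} → side x ≡ side w → dir x ≡ a
  dir-w {x} e rewrite dec-true (side x Bₚ.≟ side w) e = refl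
  dir-v : ∀ {x} → side x ≢ side w → dir x ≡ b
  dir-v {x} e rewrite dec-false (side x Bₚ.≟ side w) e = refl
  opposite : ∀ {x y} → R x y ≡ true → side y ≢ side w → side x ≡ side w
  opposite {x} {y} r k = ≢-≢ (bip x y r) k
  -- Following the other colour goes backwards: every vertex of the orbit except w was entered along
  -- it, so its edge leads to the predecessor, and w has no edge of colour b.
  closed : ∀ {x y c} → c ≡ a ⊎ c ≡ b → S x ≡ true → nb φ x c ≡ just y → S y ≡ true
  closed {x} {y} {c} cab Sx e with side x Bₚ.≟ side w
  closed {x} {y} (inj₁ refl) Sx e | yes sx = path-S y (step (S-path x Sx)
    (dec-true (Mₚ.≡-dec F._≟_ (nb φ x (dir x)) (just y)) (subst (λ d → nb φ x d ≡ just y) (sym (dir-w sx)) e)))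
  closed {x} {y} (inj₂ refl) Sx e | yes sx with S-path x Sx
  ... | stop = ⊥-elim (just≢nothing e wb)
  ... | step {x₀} p r with F-≡ {x₀} r
  ... | h = subst (λ z → S z ≡ true) (Mₚ.just-injective (trans (sym (nb-sym φ (subst (λ d → nb φ x₀ d ≡ just x)
            (dir-v (λ s → bip x₀ x (sound φ h) (trans s (sym sx)))) h))) e)) (path-S x₀ p)
  closed {x} {y} (inj₂ refl) Sx e | no sx = path-S y (step (S-path x Sx)
    (dec-true (Mₚ.≡-dec F._≟_ (nb φ x (dir x)) (just y)) (subst (λ d → nb φ x d ≡ just y) (sym (dir-v sx)) e)))
  closed {x} {y} (inj₁ refl) Sx e | no sx with S-path x Sx
  ... | stop = ⊥-elim (sx refl)
  ... | step {x₀} p r with F-≡ {x₀} r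
  ... | h = subst (λ z → S z ≡ true) (Mₚ.just-injective (trans (sym (nb-sym φ (subst (λ d → nb φ x₀ d ≡ just x)
            (dir-w (opposite (sound φ h) sx)) h))) e)) (path-S x₀ p)
  v∉S : S v ≡ false
  v∉S = ¬true λ Sv → go Sv (S-path v Sv)
    where
    go : S v ≡ true → Path F w v → ⊥
    go Sv stop = sv≢sw refl
    go Sv (step {x₀} p r) with F-≡ {x₀} r
    ... | h = just≢nothing (nb-sym φ (subst (λ d → nb φ x₀ d ≡ just v) (dir-w (opposite (sound φ h) sv≢sw)) h)) va
  τ = swap a b
  nb′ : Fin n → Fin q → Maybe (Fin n)
  nb′ x c = nb φ x (if S x then τ c else c)
  same-S : ∀ {x y c} → c ≡ a ⊎ c ≡ b → nb φ x c ≡ just y → S x ≡ S y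
  same-S cab e = bool-ext (λ s → closed cab s e) (λ s → closed cab s (nb-sym φ e))
  τ-ab : ∀ {c} → c ≡ a ⊎ c ≡ b → ∀ s → (if s then τ c else c) ≡ a ⊎ (if s then τ c else c) ≡ b
  τ-ab (inj₁ refl) true = inj₂ (swap-a a b)
  τ-ab (inj₂ refl) true = inj₁ (swap-b a b)
  τ-ab h false = h
  move : ∀ {x y c} → nb′ x c ≡ just y → nb′ y c ≡ just x
  move {x} {y} {c} e with swap-cases a b c
  ... | inj₂ (inj₂ (fix , _ , _)) = trans (cong (nb φ y) (stay (S y))) (nb-sym φ (trans (cong (nb φ x) (sym (stay (S x)))) e))
    where
    stay : ∀ s → (if s then τ c else c) ≡ c
    stay true = fix
    stay false = refl
  ... | inj₁ ca = subst (λ s → nb φ y (if s then τ c else c) ≡ just x) (same-S (τ-ab (inj₁ ca) (S x)) e) (nb-sym φ e)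
  ... | inj₂ (inj₁ cb) = subst (λ s → nb φ y (if s then τ c else c) ≡ just x) (same-S (τ-ab (inj₂ cb) (S x)) e) (nb-sym φ e)
  inj : ∀ s {c d} → (if s then τ c else c) ≡ (if s then τ d else d) → c ≡ d
  inj true {c} {d} e = trans (sym (swap-inv a b c)) (trans (cong τ e) (swap-inv a b d))
  inj false e = e
  back : ∀ s c → (if s then τ (if s then τ c else c) else (if s then τ c else c)) ≡ c
  back true c = swap-inv a b c
  back false c = refl
  φ′ : Col R (Fin q)
  φ′ = record { nb = nb′ ; nb-sym = λ {x} {y} {c} → move {x} {y} {c} ; sound = sound φ
              ; complete = λ {x} {y} r → let (c , e) = complete φ r in
                  (if S x then τ c else c) , trans (cong (nb φ x) (back (S x) c)) e
              ; unique = λ {x} e f → inj (S x) (unique φ e f) }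
  at-v : ∀ c → nb′ v c ≡ nb φ v c
  at-v c rewrite v∉S = refl
  at-w : nb′ w a ≡ nothing
  at-w rewrite path-S w stop | swap-a a b = wb
  cases : ∀ x → (∀ c → nb′ x c ≡ nb φ x c) ⊎ (∀ c → nb′ x c ≡ nb φ x (τ c))
  cases x with S x
  ... | true = inj₂ (λ c → refl)
  ... | false = inj₁ (λ c → refl)

abstract
  -- A Kempe change frees a at w without touching v. The conclusion also records that a third vertex
  -- sees at most an exchange of a and b, which is what allows the last inserted edge to separate
  -- two colour sets.
  insert : ∀ {n q} (side : Fin n → Bool) {R : Rel n} → Bip side R → (φ : Col R (Fin q)) (v w : Fin n) →
           R v w ≡ false → side v ≢ side w → (a b : Fin q) → nb φ v a ≡ nothing → nb φ w b ≡ nothing →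
           Σ (Col (R ∪ edge v w) (Fin q)) λ φ′ →
             (∀ c → seen φ′ v c ≡ seen φ v c ∨ (c == a))
             × (∀ x → x ≢ v → x ≢ w → (∀ c → seen φ′ x c ≡ seen φ x c) ⊎ (∀ c → seen φ′ x c ≡ seen φ x (swap a b c)))
  insert side bip φ v w new s a b va wb with kempe side bip φ v w s a b va wb
  ... | φ₁ , at-v , at-w , cases with insert-common φ₁ v w a new (λ e → s (cong side e)) (trans (at-v a) va) at-w
  ... | φ₂ , at-v₂ , other = φ₂
    , (λ c → trans (at-v₂ c) (cong (λ m → is-just m ∨ (c == a)) (at-v c)))
    , (λ x h k → [ (λ e → inj₁ (λ c → trans (other x h k c) (cong is-just (e c))))
                 , (λ e → inj₂ (λ c → trans (other x h k c) (cong is-just (e c)))) ]′ (cases x))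

edge-sym : ∀ {n} (v w x y : Fin n) → edge v w x y ≡ edge v w y x
edge-sym v w x y = bool-ext (go x y) (go y x)
  where
  go : ∀ x y → edge v w x y ≡ true → edge v w y x ≡ true
  go x y h with edge-cases {v = v} {w} {x} {y} h
  ... | inj₁ (refl , refl) = edge-wv v w
  ... | inj₂ (refl , refl) = edge-vw v w

-- The edges are inserted one by one. As long as an edge is absent, both its ends have fewer than q
-- edges and therefore a free colour.
koenig : ∀ {n q} (side : Fin n → Bool) (R : Rel n) → Symm R → Bip side R → (∀ u → # (R u) ≤ q) → Col R (Fin q)
koenig {n} {q} side R sy bip le = proj₁ (Col-resp (λ x y → bool-ext (λ e → proj₁ (∧-true {R x y} e))
    (λ e → ∧-intro e (within-all x y (∈-cartesianProduct⁺ (∈-allFin x) (∈-allFin y))))) (go all))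
  where
  all : List (Fin n × Fin n)
  all = cartesianProduct (allFin n) (allFin n)
  within : List (Fin n × Fin n) → Rel n
  within [] x y = false
  within ((v , w) ∷ l) x y = edge v w x y ∨ within l x y
  within-∈ : ∀ l x y → (x , y) ∈ l → within l x y ≡ true
  within-∈ ((v , w) ∷ l) x y (here refl) = ∨-introˡ (edge-vw v w)
  within-∈ ((v , w) ∷ l) x y (there p) = ∨-introʳ {edge v w x y} (within-∈ l x y p)
  within-all : ∀ x y → (x , y) ∈ all → within all x y ≡ true
  within-all = within-∈ all
  within-sym : ∀ l x y → within l x y ≡ within l y x
  within-sym [] x y = refl
  within-sym ((v , w) ∷ l) x y = cong₂ _∨_ (edge-sym v w x y) (within-sym l x y)
  only : List (Fin n × Fin n) → Rel n
  only l x y = R x y ∧ within l x y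
  go : ∀ l → Col (only l) (Fin q)
  go [] = record { nb = λ _ _ → nothing ; nb-sym = λ () ; sound = λ ()
                 ; complete = λ {x} {y} e → ⊥-elim (true≢false (proj₂ (∧-true {R x y} e)) refl) ; unique = λ () }
  go ((v , w) ∷ l) with true⊎false (R v w ∧ not (within l v w))
  -- The pair is no edge, or the edge is already present, perhaps in its other orientation.
  ... | inj₂ f = proj₁ (Col-resp same (go l))
    where
    same : ∀ x y → only l x y ≡ only ((v , w) ∷ l) x y
    same x y = bool-ext (λ e → let (r , i) = ∧-true {R x y} e in ∧-intro r (∨-introʳ {edge v w x y} i))
      (λ e → let (r , i) = ∧-true {R x y} e in ∧-intro r ([ lem r , id ]′ (∨-true {edge v w x y} i)))
      where
      lem : R x y ≡ true → edge v w x y ≡ true → within l x y ≡ true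
      lem r i with true⊎false (within l x y)
      ... | inj₁ t = t
      ... | inj₂ u with edge-cases {v = v} {w} {x} {y} i
      ... | inj₁ (refl , refl) = ⊥-elim (true≢false (∧-intro r (not-false u)) f)
      ... | inj₂ (refl , refl) = ⊥-elim (true≢false (∧-intro (trans (sy v w) r) (not-false (trans (within-sym l v w) u))) f)
  ... | inj₁ t = proj₁ (Col-resp same (proj₁ (insert side bip′ (go l) v w new (bip v w Rvw) a b va wb)))
    where
    Rvw = proj₁ (∧-true {R v w} t)
    out = not-true (proj₂ (∧-true {R v w} t))
    Rwv = trans (sy w v) Rvw
    new : only l v w ≡ false
    new rewrite out = Bₚ.∧-zeroʳ _
    new′ : only l w v ≡ false
    new′ rewrite trans (within-sym l w v) out = Bₚ.∧-zeroʳ _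
    bip′ : Bip side (only l)
    bip′ x y e = bip x y (proj₁ (∧-true e))
    less : ∀ x y → R x y ≡ true → only l x y ≡ false → # (only l x) < q
    less x y r o = ℕₚ.<-≤-trans (#-strict y (λ i e → proj₁ (∧-true {R x i} e)) o r) (le x)
    mv = missing (go l) v (less v w Rvw new)
    mw = missing (go l) w (less w v Rwv new′)
    a = proj₁ mv
    va = proj₂ mv
    b = proj₁ mw
    wb = proj₂ mw
    same : ∀ x y → (only l ∪ edge v w) x y ≡ only ((v , w) ∷ l) x y
    same x y = bool-ext
      (λ e → [ (λ o → let (r , i) = ∧-true {R x y} o in ∧-intro r (∨-introʳ {edge v w x y} i))
             , (λ i → ∧-intro (lem i) (∨-introˡ i)) ]′ (∨-true {only l x y} e))
      (λ e → let (r , i) = ∧-true {R x y} e in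
        [ (λ j → ∨-introʳ {only l x y} j) , (λ j → ∨-introˡ (∧-intro r j)) ]′ (∨-true {edge v w x y} i))
      where
      lem : edge v w x y ≡ true → R x y ≡ true
      lem i with edge-cases {v = v} {w} {x} {y} i
      ... | inj₁ (refl , refl) = Rvw
      ... | inj₂ (refl , refl) = Rwv

-- Let su, sv be the colour sets of u and v just before v w is coloured and su′, sv′ the final ones.
-- At most one colour c makes su equal to sv plus c; it suffices to avoid it both at v and at w.
insertion-distinguishes : ∀ {q} (su sv su′ sv′ : Fin q → Bool) (a b c : Fin q) → a ≢ c → b ≢ c →
  (∀ d → su d ∧ not (sv d) ≡ true → su c ∧ not (sv c) ≡ true) →
  sv a ≡ false → (∀ d → sv′ d ≡ sv d ∨ (d == a)) →
  (∀ d → su′ d ≡ su d) ⊎ (∀ d → su′ d ≡ su (swap a b d)) → ¬ (∀ d → su′ d ≡ sv′ d)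
insertion-distinguishes su sv su′ sv′ a b c a≢c b≢c worst a∉ at-v at-u eq = go at-u
  where
  contra : su c ∧ not (sv c) ≡ true → su′ c ≡ su c → ⊥
  contra bad e = true≢false (proj₁ (∧-true {su c} bad)) (trans (sym e) (trans (eq c) (trans (at-v c)
      (cong₂ _∨_ (not-true (proj₂ (∧-true {su c} bad))) (==-≢ (a≢c ∘ sym))))))
  sv′a : sv′ a ≡ true
  sv′a = trans (at-v a) (∨-introʳ {sv a} (==-refl a))
  go : (∀ d → su′ d ≡ su d) ⊎ (∀ d → su′ d ≡ su (swap a b d)) → ⊥
  go (inj₁ h) = contra (worst a (∧-intro (trans (sym (h a)) (trans (eq a) sv′a)) (not-false a∉))) (h c)
  go (inj₂ h) = contra (bad (true⊎false (sv b))) (trans (h c) (cong su (swap-other a b c (a≢c ∘ sym) (b≢c ∘ sym))))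
    where
    bad : sv b ≡ true ⊎ sv b ≡ false → su c ∧ not (sv c) ≡ true
    bad (inj₂ f) = worst b (∧-intro (trans (cong su (sym (swap-a a b))) (trans (sym (h a)) (trans (eq a) sv′a))) (not-false f))
    bad (inj₁ t) = worst a (∧-intro (trans (cong su (sym (swap-b a b))) (trans (sym (h b)) (trans (eq b)
                     (trans (at-v b) (∨-introˡ t))))) (not-false a∉))

-- Any single element of f serves; for empty f every colour does, and the default is returned.
worst-colour : ∀ {q} (f : Fin q → Bool) → Fin q → ∃[ c ] (∀ d → f d ≡ true → f c ≡ true)
worst-colour f c₀ with Fₚ.any? (λ c → f c Bₚ.≟ true)
... | yes (c , b) = c , (λ _ _ → b)
... | no h = c₀ , (λ d b → ⊥-elim (h (d , b)))

-- The edge v w is left out and inserted last. Degrees below q leave two free colours at each of v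
-- and w before the insertion, so each has one different from the colour to be avoided. The side of
-- u keeps it distinct from v.
koenig-distinct : ∀ {n q} (side : Fin n → Bool) (R : Rel n) → Symm R → Bip side R → (∀ u → # (R u) ≤ q) →
  ∀ u v w → R v w ≡ true → side u ≡ side w → u ≢ w → # (R v) < q → # (R w) < q →
  Σ (Col R (Fin q)) λ φ → ¬ (∀ c → seen φ u c ≡ seen φ v c)
koenig-distinct {n} {q} side R sy bip le u v w Rvw su u≢w dv dw = extend (koenig side R⁻ sym⁻ bip⁻ (λ x → ℕₚ.≤-trans (#-mono (sub x)) (le x)))
  where
  R⁻ : Rel n
  R⁻ x y = R x y ∧ not (edge v w x y)
  Rwv : R w v ≡ true
  Rwv = trans (sy w v) Rvw
  sub : ∀ x y → R⁻ x y ≡ true → R x y ≡ true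
  sub x y e = proj₁ (∧-true e)
  off-v : R⁻ v w ≡ false
  off-v rewrite edge-vw v w = Bₚ.∧-zeroʳ _
  off-w : R⁻ w v ≡ false
  off-w rewrite edge-wv v w = Bₚ.∧-zeroʳ _
  sym⁻ : Symm R⁻
  sym⁻ x y = cong₂ (λ r e → r ∧ not e) (sy x y) (edge-sym v w x y)
  bip⁻ : Bip side R⁻
  bip⁻ x y e = bip x y (sub x y e)
  two : ∀ x y → # (R x) < q → R x y ≡ true → R⁻ x y ≡ false → 2 + # (R⁻ x) ≤ q
  two x y d r o = ℕₚ.≤-trans (s≤s (#-strict {f = R⁻ x} {R x} y (sub x) o r)) d
  same : ∀ x y → (R⁻ ∪ edge v w) x y ≡ R x y
  same x y = bool-ext (λ e → [ sub x y , (λ i → [ (λ { (refl , refl) → Rvw }) , (λ { (refl , refl) → Rwv }) ]′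
      (edge-cases {v = v} {w} {x} {y} i)) ]′ (∨-true {R⁻ x y} e))
    (λ r → [ (λ i → ∨-introʳ {R⁻ x y} i) , (λ i → ∨-introˡ (∧-intro r (not-false i))) ]′ (true⊎false (edge v w x y)))
  extend : Col R⁻ (Fin q) → Σ (Col R (Fin q)) λ φ → ¬ (∀ c → seen φ u c ≡ seen φ v c)
  -- This colour is only the default for `worst-colour`.
  extend φ with missing φ v (ℕₚ.<-trans (ℕₚ.n<1+n _) (two v w dv Rvw off-v))
  ... | c₀ , _ with worst-colour (λ d → seen φ u d ∧ not (seen φ v d)) c₀
  ... | c , worst with missing-≢ φ v (two v w dv Rvw off-v) c | missing-≢ φ w (two w v dw Rwv off-w) c
  ... | a , va , a≢c | b , wb , b≢c with insert side bip⁻ φ v w off-v (bip v w Rvw) a b va wb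
  ... | φ′ , at-v , at-u with Col-resp same φ′
  ... | ψ , same-nb = ψ , λ eq → insertion-distinguishes (seen φ u) (seen φ v) (seen φ′ u) (seen φ′ v) a b c a≢c b≢c worst
      (cong is-just va) at-v (at-u u (λ e → bip v w Rvw (trans (cong side (sym e)) su)) u≢w)
      (λ d → trans (cong (λ f → is-just (f u d)) (sym same-nb)) (trans (eq d) (cong (λ f → is-just (f v d)) same-nb)))

-- Signing the edges of a multigraph

module Signing {n : ℕ} where

  open Int using (0ℤ) renaming (_+_ to _+ᶻ_; -_ to -ᶻ_)

  private
    V = Fin n

  -- An end carries a twist: an edge of sign s counts as `sg (s xor α)` at an end of twist α. Such
  -- bidirected multigraphs are closed under splitting off two edges at a vertex with equal or with
  -- opposite signs there.
  End : Set
  End = Maybe V × Bool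

  Edge : Set
  Edge = End × End

  sg : Bool → ℤ
  sg b = if b then -ᶻ (Int.+ 1) else Int.+ 1

  ct : End → Bool → V → ℤ
  ct (just a , α) s u = if a == u then sg (s xor α) else 0ℤ
  ct (nothing , α) s u = 0ℤ

  weight : Edge → Bool → V → ℤ
  weight (x , y) s u = ct x s u +ᶻ ct y s u

  val : {E : List Edge} → All (λ _ → Bool) E → V → ℤ
  val [] u = 0ℤ
  val (_∷_ {e} s z) u = weight e s u +ᶻ val z u

  -- Ach E f: some choice of signs on the signed multigraph E has vertex sums f.
  -- An end "nothing" belongs to no vertex; an edge with such an end is dangling.
  Ach : List Edge → (V → ℤ) → Set
  Ach E f = Σ (All (λ _ → Bool) E) λ z → ∀ u → f u ≡ val z u

  cons : ∀ {E f} e s → Ach E f → Ach (e ∷ E) (λ u → weight e s u +ᶻ f u)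
  cons e s (z , h) = s ∷ z , λ u → cong (weight e s u +ᶻ_) (h u)

  uncons : ∀ {E f e} → Ach (e ∷ E) f → Σ Bool λ s → Σ (V → ℤ) λ g → Ach E g × (∀ u → f u ≡ weight e s u +ᶻ g u)
  uncons (s ∷ z , h) = s , val z , (z , λ u → refl) , h

  ext : ∀ {E f g} → (∀ u → g u ≡ f u) → Ach E f → Ach E g
  ext k (z , h) = z , λ u → trans (k u) (h u)

  -- Reductions are read backwards: the simpler multigraph is signed first, and its signs are then
  -- carried over to the original one.
  _⊑_ : List Edge → List Edge → Set
  X ⊑ Y = ∀ {f} → Ach X f → Ach Y f

  ⊑-cons : ∀ {X Y} e → X ⊑ Y → (e ∷ X) ⊑ (e ∷ Y)
  ⊑-cons e k a = let (s , g , b , h) = uncons a in ext h (cons e s (k b))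

  ⊑-swap : ∀ {X} e e′ → (e ∷ e′ ∷ X) ⊑ (e′ ∷ e ∷ X)
  ⊑-swap e e′ (s ∷ s′ ∷ z , h) = s′ ∷ s ∷ z , λ u → trans (h u) (lem (weight e s u) (weight e′ s′ u) (val z u))
    where
    lem : ∀ a b c → a +ᶻ (b +ᶻ c) ≡ b +ᶻ (a +ᶻ c)
    lem = solve-∀

  ⊑-front : ∀ xs {ys} e → (xs ++ e ∷ ys) ⊑ (e ∷ xs ++ ys)
  ⊑-front [] e a = a
  ⊑-front (x ∷ xs) e a = ⊑-swap x e (⊑-cons x (⊑-front xs e) a)

  xor-cancel : ∀ s α → (s xor α) xor α ≡ s
  xor-cancel true true = refl
  xor-cancel true false = refl
  xor-cancel false true = refl
  xor-cancel false false = refl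

  flip : End → Bool → End
  flip (a , α) β = a , β xor α

  ct-flip : ∀ x s β u → ct (flip x β) s u ≡ ct x (s xor β) u
  ct-flip (nothing , α) s β u = refl
  ct-flip (just a , α) s β u rewrite Bₚ.xor-assoc s β α = refl

  at : V → Bool → End
  at v γ = just v , γ

  ct-at : ∀ v γ s u → ct (at v γ) (s xor γ) u ≡ ct (at v false) s u
  ct-at v γ s u rewrite xor-cancel s γ | Bₚ.xor-identityʳ s = refl

  spoke : V → End → Edge
  spoke v x = at v false , x

  -- Replacing s by `s xor γ` moves the twist at v to the far end, so edges may be assumed untwisted
  -- at v.
  spoke-flipˡ : ∀ {X} v γ x → (spoke v (flip x γ) ∷ X) ⊑ ((at v γ , x) ∷ X)
  spoke-flipˡ v γ x a with uncons a
  ... | s , g , b , h = ext (λ u → trans (h u) (cong (_+ᶻ g u)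
          (cong₂ _+ᶻ_ (sym (ct-at v γ s u)) (ct-flip x s γ u)))) (cons _ (s xor γ) b)

  spoke-flipʳ : ∀ {X} v γ x → (spoke v (flip x γ) ∷ X) ⊑ ((x , at v γ) ∷ X)
  spoke-flipʳ v γ x a with uncons a
  ... | s , g , b , h = ext (λ u → trans (h u) (cong (_+ᶻ g u)
          (trans (ℤₚ.+-comm _ (ct (flip x γ) s u)) (cong₂ _+ᶻ_ (ct-flip x s γ u) (sym (ct-at v γ s u)))))) (cons _ (s xor γ) b)

  ct-v : ∀ v s → ct (at v false) s v ≡ sg s
  ct-v v s rewrite ==-refl v | Bₚ.xor-identityʳ s = refl

  ct-≢ : ∀ v γ s u → u ≢ v → ct (at v γ) s u ≡ 0ℤ
  ct-≢ v γ s u h rewrite ==-≢ {i = v} {u} (h ∘ sym) = refl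

  sg-not : ∀ s → sg s +ᶻ sg (not s) ≡ 0ℤ
  sg-not true = refl
  sg-not false = refl

  ct-not : ∀ v s u → ct (at v false) s u +ᶻ ct (at v false) (not s) u ≡ 0ℤ
  ct-not v s u with v == u
  ... | false = refl
  ... | true rewrite Bₚ.xor-identityʳ s | Bₚ.xor-identityʳ (not s) = sg-not s

  -- Splitting off two edges at v with opposite signs there.
  alternate : ∀ {X} v x y → ((x , flip y true) ∷ X) ⊑ (spoke v x ∷ spoke v y ∷ X)
  alternate {X} v x y a with uncons a
  ... | s , g , b , h = ext (λ u → trans (h u) (eq u)) (cons (spoke v x) s (cons (spoke v y) (not s) b))
    where
    lem : ∀ p q c d e → p +ᶻ q ≡ 0ℤ → (c +ᶻ d) +ᶻ e ≡ (p +ᶻ c) +ᶻ ((q +ᶻ d) +ᶻ e)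
    lem p q c d e k = trans (trans (sym (ℤₚ.+-identityˡ _)) (cong (_+ᶻ _) (sym k))) (r p q c d e)
      where
      r : ∀ p q c d e → (p +ᶻ q) +ᶻ ((c +ᶻ d) +ᶻ e) ≡ (p +ᶻ c) +ᶻ ((q +ᶻ d) +ᶻ e)
      r = solve-∀
    eq : ∀ u → weight (x , flip y true) s u +ᶻ g u ≡ weight (spoke v x) s u +ᶻ (weight (spoke v y) (not s) u +ᶻ g u)
    eq u = trans (cong (λ t → (ct x s u +ᶻ t) +ᶻ g u) (trans (ct-flip y s true u) (cong (λ t → ct y t u) (xt s))))
             (lem (ct (at v false) s u) (ct (at v false) (not s) u) (ct x s u) (ct y (not s) u) (g u) (ct-not v s u))
      where
      xt : ∀ s → s xor true ≡ not s
      xt true = refl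
      xt false = refl

  -- `Rt` is what remains attainable at a vertex whose edges are all loops.
  One Two Rt : ℤ → Set
  One z = z ≡ Int.+ 1 ⊎ z ≡ -ᶻ (Int.+ 1)
  Two z = z ≡ Int.+ 2 ⊎ z ≡ -ᶻ (Int.+ 2)
  Rt z = z ≡ 0ℤ ⊎ Two z

  -- τ selects the even outcome: the last pair of edges takes equal signs if τ is true and opposite
  -- signs otherwise.
  Out : Bool → ℤ → Set
  Out τ z = One z ⊎ (if τ then Two z else z ≡ 0ℤ)

  away : V → End → Set
  away v x = proj₁ x ≢ just v

  Away : V → Edge → Set
  Away v (x , y) = away v x × away v y

  away-ct : ∀ v x s → away v x → ct x s v ≡ 0ℤ
  away-ct v (nothing , α) s h = refl
  away-ct v (just a , α) s h rewrite ==-≢ {i = a} {v} (λ { refl → h refl }) = refl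

  away-val : ∀ {E v} → All (Away v) E → (z : All (λ _ → Bool) E) → val z v ≡ 0ℤ
  away-val [] [] = refl
  away-val {v = v} (_∷_ {e} (h , k) hs) (s ∷ z) rewrite away-ct v (proj₁ e) s h | away-ct v (proj₂ e) s k | away-val hs z = refl

  Lift : V → (Out? : ℤ → Set) → List Edge → List Edge → Set
  Lift v Out? X Y = ∀ {f} → Ach X f → Σ (V → ℤ) λ g → Ach Y g × (∀ u → u ≢ v → g u ≡ f u) × Out? (g v)

  -- Spokes are split off in pairs of opposite signs, which cancel at v. A single spoke left over
  -- becomes a dangling edge and gives ±1; a last pair gives 0, or ±2 when it is split off with
  -- equal signs.
  pairUp : ∀ v τ x N R → All (away v) (x ∷ N) → All (Away v) R →
           Σ (List Edge) λ X → (∀ {e} → e ∈ R → e ∈ X) × All (Away v) X × Lift v (Out τ) X (map (spoke v) (x ∷ N) ++ R)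
  pairUp v τ x [] R (hx ∷ []) hR = ((nothing , false) , x) ∷ R , there , ((λ ()) , hx) ∷ hR , lift
    where
    lift : Lift v (Out τ) (((nothing , false) , x) ∷ R) (spoke v x ∷ R)
    lift a with uncons a
    ... | s , g , b , h = _ , cons (spoke v x) s b , (λ u k → trans (cong (λ t → (t +ᶻ ct x s u) +ᶻ g u) (ct-≢ v false s u k)) (sym (h u)))
        , inj₁ (subst One (sym value) (one s))
      where
      one : ∀ s → One (sg s)
      one true = inj₂ refl
      one false = inj₁ refl
      gv : g v ≡ 0ℤ
      gv = trans (proj₂ b v) (away-val hR (proj₁ b))
      value : weight (spoke v x) s v +ᶻ g v ≡ sg s
      value rewrite ct-v v s | away-ct v x s hx | gv = trans (ℤₚ.+-identityʳ _) (ℤₚ.+-identityʳ _)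
  pairUp v false x (y ∷ []) R (hx ∷ hy ∷ []) hR = (x , flip y true) ∷ R , there , (hx , hy) ∷ hR , lift
    where
    lift : Lift v (Out false) ((x , flip y true) ∷ R) (spoke v x ∷ spoke v y ∷ R)
    lift {f} a = f , alternate v x y a , (λ u _ → refl) , inj₂ (trans (proj₂ a v) (away-val ((hx , hy) ∷ hR) (proj₁ a)))
  pairUp v true x (y ∷ []) R (hx ∷ hy ∷ []) hR = (x , y) ∷ R , there , (hx , hy) ∷ hR , lift
    where
    lift : Lift v (Out true) ((x , y) ∷ R) (spoke v x ∷ spoke v y ∷ R)
    lift a with uncons a
    ... | s , g , b , h = _ , cons (spoke v x) s (cons (spoke v y) s b)
        , (λ u k → trans (off u k) (sym (h u))) , inj₂ (subst Two (sym value) (two s))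
      where
      two : ∀ s → Two (sg s +ᶻ sg s)
      two true = inj₂ refl
      two false = inj₁ refl
      gv : g v ≡ 0ℤ
      gv = trans (proj₂ b v) (away-val hR (proj₁ b))
      r : ∀ a b c → (0ℤ +ᶻ a) +ᶻ ((0ℤ +ᶻ b) +ᶻ c) ≡ (a +ᶻ b) +ᶻ c
      r = solve-∀
      off : ∀ u → u ≢ v → weight (spoke v x) s u +ᶻ (weight (spoke v y) s u +ᶻ g u) ≡ weight (x , y) s u +ᶻ g u
      off u k rewrite ct-≢ v false s u k = r (ct x s u) (ct y s u) (g u)
      q : ∀ a → (a +ᶻ 0ℤ) +ᶻ ((a +ᶻ 0ℤ) +ᶻ 0ℤ) ≡ a +ᶻ a
      q = solve-∀
      value : weight (spoke v x) s v +ᶻ (weight (spoke v y) s v +ᶻ g v) ≡ sg s +ᶻ sg s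
      value rewrite ct-v v s | away-ct v x s hx | away-ct v y s hy | gv = q (sg s)
  pairUp v τ x (y ∷ w ∷ N) R (hx ∷ hy ∷ hs) hR with pairUp v τ w N R hs hR
  ... | X , sub , hX , lift = (x , flip y true) ∷ X , there ∘ sub , (hx , hy) ∷ hX , lift′
    where
    lift′ : Lift v (Out τ) ((x , flip y true) ∷ X) (spoke v x ∷ spoke v y ∷ map (spoke v) (w ∷ N) ++ R)
    lift′ a with uncons a
    ... | s , g , b , h with lift b
    ... | g′ , b′ , same , out = _ , alternate v x y (cons (x , flip y true) s b′)
        , (λ u k → trans (cong (weight (x , flip y true) s u +ᶻ_) (same u k)) (sym (h u)))
        , subst (Out τ) (sym value) out
      where
      value : weight (x , flip y true) s v +ᶻ g′ v ≡ g′ v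
      value rewrite away-ct v x s hx | away-ct v (flip y true) s hy = trans (cong (_+ᶻ g′ v) (ℤₚ.+-identityˡ 0ℤ)) (ℤₚ.+-identityˡ _)

  loop : V → Bool → Edge
  loop v γ = spoke v (at v γ)

  -- Give a loop and a spoke opposite signs: the first end of the loop cancels the spoke at v, and
  -- only its second end counts. Together they act like one spoke whose far end is twisted.
  absorb : ∀ v P x {X} → Σ Bool λ β → (spoke v (flip x β) ∷ X) ⊑ (map (loop v) P ++ spoke v x ∷ X)
  absorb v [] (a , α) = false , id
  absorb v (γ ∷ P) x {X} with absorb v P x {X}
  ... | β , k = γ xor (true xor β) , λ a → ⊑-cons (loop v γ) k (alternate v (at v γ) (flip x β)
        (spoke-flipˡ v γ (flip (flip x β) true) (subst (λ b → Ach (spoke v (proj₁ x , b) ∷ X) _) (assoc γ β (proj₂ x)) a)))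
    where
    assoc : ∀ γ β α → (γ xor (true xor β)) xor α ≡ γ xor (true xor (β xor α))
    assoc γ β α = trans (Bₚ.xor-assoc γ (true xor β) α) (cong (γ xor_) (Bₚ.xor-assoc true β α))

  -- A twisted loop gives 0 and an untwisted one ±2 at will, so choosing each sign against the
  -- running sum keeps that sum among 0 and ±2.
  loopsOnly : ∀ v P R → All (Away v) R → Lift v Rt R (map (loop v) P ++ R)
  loopsOnly v [] R hR {f} a = f , a , (λ u _ → refl) , inj₁ (trans (proj₂ a v) (away-val hR (proj₁ a)))
  loopsOnly v (γ ∷ P) R hR {f} a with loopsOnly v P R hR a
  ... | g , b , same , rt = _ , cons (loop v γ) (choose γ rt) b , (λ u k → trans (off u k) (same u k)) , val-v γ rt
    where
    choose : Bool → Rt (g v) → Bool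
    choose γ (inj₁ _) = false
    choose γ (inj₂ (inj₁ _)) = true
    choose γ (inj₂ (inj₂ _)) = false
    off : ∀ u → u ≢ v → weight (loop v γ) (choose γ rt) u +ᶻ g u ≡ g u
    off u k rewrite ct-≢ v false (choose γ rt) u k | ct-≢ v γ (choose γ rt) u k = trans (cong (_+ᶻ g u) (ℤₚ.+-identityˡ 0ℤ)) (ℤₚ.+-identityˡ _)
    val-v : ∀ γ (rt : Rt (g v)) → Rt (weight (loop v γ) (choose γ rt) v +ᶻ g v)
    val-v true (inj₁ e) rewrite ==-refl v | e = inj₁ refl
    val-v false (inj₁ e) rewrite ==-refl v | e = inj₂ (inj₁ refl)
    val-v true (inj₂ (inj₁ e)) rewrite ==-refl v | e = inj₂ (inj₁ refl)
    val-v false (inj₂ (inj₁ e)) rewrite ==-refl v | e = inj₁ refl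
    val-v true (inj₂ (inj₂ e)) rewrite ==-refl v | e = inj₂ (inj₂ refl)
    val-v false (inj₂ (inj₂ e)) rewrite ==-refl v | e = inj₁ refl

  Link : V → Edge → Set
  Link v (x , y) = (proj₁ x ≡ just v × away v y) ⊎ (proj₁ y ≡ just v × away v x)

  -- A normal form of E seen from v: `P` lists the twists of the loops, `N` the far ends of the
  -- spokes, `R` the edges that miss v.
  record Split (v : V) (E : List Edge) : Set where
    field
      N    : List End
      P    : List Bool
      R    : List Edge
      N-ok : All (away v) N
      R-ok : All (Away v) R
      keep : ∀ {e} → e ∈ E → Away v e → e ∈ R
      link : ∀ {e} → e ∈ E → Link v e → N ≢ []
      back : (map (loop v) P ++ map (spoke v) N ++ R) ⊑ E

  split : ∀ v E → Split v E
  split v [] = record { N = [] ; P = [] ; R = [] ; N-ok = [] ; R-ok = [] ; keep = λ () ; link = λ () ; back = id }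
  split v ((x , y) ∷ E) with split v E | Mₚ.≡-dec F._≟_ (proj₁ x) (just v) | Mₚ.≡-dec F._≟_ (proj₁ y) (just v)
  ... | S | yes p | yes q = record
    { N = S.N ; P = (proj₂ x xor proj₂ y) ∷ S.P ; R = S.R ; N-ok = S.N-ok ; R-ok = S.R-ok
    ; keep = λ { (here refl) (k , _) → ⊥-elim (k p) ; (there i) k → S.keep i k }
    ; link = λ { (here refl) (inj₁ (_ , k)) → ⊥-elim (k q) ; (here refl) (inj₂ (_ , k)) → ⊥-elim (k p) ; (there i) k → S.link i k }
    ; back = λ a → subst (λ m → Ach (((m , proj₂ x) , y) ∷ E) _) (sym p)
        (spoke-flipˡ v (proj₂ x) y (⊑-cons _ S.back (subst (λ m → Ach (spoke v (m , proj₂ x xor proj₂ y) ∷ _) _) (sym q) a))) }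
    where module S = Split S
  ... | S | yes p | no q = record
    { N = flip y (proj₂ x) ∷ S.N ; P = S.P ; R = S.R ; N-ok = q ∷ S.N-ok ; R-ok = S.R-ok
    ; keep = λ { (here refl) (k , _) → ⊥-elim (k p) ; (there i) k → S.keep i k }
    ; link = λ _ _ ()
    ; back = λ a → subst (λ m → Ach (((m , proj₂ x) , y) ∷ E) _) (sym p)
        (spoke-flipˡ v (proj₂ x) y (⊑-cons _ S.back (⊑-front (map (loop v) S.P) _ a))) }
    where module S = Split S
  ... | S | no p | yes q = record
    { N = flip x (proj₂ y) ∷ S.N ; P = S.P ; R = S.R ; N-ok = p ∷ S.N-ok ; R-ok = S.R-ok
    ; keep = λ { (here refl) (_ , k) → ⊥-elim (k q) ; (there i) k → S.keep i k }
    ; link = λ _ _ ()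
    ; back = λ a → subst (λ m → Ach ((x , (m , proj₂ y)) ∷ E) _) (sym q)
        (spoke-flipʳ v (proj₂ y) x (⊑-cons _ S.back (⊑-front (map (loop v) S.P) _ a))) }
    where module S = Split S
  ... | S | no p | no q = record
    { N = S.N ; P = S.P ; R = (x , y) ∷ S.R ; N-ok = S.N-ok ; R-ok = (p , q) ∷ S.R-ok
    ; keep = λ { (here refl) _ → here refl ; (there i) k → there (S.keep i k) }
    ; link = λ { (here refl) (inj₁ (k , _)) → ⊥-elim (p k) ; (here refl) (inj₂ (k , _)) → ⊥-elim (q k) ; (there i) k → S.link i k }
    ; back = λ a → ⊑-cons _ S.back (⊑-front (map (loop v) S.P) _ (front₂ a)) }
    where
    module S = Split S
    front₂ : (map (loop v) S.P ++ map (spoke v) S.N ++ (x , y) ∷ S.R) ⊑ (map (loop v) S.P ++ (x , y) ∷ map (spoke v) S.N ++ S.R)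
    front₂ = go (map (loop v) S.P)
      where
      go : ∀ l → (l ++ map (spoke v) S.N ++ (x , y) ∷ S.R) ⊑ (l ++ (x , y) ∷ map (spoke v) S.N ++ S.R)
      go [] = ⊑-front (map (spoke v) S.N) (x , y)
      go (e ∷ l) = ⊑-cons e (go l)

  Elimination : V → Bool → List Edge → Set
  Elimination v τ E = Σ (List Edge) λ X → (∀ {e} → e ∈ E → Away v e → e ∈ X)
    × Lift v (λ z → Out τ z ⊎ ((∀ {e} → e ∈ E → ¬ Link v e) × Rt z)) X E

  -- If there is a spoke, it absorbs all the loops and `pairUp` yields the prescribed outcome.
  -- Without a spoke only loops remain, and the weaker `Rt` is all that is claimed.
  eliminate : ∀ v τ E → Elimination v τ E
  eliminate v τ E = go (Split.N S) (Split.N-ok S) refl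
    where
    S = split v E
    module S = Split S
    go : ∀ N → All (away v) N → S.N ≡ N → Elimination v τ E
    go [] _ e = S.R , S.keep , λ a → let (g , b , same , rt) = loopsOnly v S.P S.R S.R-ok a in
      g , S.back (subst (λ N → Ach (map (loop v) S.P ++ map (spoke v) N ++ S.R) g) (sym e) b) , same
        , inj₂ ((λ i k → S.link i k e) , rt)
    go (x ∷ N) (hx ∷ hN) e with absorb v S.P x {map (spoke v) N ++ S.R}
    ... | β , ab with pairUp v τ (flip x β) N S.R (hx ∷ hN) S.R-ok
    ... | X , sub , _ , lift = X , (λ i k → sub (S.keep i k)) , λ a → let (g , b , same , out) = lift a in
      g , S.back (subst (λ N → Ach (map (loop v) S.P ++ map (spoke v) N ++ S.R) g) (sym e) (ab b)) , same , inj₁ out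

  Joins : V → V → Edge → Set
  Joins v w ((a , _) , (b , _)) = (a ≡ just v × b ≡ just w) ⊎ (a ≡ just w × b ≡ just v)

  -- Vertices are eliminated from the head of L; a vertex that is not free has a neighbour later in L,
  -- hence an edge other than loops when its turn comes.
  data Ordered (Free : V → Set) (E : List Edge) : List V → Set where
    []  : Ordered Free E []
    _∷_ : ∀ {v L} → ¬ (v ∈ L) × (Free v ⊎ (∃[ w ] ∃[ e ] (w ∈ L × e ∈ E × Joins v w e))) → Ordered Free E L → Ordered Free E (v ∷ L)

  -- An edge witnessing the order has both ends in L, hence misses v and survives its elimination.
  Ordered-⊆ : ∀ {Free E X v L} → (∀ {e} → e ∈ E → Away v e → e ∈ X) → ¬ (v ∈ L) → Ordered Free E L → Ordered Free X L
  Ordered-⊆ k v∉ [] = []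
  Ordered-⊆ {v = v} k v∉ (_∷_ {u} {L} (u∉ , inj₁ f) o) = (u∉ , inj₁ f) ∷ Ordered-⊆ k (v∉ ∘ there) o
  Ordered-⊆ {v = v} k v∉ (_∷_ {u} {L} (u∉ , inj₂ (w , e , w∈ , e∈ , j)) o) =
    (u∉ , inj₂ (w , e , w∈ , k e∈ (aw {e} j) , j)) ∷ Ordered-⊆ k (v∉ ∘ there) o
    where
    u≢ : ∀ {x y : V} → x ∈ (u ∷ L) → y ≡ v → just x ≢ just y
    u≢ i refl refl = v∉ i
    aw : ∀ {e} → Joins u w e → Away v e
    aw (inj₁ (refl , refl)) = u≢ (here refl) refl , u≢ (there w∈) refl
    aw (inj₂ (refl , refl)) = u≢ (there w∈) refl , u≢ (here refl) refl

  -- Vertices are eliminated down the list and restored on the way back. Restoring v changes the sum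
  -- at v only, so what was obtained for the later vertices persists.
  signing : ∀ {Free : V → Set} (τ : V → Bool) L E → Ordered Free E L →
            Σ (V → ℤ) λ g → Ach E g × (∀ v → v ∈ L → Out (τ v) (g v) ⊎ (Free v × Rt (g v)))
  signing τ [] E [] = _ , (Data.List.Relation.Unary.All.universal (λ _ → true) E , λ u → refl) , λ v ()
  signing {Free} τ (v ∷ L) E ((v∉ , fr) ∷ o) with eliminate v (τ v) E
  ... | X , keep , lift with signing τ L X (Ordered-⊆ keep v∉ o)
  ... | f , a , spec with lift a
  ... | g , b , same , out = g , b , λ { u (here refl) → fin fr out ; u (there i) → subst (λ z → Out (τ u) z ⊎ (Free u × Rt z))
        (sym (same u (λ { refl → v∉ i }))) (spec u i) }
    where
    fin : Free v ⊎ (∃[ w ] ∃[ e ] (w ∈ L × e ∈ E × Joins v w e)) →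
          Out (τ v) (g v) ⊎ ((∀ {e} → e ∈ E → ¬ Link v e) × Rt (g v)) → Out (τ v) (g v) ⊎ (Free v × Rt (g v))
    fin _ (inj₁ q) = inj₁ q
    fin (inj₁ p) (inj₂ (_ , rt)) = inj₂ (p , rt)
    fin (inj₂ (w , e , w∈ , e∈ , j)) (inj₂ (none , _)) = ⊥-elim (none e∈ (lk {e} j))
      where
      w≢v : just w ≢ just v
      w≢v refl = v∉ w∈
      lk : ∀ {e} → Joins v w e → Link v e
      lk (inj₁ (refl , refl)) = inj₁ (refl , w≢v)
      lk (inj₂ (refl , refl)) = inj₂ (refl , w≢v)

-- Elimination orders and signings of a bipartite graph.

data Order {n} (Free : Fin n → Set) (R : Rel n) : List (Fin n) → Set where
  []  : Order Free R []
  _∷_ : ∀ {v L} → ¬ (v ∈ L) × (Free v ⊎ (∃[ w ] (w ∈ L × R v w ≡ true))) → Order Free R L → Order Free R (v ∷ L)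

-- Each new vertex belongs to the base or is adjacent to a listed one, and it goes to the front:
-- elimination runs against the growth, so the neighbour is still there when the vertex is removed.
order : ∀ {n} (R : Rel n) (base : Fin n → Bool) → (∀ v → ∃[ r ] (Path R v r × base r ≡ true)) →
        Σ (List (Fin n)) λ L → Order (λ v → base v ≡ true) R L × (∀ v → v ∈ L)
order {n} R base reach-base = grow _ [] (λ _ → false) ℕₚ.≤-refl [] (λ _ ()) (λ _ ())
  where
  Goal = Σ (List (Fin n)) λ L → Order (λ v → base v ≡ true) R L × (∀ v → v ∈ L)
  grow : ∀ k L (S : Fin n → Bool) → # (not ∘ S) ≤ k → Order (λ v → base v ≡ true) R L →
         (∀ v → S v ≡ true → v ∈ L) → (∀ v → v ∈ L → S v ≡ true) → Goal
  grow k L S le o to from with Fₚ.any? (λ v → (S v Bₚ.≟ false) ×-dec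
      ((base v Bₚ.≟ true) ⊎-dec Fₚ.any? (λ w → (S w Bₚ.≟ true) ×-dec (R v w Bₚ.≟ true))))
  ... | no stuck = L , o , λ v → to v (all v)
    where
    outside : ∀ {v} → S v ≡ false → ∀ {y} → Path R v y → S y ≡ false
    outside f stop = f
    outside f (step {x} {y} p r) = ¬true λ t → stuck (x , outside f p , inj₂ (y , t , r))
    all : ∀ v → S v ≡ true
    all v with true⊎false (S v)
    ... | inj₁ t = t
    ... | inj₂ f = let (r , p , b) = reach-base v in ⊥-elim (stuck (r , outside f p , inj₁ b))
  ... | yes (v , Sv , link) = next k le
    where
    S′ : Fin n → Bool
    S′ z = S z ∨ (z == v)
    less : # (not ∘ S′) < # (not ∘ S)
    less = #-strict v (λ i h → not-false (¬true λ t → true≢false (∨-introˡ {b = i == v} t) (not-true h)))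
             (cong not (∨-introʳ {S v} (==-refl v))) (not-false Sv)
    v∉ : ¬ (v ∈ L)
    v∉ i = true≢false (from v i) Sv
    fr : (base v ≡ true) ⊎ (∃[ w ] (S w ≡ true × R v w ≡ true)) → (base v ≡ true) ⊎ (∃[ w ] (w ∈ L × R v w ≡ true))
    fr (inj₁ b) = inj₁ b
    fr (inj₂ (w , s , r)) = inj₂ (w , to w s , r)
    next : ∀ k → # (not ∘ S) ≤ k → Goal
    next zero le = ⊥-elim (ℕₚ.n≮0 (ℕₚ.<-≤-trans less le))
    next (suc k) le = grow k (v ∷ L) S′ (ℕ.s≤s⁻¹ (ℕₚ.<-≤-trans less le)) ((v∉ , fr link) ∷ o)
      (λ z h → [ (λ s → there (to z s)) , (λ e → here (==-≡ e)) ]′ (∨-true h))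
      (λ { z (here refl) → ∨-introʳ {S z} (==-refl z) ; z (there i) → ∨-introˡ (from z i) })

Equal One Two : ℕ → ℕ → Set
Equal h k = h ≡ k
One h k = h ≡ 1 + k ⊎ k ≡ 1 + h
Two h k = h ≡ 2 + k ⊎ k ≡ 2 + h

plus minus : ∀ {n} → Rel n → Rel n → Rel n
plus R x u v = R u v ∧ x u v
minus R x u v = R u v ∧ not (x u v)

module _ {n} (side : Fin n → Bool) (R : Rel n) (sy : Symm R) (bip : Bip side R) where

  open Signing {n} hiding (One; Two)
  open Int using (0ℤ) renaming (_+_ to _+ᶻ_; -_ to -ᶻ_; _-_ to _-ᶻ_)

  private
    V = Fin n

    -- Each edge is listed once, with its end in A first.
    cond : V → V → Bool
    cond a b = R a b ∧ side a

    the-edge : V → V → Edge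
    the-edge a b = (just a , false) , (just b , false)

    edgesOf : V → V → List Edge
    edgesOf a b = if cond a b then the-edge a b ∷ [] else []

    E₀ : List Edge
    E₀ = concat (tabulate (λ a → concat (tabulate (edgesOf a))))

    Ach-++ : ∀ xs {ys f} → Ach (xs ++ ys) f → Σ (V → ℤ) λ g → Σ (V → ℤ) λ h → Ach xs g × Ach ys h × (∀ u → f u ≡ g u +ᶻ h u)
    Ach-++ [] {f = f} a = (λ _ → 0ℤ) , f , ([] , λ _ → refl) , a , λ u → sym (ℤₚ.+-identityˡ (f u))
    Ach-++ (x ∷ xs) a with uncons a
    ... | s , k , b , eq with Ach-++ xs b
    ... | g , h , ag , ah , eq′ = _ , h , cons x s ag , ah , λ u → trans (eq u) (trans (cong (weight x s u +ᶻ_) (eq′ u))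
            (sym (ℤₚ.+-assoc (weight x s u) (g u) (h u))))

    Ach-concat : ∀ {m} (es : Fin m → List Edge) {f} → Ach (concat (tabulate es)) f →
                 Σ (Fin m → V → ℤ) λ fs → (∀ i → Ach (es i) (fs i)) × (∀ u → f u ≡ ℤΣ.sum (λ i → fs i u))
    Ach-concat {zero} es ([] , h) = (λ ()) , (λ ()) , h
    Ach-concat {suc m} es a with Ach-++ (es zero) a
    ... | g , h , ag , ah , eq with Ach-concat (es ∘ suc) ah
    ... | fs , as , eq′ = (λ { zero → g ; (suc i) → fs i }) , (λ { zero → ag ; (suc i) → as i })
        , λ u → trans (eq u) (cong (g u +ᶻ_) (eq′ u))

    Σ-delta : ∀ {m} (u : Fin m) (K : ℤ) → ℤΣ.sum (λ a → if a == u then K else 0ℤ) ≡ K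
    Σ-delta {suc m} zero K = trans (cong (K +ᶻ_) (ℤΣ.sum-replicate-zero m)) (ℤₚ.+-identityʳ K)
    Σ-delta {suc m} (suc u) K = trans (ℤₚ.+-identityˡ _) (trans (ℤΣ.sum-cong-≗ (λ a → cong (if_then K else 0ℤ) (suc-== a u))) (Σ-delta u K))

    Σ-signs : ∀ {m} (r s : Fin m → Bool) → ℤΣ.sum (λ v → if r v then sg (s v) else 0ℤ)
              ≡ Int.+ (# (λ v → r v ∧ not (s v))) -ᶻ Int.+ (# (λ v → r v ∧ s v))
    Σ-signs {zero} r s = refl
    Σ-signs {suc m} r s rewrite Σ-signs (r ∘ suc) (s ∘ suc) = go (r zero) (s zero) _ _
      where
      solve₁ : ∀ P M → Int.+ 1 +ᶻ (P -ᶻ M) ≡ (Int.+ 1 +ᶻ P) -ᶻ M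
      solve₁ = solve-∀
      solve₂ : ∀ P M → -ᶻ (Int.+ 1) +ᶻ (P -ᶻ M) ≡ P -ᶻ (Int.+ 1 +ᶻ M)
      solve₂ = solve-∀
      go : ∀ a b P M → (if a then sg b else 0ℤ) +ᶻ (Int.+ P -ᶻ Int.+ M)
           ≡ Int.+ (b2n (a ∧ not b) + P) -ᶻ Int.+ (b2n (a ∧ b) + M)
      go true true P M = solve₂ (Int.+ P) (Int.+ M)
      go true false P M = solve₁ (Int.+ P) (Int.+ M)
      go false b P M = ℤₚ.+-identityˡ _

    cond-true : ∀ {a b} → R a b ≡ true → side a ≡ true → cond a b ≡ true
    cond-true r s = ∧-intro r s

    single : ∀ {a b f} → Ach (edgesOf a b) f → Σ Bool λ s → ∀ u → f u ≡ (if cond a b then weight (the-edge a b) s u else 0ℤ)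
    single {a} {b} ac with cond a b
    single (s ∷ [] , h) | true = s , λ u → trans (h u) (ℤₚ.+-identityʳ _)
    single ([] , h) | false = true , h

    Cells : (V → ℤ) → Set
    Cells g = Σ (V → V → V → ℤ) λ f → Σ (V → V → Bool) λ X →
      (∀ a b u → f a b u ≡ (if cond a b then weight (the-edge a b) (X a b) u else 0ℤ))
      × (∀ u → g u ≡ ℤΣ.sum (λ a → ℤΣ.sum (λ b → f a b u)))

    cells : ∀ {g} → Ach E₀ g → Cells g
    cells ac with Ach-concat (λ a → concat (tabulate (edgesOf a))) ac
    ... | fs , as , total = (λ a b → proj₁ (cell a) b) , (λ a b → proj₁ (sgl a b)) , (λ a b → proj₂ (sgl a b))
        , λ u → trans (total u) (ℤΣ.sum-cong-≗ (λ a → proj₂ (proj₂ (cell a)) u))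
      where
      cell : ∀ a → _
      cell a = Ach-concat (edgesOf a) (as a)
      sgl : ∀ a b → _
      sgl a b = single {a} {b} (proj₁ (proj₂ (cell a)) b)

    module Values {g : V → ℤ} (f : V → V → V → ℤ) (X : V → V → Bool)
      (sgl : ∀ a b u → f a b u ≡ (if cond a b then weight (the-edge a b) (X a b) u else 0ℤ))
      (total : ∀ u → g u ≡ ℤΣ.sum (λ a → ℤΣ.sum (λ b → f a b u))) where
      s : V → V → Bool
      s u v = if side u then X u v else X v u

      at-A : ∀ u → side u ≡ true → ∀ a b → f a b u ≡ (if a == u then (if R u b then sg (s u b) else 0ℤ) else 0ℤ)
      at-A u su a b = trans (sgl a b u) (go (true⊎false (cond a b)))
        where
        go : cond a b ≡ true ⊎ cond a b ≡ false → (if cond a b then weight (the-edge a b) (X a b) u else 0ℤ)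
             ≡ (if a == u then (if R u b then sg (s u b) else 0ℤ) else 0ℤ)
        go (inj₁ t) rewrite t | ==-≢ {i = b} {u} (λ { refl → bip a b (proj₁ (∧-true t)) (trans (proj₂ (∧-true {R a b} t)) (sym su)) })
          with a F.≟ u
        ... | yes refl rewrite proj₁ (∧-true {R a b} t) | su | Bₚ.xor-identityʳ (X a b) = ℤₚ.+-identityʳ _
        ... | no _ = refl
        go (inj₂ e) rewrite e with a F.≟ u
        ... | no _ = refl
        ... | yes refl rewrite ¬true {R a b} (λ r → true≢false (cond-true r su) e) = refl

      at-B : ∀ u → side u ≡ false → ∀ a b → f a b u ≡ (if b == u then (if R u a then sg (s u a) else 0ℤ) else 0ℤ)
      at-B u su a b = trans (sgl a b u) (go (true⊎false (cond a b)))
        where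
        go : cond a b ≡ true ⊎ cond a b ≡ false → (if cond a b then weight (the-edge a b) (X a b) u else 0ℤ)
             ≡ (if b == u then (if R u a then sg (s u a) else 0ℤ) else 0ℤ)
        go (inj₁ t) rewrite t | ==-≢ {i = a} {u} (λ { refl → true≢false (proj₂ (∧-true {R a b} t)) su })
          with b F.≟ u
        ... | yes refl rewrite trans (sy b a) (proj₁ (∧-true {R a b} t)) | su | Bₚ.xor-identityʳ (X a b) = ℤₚ.+-identityˡ _
        ... | no _ = refl
        go (inj₂ e) rewrite e with b F.≟ u
        ... | no _ = refl
        ... | yes refl = sym (cong (if_then sg (s b a) else 0ℤ) {x = R b a} {y = false} (¬true λ r → true≢false (cond-true (trans (sy a b) r) (Bₚ.¬-not (λ e′ → bip b a r (trans su (sym e′))))) e))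

      -- In the double sum only the row of u contributes when u is in A, and only its column when u
      -- is in B.
      collapse : ∀ u → g u ≡ ℤΣ.sum (λ v → if R u v then sg (s u v) else 0ℤ)
      collapse u = trans (total u) (go (true⊎false (side u)))
        where
        go : side u ≡ true ⊎ side u ≡ false → ℤΣ.sum (λ a → ℤΣ.sum (λ b → f a b u)) ≡ ℤΣ.sum (λ v → if R u v then sg (s u v) else 0ℤ)
        go (inj₁ t) = trans (ℤΣ.∑-comm (λ a b → f a b u)) (ℤΣ.sum-cong-≗ (λ b →
          trans (ℤΣ.sum-cong-≗ (λ a → at-A u t a b)) (Σ-delta u (if R u b then sg (s u b) else 0ℤ))))
        go (inj₂ e) = ℤΣ.sum-cong-≗ (λ a →
          trans (ℤΣ.sum-cong-≗ (λ b → at-B u e a b)) (Σ-delta u (if R u a then sg (s u a) else 0ℤ)))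

    ordered : ∀ {Free L} → Order Free R L → Ordered Free E₀ L
    ordered [] = []
    ordered ((v∉ , inj₁ p) ∷ o) = (v∉ , inj₁ p) ∷ ordered o
    ordered (_∷_ {v} (v∉ , inj₂ (w , w∈ , r)) o) = (v∉ , inj₂ (w , lk (true⊎false (side v)))) ∷ ordered o
      where
      mem : ∀ a b → cond a b ≡ true → the-edge a b ∈ E₀
      mem a b t = ∈-concat⁺′ (∈-concat⁺′ here-ab (∈-tabulate⁺ {f = edgesOf a} b)) (∈-tabulate⁺ {f = λ a → concat (tabulate (edgesOf a))} a)
        where
        here-ab : the-edge a b ∈ edgesOf a b
        here-ab rewrite t = here refl
      lk : side v ≡ true ⊎ side v ≡ false → ∃[ e ] (w ∈ _ × e ∈ E₀ × Joins v w e)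
      lk (inj₁ t) = the-edge v w , w∈ , mem v w (cond-true r t) , inj₁ (refl , refl)
      lk (inj₂ e) = the-edge w v , w∈ , mem w v (cond-true (trans (sy w v) r) (Bₚ.¬-not (λ e′ → bip v w r (trans e (sym e′))))) , inj₂ (refl , refl)

    diff : ∀ h k d → Int.+ h -ᶻ Int.+ k ≡ Int.+ d → h ≡ d + k
    diff h k d e = ℤₚ.+-injective (trans (lem (Int.+ h) (Int.+ k)) (cong (_+ᶻ Int.+ k) e))
      where
      lem : ∀ a b → a ≡ (a -ᶻ b) +ᶻ b
      lem = solve-∀

    diff⁻ : ∀ h k d → Int.+ h -ᶻ Int.+ k ≡ -ᶻ (Int.+ d) → k ≡ d + h
    diff⁻ h k d e = diff k h d (trans (lem (Int.+ h) (Int.+ k)) (trans (cong -ᶻ_ e) (ℤₚ.neg-involutive (Int.+ d))))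
      where
      lem : ∀ a b → b -ᶻ a ≡ -ᶻ (a -ᶻ b)
      lem = solve-∀

  -- Initially no end is twisted, so the sum at a vertex is the difference of its two class sizes.
  -- Taking `not ∘ side` for τ asks for 0 at even vertices of A and ±2 at even vertices of B.
  sign-graph : ∀ {Free L} → Order Free R L → (∀ v → v ∈ L) → Σ (Rel n) λ x → Symm x × (∀ v →
    let h = # (plus R x v) ; k = # (minus R x v) in
    (One h k ⊎ (if side v then Equal h k else Two h k)) ⊎ (Free v × (Equal h k ⊎ Two h k)))
  sign-graph {Free} {L} o cover with signing (not ∘ side) L E₀ (ordered o)
  ... | g , ac , spec with cells ac
  ... | f , X , sgl , total = x , xsym , λ v → conv v (spec v (cover v))
    where
    open Values f X sgl total
    x : Rel n
    -- `X` is indexed with the end in A first; the sign +1 is encoded there by `false`, hence the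
    -- negation.
    x u v = if side u then (if side v then true else not (X u v)) else (if side v then not (X v u) else true)
    xsym : Symm x
    xsym u v with side u | side v
    ... | true | true = refl
    ... | true | false = refl
    ... | false | true = refl
    ... | false | false = refl
    x-s : ∀ u v → side u ≢ side v → x u v ≡ not (s u v)
    x-s u v h with side u | side v
    ... | true | true = ⊥-elim (h refl)
    ... | true | false = refl
    ... | false | true = refl
    ... | false | false = ⊥-elim (h refl)
    on : ∀ u v (k : Bool → Bool) → R u v ∧ k (x u v) ≡ R u v ∧ k (not (s u v))
    on u v k with R u v in r
    ... | true = cong k (x-s u v (bip u v r))
    ... | false = refl
    value : ∀ v → g v ≡ Int.+ # (plus R x v) -ᶻ Int.+ # (minus R x v)
    value v = trans (collapse v) (trans (Σ-signs (R v) (s v)) (sym (cong₂ (λ a b → Int.+ a -ᶻ Int.+ b)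
      (#-cong {f = plus R x v} {λ w → R v w ∧ not (s v w)} (λ w → on v w id))
      (#-cong {f = minus R x v} {λ w → R v w ∧ s v w} (λ w → trans (on v w not) (cong (R v w ∧_) (Bₚ.not-involutive (s v w))))))))
    conv : ∀ v → Signing.Out {n} (not (side v)) (g v) ⊎ (Free v × Signing.Rt {n} (g v)) → _
    conv v = [ (λ o → inj₁ ([ (λ p → inj₁ (one p)) , (λ q → inj₂ (even (side v) q)) ]′ o))
             , (λ { (fr , rt) → inj₂ (fr , [ (λ z → inj₁ (diff _ _ 0 (trans (sym (value v)) z))) , (λ t → inj₂ (two t)) ]′ rt) }) ]′
      where
      one : Signing.One {n} (g v) → One (# (plus R x v)) (# (minus R x v))
      one = [ (λ e → inj₁ (diff _ _ 1 (trans (sym (value v)) e))) , (λ e → inj₂ (diff⁻ _ _ 1 (trans (sym (value v)) e))) ]′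
      two : Signing.Two {n} (g v) → Two (# (plus R x v)) (# (minus R x v))
      two = [ (λ e → inj₁ (diff _ _ 2 (trans (sym (value v)) e))) , (λ e → inj₂ (diff⁻ _ _ 2 (trans (sym (value v)) e))) ]′
      even : ∀ b → (if not b then Signing.Two {n} (g v) else g v ≡ 0ℤ) →
             (if b then Equal (# (plus R x v)) (# (minus R x v)) else Two (# (plus R x v)) (# (minus R x v)))
      even true z = diff _ _ 0 (trans (sym (value v)) z)
      even false t = two t

path-trans : ∀ {n} {R : Rel n} {u v w} → Path R u v → Path R v w → Path R u w
path-trans p stop = p
path-trans p (step q r) = step (path-trans p q) r

path-sym : ∀ {n} {R : Rel n} → Symm R → ∀ {u v} → Path R u v → Path R v u
path-sym sy stop = stop
path-sym sy (step {x} {y} p r) = path-trans (step stop (trans (sy y x) r)) (path-sym sy p)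

abstract
  path? : ∀ {n} (R : Rel n) u v → Dec (Path R u v)
  path? R u v with reach R u
  ... | S , to , from with true⊎false (S v)
  ... | inj₁ t = yes (to v t)
  ... | inj₂ f = no (λ p → true≢false (from v p) f)

par : ℕ → Bool
par zero = false
par (suc k) = not (par k)

-- The matching

module Matchings {n} (G : Graph n) where

  Same : Fin n → Fin n → Set
  Same u v = Adj G u v × deg G u ≡ deg G v

  same? : ∀ u v → Dec (Same u v)
  same? u v = (adj G u v Bₚ.≟ true) ×-dec (deg G u ℕₚ.≟ deg G v)

  Same-sym : ∀ {u v} → Same u v → Same v u
  Same-sym {u} {v} (a , d) = trans (adj-sym G v u) a , sym d

  adj-≢ : ∀ {u v} → Adj G u v → u ≢ v
  adj-≢ {u} a refl = true≢false a (adj-irr G u)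

  record Matching : Set where
    field
      m     : Fin n → Maybe (Fin n)
      m-sym : ∀ {u v} → m u ≡ just v → m v ≡ just u
      m-adj : ∀ {u v} → m u ≡ just v → Same u v

    cov : Fin n → Bool
    cov u = is-just (m u)

    -- This is the parity of the degree in `rest`, as `par-rest` confirms.
    odd : Fin n → Bool
    odd u = par (deg G u) xor cov u

    rest : Rel n
    rest u v = adj G u v ∧ not (is (m u) v)

    rest-intro : ∀ {u v} → Adj G u v → m u ≢ just v → rest u v ≡ true
    rest-intro a h = ∧-intro a (not-false (≢-is h))

    rest-elim : ∀ {u v} → rest u v ≡ true → Adj G u v × m u ≢ just v
    rest-elim {u} {v} e = let (a , b) = ∧-true {adj G u v} e in a , λ h → true≢false (≡-is h) (not-true b)

    rest-sym : Symm rest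
    rest-sym u v = bool-ext (go u v) (go v u)
      where
      go : ∀ u v → rest u v ≡ true → rest v u ≡ true
      go u v e = let (a , h) = rest-elim e in rest-intro (trans (adj-sym G v u) a) (λ k → h (m-sym k))

    -- A condition on the whole component of u in `rest`, not on u alone.
    Even : Fin n → Set
    Even u = ∀ x → Path rest u x → odd x ≡ false

    even? : ∀ u → Dec (Even u)
    even? u = Fₚ.all? (λ x → path? rest u x →-dec (odd x Bₚ.≟ false))

    Even-path : ∀ {u v} → Path rest u v → Even u → Even v
    Even-path p e x q = e x (path-trans p q)

    OddConf : Fin n → Fin n → Set
    OddConf u v = Same u v × cov u ≡ cov v × odd u ≡ true

    -- The invariant of the toggling. Pairs that class sizes might fail to separate are either
    -- matched to each other or both unmatched, the two states a toggle produces, and no other odd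
    -- vertex shares their components.
    Isolated : Set
    Isolated = ∀ u v → OddConf u v → (m u ≡ just v ⊎ m u ≡ nothing)
      × (∀ x → Path rest u x ⊎ Path rest v x → x ≡ u ⊎ x ≡ v ⊎ odd x ≡ false)

    same-parity : ∀ {u v} → deg G u ≡ deg G v → cov u ≡ cov v → odd u ≡ odd v
    same-parity d c = cong₂ (λ k b → par k xor b) d c

  open Matching

  record Toggled (M M′ : Matching) (u v : Fin n) : Set where
    field
      off  : ∀ {x} → x ≢ u → x ≢ v → m M′ x ≡ m M x
      flip : (m M u ≡ just v × m M v ≡ just u × m M′ u ≡ nothing × m M′ v ≡ nothing)
           ⊎ (m M u ≡ nothing × m M v ≡ nothing × m M′ u ≡ just v × m M′ v ≡ just u)

  module _ (M : Matching) (u v : Fin n) (s : Same u v) where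

    private
      u≢v : u ≢ v
      u≢v = adj-≢ (proj₁ s)

    addEdge : m M u ≡ nothing → m M v ≡ nothing → Σ Matching λ M′ → Toggled M M′ u v
    addEdge mu mv = record { m = m′ ; m-sym = λ {x} {y} → sy x y ; m-adj = λ {x} {y} → ad x y } , record
      { off = λ {x} h k → away x h k ; flip = inj₂ (mu , mv , at-u , at-v) }
      where
      m′ : Fin n → Maybe (Fin n)
      m′ x = if x == u then just v else if x == v then just u else m M x
      away : ∀ x → x ≢ u → x ≢ v → m′ x ≡ m M x
      away x h k rewrite ==-≢ h | ==-≢ k = refl
      at-u : m′ u ≡ just v
      at-u rewrite ==-refl u = refl
      at-v : m′ v ≡ just u
      at-v rewrite ==-≢ {i = v} {u} (u≢v ∘ sym) | ==-refl v = refl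
      sy : ∀ x y → m′ x ≡ just y → m′ y ≡ just x
      sy x y e with x F.≟ u
      sy x y refl | yes refl = at-v
      ... | no h with x F.≟ v
      sy x y refl | no h | yes refl = at-u
      ... | no k = trans (away y (λ { refl → just≢nothing (m-sym M e) mu }) (λ { refl → just≢nothing (m-sym M e) mv })) (m-sym M e)
      ad : ∀ x y → m′ x ≡ just y → Same x y
      ad x y e with x F.≟ u
      ad x y refl | yes refl = s
      ... | no h with x F.≟ v
      ad x y refl | no h | yes refl = Same-sym s
      ... | no k = m-adj M e

    removeEdge : m M u ≡ just v → Σ Matching λ M′ → Toggled M M′ u v
    removeEdge mu = record { m = m′ ; m-sym = λ {x} {y} → sy x y ; m-adj = λ {x} {y} → ad x y } , record
      { off = λ {x} h k → away x h k ; flip = inj₁ (mu , m-sym M mu , at-u , at-v) }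
      where
      m′ : Fin n → Maybe (Fin n)
      m′ x = if x == u then nothing else if x == v then nothing else m M x
      away : ∀ x → x ≢ u → x ≢ v → m′ x ≡ m M x
      away x h k rewrite ==-≢ h | ==-≢ k = refl
      at-u : m′ u ≡ nothing
      at-u rewrite ==-refl u = refl
      at-v : m′ v ≡ nothing
      at-v rewrite ==-≢ {i = v} {u} (u≢v ∘ sym) | ==-refl v = refl
      sy : ∀ x y → m′ x ≡ just y → m′ y ≡ just x
      sy x y e with x F.≟ u
      sy x y () | yes refl
      ... | no h with x F.≟ v
      sy x y () | no h | yes refl
      ... | no k = trans (away y (λ { refl → k (Mₚ.just-injective (trans (sym (m-sym M e)) mu)) })
                              (λ { refl → h (Mₚ.just-injective (trans (sym (m-sym M e)) (m-sym M mu))) })) (m-sym M e)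
      ad : ∀ x y → m′ x ≡ just y → Same x y
      ad x y e with x F.≟ u
      ad x y () | yes refl
      ... | no h with x F.≟ v
      ad x y () | no h | yes refl
      ... | no k = m-adj M e

  module Toggling {M M′ : Matching} {u v : Fin n} (s : Same u v) (T : Toggled M M′ u v)
                  (Eu : Even M u) (Ev : Even M v) (iso : Isolated M) where
    open Toggled T

    split-uv : ∀ x → x ≡ u ⊎ x ≡ v ⊎ (x ≢ u × x ≢ v)
    split-uv x with x F.≟ u | x F.≟ v
    ... | yes e | _ = inj₁ e
    ... | no _ | yes e = inj₂ (inj₁ e)
    ... | no h | no k = inj₂ (inj₂ (h , k))

    odd-off : ∀ {x} → x ≢ u → x ≢ v → odd M′ x ≡ odd M x
    odd-off {x} h k = cong (λ t → par (deg G x) xor is-just t) (off h k)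

    cov-off : ∀ {x} → x ≢ u → x ≢ v → cov M′ x ≡ cov M x
    cov-off h k = cong is-just (off h k)

    rest-new : ∀ {y z} → rest M′ y z ≡ true → rest M y z ≡ true ⊎ (y ≡ u × z ≡ v) ⊎ (y ≡ v × z ≡ u)
    rest-new {y} {z} e with rest-elim M′ e | split-uv y
    ... | a , h | inj₂ (inj₂ (p , q)) = inj₁ (rest-intro M a (λ k → h (trans (off p q) k)))
    ... | a , h | inj₁ refl with z F.≟ v
    ...   | yes refl = inj₂ (inj₁ (refl , refl))
    ...   | no z≢v = inj₁ (rest-intro M a ([ (λ (p , _) k → z≢v (Mₚ.just-injective (trans (sym k) p))) , (λ (p , _) k → just≢nothing k p) ]′ flip))
    rest-new {y} {z} e | a , h | inj₂ (inj₁ refl) with z F.≟ u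
    ...   | yes refl = inj₂ (inj₂ (refl , refl))
    ...   | no z≢u = inj₁ (rest-intro M a ([ (λ (_ , p , _) k → z≢u (Mₚ.just-injective (trans (sym k) p))) , (λ (_ , p , _) k → just≢nothing k p) ]′ flip))

    Near : Fin n → Set
    Near x = Path (rest M) u x ⊎ Path (rest M) v x

    near : ∀ {y x} → Near y → Path (rest M′) y x → Near x
    near h stop = h
    near h (step p r) with near h p | rest-new r
    ... | inj₁ q | inj₁ r′ = inj₁ (step q r′)
    ... | inj₂ q | inj₁ r′ = inj₂ (step q r′)
    ... | _ | inj₂ (inj₁ (_ , refl)) = inj₂ stop
    ... | _ | inj₂ (inj₂ (_ , refl)) = inj₁ stop

    near-even : ∀ {x} → Near x → odd M x ≡ false
    near-even = [ Eu _ , Ev _ ]′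

    far : ∀ {a x} → odd M a ≡ true → Path (rest M) a x → x ≢ u × x ≢ v
    far o p = (λ { refl → true≢false o (Eu _ (path-sym (rest-sym M) p)) }) , (λ { refl → true≢false o (Ev _ (path-sym (rest-sym M) p)) })

    stay : ∀ {a x} → odd M a ≡ true → Path (rest M′) a x → Path (rest M) a x
    stay o stop = stop
    stay o (step p r) with stay o p
    ... | q with rest-new r
    ... | inj₁ r′ = step q r′
    ... | inj₂ (inj₁ (e , _)) = ⊥-elim (proj₁ (far o q) e)
    ... | inj₂ (inj₂ (e , _)) = ⊥-elim (proj₂ (far o q) e)

    no-third : ∀ {b} → b ≢ u → b ≢ v → odd M′ b ≡ true → ¬ Adj G u b × ¬ Adj G v b
    no-third {b} h k o =
      (λ a → contra (Eu b (step stop (rest-intro M a ([ (λ (p , _) e → k (Mₚ.just-injective (trans (sym e) p))) , (λ (p , _) e → just≢nothing e p) ]′ flip)))))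
      , (λ a → contra (Ev b (step stop (rest-intro M a ([ (λ (_ , p , _) e → h (Mₚ.just-injective (trans (sym e) p))) , (λ (_ , p , _) e → just≢nothing e p) ]′ flip)))))
      where
      contra : odd M b ≡ false → ⊥
      contra = true≢false (trans (sym (odd-off h k)) o)

    status : (m M′ u ≡ just v ⊎ m M′ u ≡ nothing) × (m M′ v ≡ just u ⊎ m M′ v ≡ nothing)
    status = [ (λ (_ , _ , p , q) → inj₂ p , inj₂ q) , (λ (_ , _ , p , q) → inj₁ p , inj₁ q) ]′ flip

    others : ∀ x → Near x → x ≡ u ⊎ x ≡ v ⊎ odd M′ x ≡ false
    others x p with split-uv x
    ... | inj₁ e = inj₁ e
    ... | inj₂ (inj₁ e) = inj₂ (inj₁ e)
    ... | inj₂ (inj₂ (h , k)) = inj₂ (inj₂ (trans (odd-off h k) (near-even p)))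

    -- A new pair with exactly one end among u and v would need an odd neighbour of u or v, which
    -- `no-third` excludes since the old components had no odd vertex. Pairs away from u and v are
    -- inherited: an odd vertex never reached u or v, so its paths avoid the toggled edge.
    isolated : Isolated M′
    isolated a b (sab , c , o) with split-uv a | split-uv b
    ... | inj₁ refl | inj₁ refl = ⊥-elim (adj-≢ (proj₁ sab) refl)
    ... | inj₂ (inj₁ refl) | inj₂ (inj₁ refl) = ⊥-elim (adj-≢ (proj₁ sab) refl)
    ... | inj₁ refl | inj₂ (inj₁ refl) = proj₁ status , λ x → others x ∘ [ near (inj₁ stop) , near (inj₂ stop) ]′
    ... | inj₂ (inj₁ refl) | inj₁ refl = proj₂ status , λ x p →
      [ (λ e → inj₂ (inj₁ e)) , [ inj₁ , (λ e → inj₂ (inj₂ e)) ]′ ]′ (others x ([ near (inj₂ stop) , near (inj₁ stop) ]′ p))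
    ... | inj₁ refl | inj₂ (inj₂ (h , k)) = ⊥-elim (proj₁ (no-third h k (trans (sym (same-parity M′ (proj₂ sab) c)) o)) (proj₁ sab))
    ... | inj₂ (inj₁ refl) | inj₂ (inj₂ (h , k)) = ⊥-elim (proj₂ (no-third h k (trans (sym (same-parity M′ (proj₂ sab) c)) o)) (proj₁ sab))
    ... | inj₂ (inj₂ (h , k)) | inj₁ refl = ⊥-elim (proj₁ (no-third h k o) (proj₁ (Same-sym sab)))
    ... | inj₂ (inj₂ (h , k)) | inj₂ (inj₁ refl) = ⊥-elim (proj₂ (no-third h k o) (proj₁ (Same-sym sab)))
    ... | inj₂ (inj₂ (h , k)) | inj₂ (inj₂ (h′ , k′)) =
      [ (λ e → inj₁ (trans (off h k) e)) , (λ e → inj₂ (trans (off h k) e)) ]′ (proj₁ old)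
      , λ x → [ (λ p → fin x oa (stay oa p) (proj₂ old x (inj₁ (stay oa p)))) , (λ p → fin x ob (stay ob p) (proj₂ old x (inj₂ (stay ob p)))) ]′
      where
      oa : odd M a ≡ true
      oa = trans (sym (odd-off h k)) o
      ob : odd M b ≡ true
      ob = trans (sym (odd-off h′ k′)) (trans (sym (same-parity M′ (proj₂ sab) c)) o)
      old = iso a b (sab , trans (sym (cov-off h k)) (trans c (cov-off h′ k′)) , oa)
      fin : ∀ x {y} → odd M y ≡ true → Path (rest M) y x → x ≡ a ⊎ x ≡ b ⊎ odd M x ≡ false → x ≡ a ⊎ x ≡ b ⊎ odd M′ x ≡ false
      fin x oy p = [ inj₁ , [ (λ e → inj₂ (inj₁ e)) , (λ e → inj₂ (inj₂ (trans (odd-off (proj₁ (far oy p)) (proj₂ (far oy p))) e))) ]′ ]′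

    fewer : # (not ∘ odd M′) < # (not ∘ odd M)
    fewer = #-strict u le (cong not odd-u) (not-false (Eu u stop))
      where
      xor-not : ∀ a b → a xor b ≡ false → a xor not b ≡ true
      xor-not true true _ = refl
      xor-not false false _ = refl
      cov-flip : ∀ {x} → (m M x ≡ nothing × ∃[ y ] m M′ x ≡ just y) ⊎ (m M′ x ≡ nothing × ∃[ y ] m M x ≡ just y) → cov M′ x ≡ not (cov M x)
      cov-flip (inj₁ (p , _ , q)) rewrite p | q = refl
      cov-flip (inj₂ (p , _ , q)) rewrite p | q = refl
      cu : cov M′ u ≡ not (cov M u)
      cu = cov-flip ([ (λ (p , _ , q , _) → inj₂ (q , v , p)) , (λ (p , _ , q , _) → inj₁ (p , v , q)) ]′ flip)
      cv : cov M′ v ≡ not (cov M v)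
      cv = cov-flip ([ (λ (_ , p , _ , q) → inj₂ (q , u , p)) , (λ (_ , p , _ , q) → inj₁ (p , u , q)) ]′ flip)
      odd-u : odd M′ u ≡ true
      odd-u = trans (cong (par (deg G u) xor_) cu) (xor-not (par (deg G u)) (cov M u) (Eu u stop))
      odd-v : odd M′ v ≡ true
      odd-v = trans (cong (par (deg G v) xor_) cv) (xor-not (par (deg G v)) (cov M v) (Ev v stop))
      le : ∀ i → not (odd M′ i) ≡ true → not (odd M i) ≡ true
      le i e with split-uv i
      ... | inj₁ refl = ⊥-elim (true≢false odd-u (not-true e))
      ... | inj₂ (inj₁ refl) = ⊥-elim (true≢false odd-v (not-true e))
      ... | inj₂ (inj₂ (h , k)) = trans (cong not (sym (odd-off h k))) e

  -- `t₁` and `t₂` say that no toggle is left: neither removing a matching edge between two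
  -- components without odd vertices nor adding an edge inside one.
  record Final : Set where
    field
      M   : Matching
      iso : Isolated M
      t₁  : ∀ u v → m M u ≡ just v → Even M u → Even M v → ⊥
      t₂  : ∀ u v → Same u v → m M u ≡ nothing → m M v ≡ nothing → Even M u → ⊥

  -- Each toggle makes two more vertices odd.
  saturate : ∀ k (M : Matching) → # (not ∘ odd M) ≤ k → Isolated M → Final
  saturate k M le iso with Fₚ.any? (λ u → Fₚ.any? (λ v → (same? u v ×-dec
      (Mₚ.≡-dec F._≟_ (m M u) (just v) ⊎-dec (Mₚ.≡-dec F._≟_ (m M u) nothing ×-dec Mₚ.≡-dec F._≟_ (m M v) nothing)))
      ×-dec (even? M u ×-dec even? M v)))
  ... | no stuck = record { M = M ; iso = iso
    ; t₁ = λ u v e Eu Ev → stuck (u , v , (m-adj M e , inj₁ e) , Eu , Ev)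
    ; t₂ = λ u v s p q Eu → stuck (u , v , (s , inj₂ (p , q)) , Eu
        , Even-path M (step stop (rest-intro M (proj₁ s) (λ e → just≢nothing e p))) Eu) }
  ... | yes (u , v , (s , how) , Eu , Ev) = next k le (toggled how)
    where
    toggled : m M u ≡ just v ⊎ (m M u ≡ nothing × m M v ≡ nothing) → Σ Matching λ M′ → Toggled M M′ u v
    toggled (inj₁ e) = removeEdge M u v s e
    toggled (inj₂ (p , q)) = addEdge M u v s p q
    next : ∀ k → # (not ∘ odd M) ≤ k → (Σ Matching λ M′ → Toggled M M′ u v) → Final
    next zero le (M′ , T) = ⊥-elim (ℕₚ.n≮0 (ℕₚ.<-≤-trans (Toggling.fewer s T Eu Ev iso) le))
    next (suc k) le (M′ , T) = saturate k M′ (ℕ.s≤s⁻¹ (ℕₚ.<-≤-trans (Toggling.fewer s T Eu Ev iso) le)) (Toggling.isolated s T Eu Ev iso)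

  -- A maximal matching among edges whose ends have equal odd degree. Its covered vertices are even,
  -- and an uncovered odd pair would enlarge it, so `Isolated` holds vacuously.
  initial : Σ Matching Isolated
  initial = grow _ (record { m = λ _ → nothing ; m-sym = λ () ; m-adj = λ () }) ℕₚ.≤-refl (λ u ())
    where
    grow : ∀ k (M : Matching) → # (not ∘ cov M) ≤ k → (∀ u → cov M u ≡ true → par (deg G u) ≡ true) → Σ Matching Isolated
    grow k M le odd-cov with Fₚ.any? (λ u → Fₚ.any? (λ v → (same? u v ×-dec (par (deg G u) Bₚ.≟ true))
        ×-dec (Mₚ.≡-dec F._≟_ (m M u) nothing ×-dec Mₚ.≡-dec F._≟_ (m M v) nothing)))
    ... | no stuck = M , λ u v (s , c , o) → ⊥-elim (go s c o (true⊎false (cov M u)))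
      where
      go : ∀ {u v} → Same u v → cov M u ≡ cov M v → odd M u ≡ true → cov M u ≡ true ⊎ cov M u ≡ false → ⊥
      go {u} s c o (inj₁ t) = true≢false o (cong₂ _xor_ (odd-cov u t) t)
      go {u} {v} s c o (inj₂ f) = stuck (u , v , (s , trans (sym (Bₚ.xor-identityʳ _)) (trans (cong (par (deg G u) xor_) (sym f)) o))
        , is-just-false f , is-just-false (trans (sym c) f))
    ... | yes (u , v , (s , o) , mu , mv) with addEdge M u v s mu mv
    ... | M′ , T = next k le
      where
      open Toggled T
      at-u : cov M′ u ≡ true
      at-u = [ (λ (p , _) → ⊥-elim (just≢nothing p mu)) , (λ (_ , _ , p , _) → cong is-just p) ]′ flip
      keep : ∀ x → cov M x ≡ true → cov M′ x ≡ true
      keep x c = trans (cong is-just (off {x} (λ { refl → true≢false c (cong is-just mu) }) (λ { refl → true≢false c (cong is-just mv) }))) c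
      less : # (not ∘ cov M′) < # (not ∘ cov M)
      less = #-strict u (λ i h → not-false (¬true λ t → true≢false (keep i t) (not-true h))) (cong not at-u) (not-false (cong is-just mu))
      odd-cov′ : ∀ x → cov M′ x ≡ true → par (deg G x) ≡ true
      odd-cov′ x c with x F.≟ u | x F.≟ v
      ... | yes refl | _ = o
      ... | no _ | yes refl = trans (cong par (sym (proj₂ s))) o
      ... | no h | no k = odd-cov x (trans (sym (cong is-just (off h k))) c)
      next : ∀ k → # (not ∘ cov M) ≤ k → Σ Matching Isolated
      next zero le = ⊥-elim (ℕₚ.n≮0 (ℕₚ.<-≤-trans less le))
      next (suc k) le = grow k M′ (ℕ.s≤s⁻¹ (ℕₚ.<-≤-trans less le)) odd-cov′

  final : Final
  final = saturate _ (proj₁ initial) ℕₚ.≤-refl (proj₂ initial)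

-- Roots of components without odd vertices, and the signing with these roots.

par-+ : ∀ a b → par (a + b) ≡ par a xor par b
par-+ zero b = refl
par-+ (suc a) b = trans (cong not (par-+ a b)) (Bₚ.not-distribˡ-xor (par a) (par b))

xor-same : ∀ b → b xor b ≡ false
xor-same true = refl
xor-same false = refl

plus-minus : ∀ {n} (R x : Rel n) v → # (plus R x v) + # (minus R x v) ≡ # (R v)
plus-minus R x v = sym (#-split (R v) (x v))

NoIsolatedEdge : ∀ {n} → Graph n → Set
NoIsolatedEdge G = ∀ u v → Adj G u v → ¬ (deg G u ≡ 1 × deg G v ≡ 1)

module Signed {n} (G : Graph n) (side : Fin n → Bool) (bip : Bip side (adj G))
              (noiso : NoIsolatedEdge G) (fin : Matchings.Final G) where

  open Matchings G
  open Final fin public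
  open Matching M public

  rest-bip : Bip side rest
  rest-bip x y e = bip x y (proj₁ (rest-elim e))

  deg-rest : ∀ u → deg G u ≡ # (rest u) + b2n (cov u)
  deg-rest u = trans (deg-# G u) (trans (#-split (adj G u) (is (m u)))
    (trans (ℕₚ.+-comm (# (λ v → adj G u v ∧ is (m u) v)) _) (cong (# (rest u) +_) (lem (m u) refl))))
    where
    lem : ∀ p → m u ≡ p → # (λ v → adj G u v ∧ is (m u) v) ≡ b2n (is-just p)
    lem nothing e = #-zero (λ v → ¬true λ t → just≢nothing (is-≡ (proj₂ (∧-true {adj G u v} t))) e)
    lem (just w) e = #-unique w (∧-intro (proj₁ (m-adj e)) (≡-is e))
      (λ j t → Mₚ.just-injective (trans (sym (is-≡ (proj₂ (∧-true {adj G u j} t)))) e))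

  par-rest : ∀ u → par (# (rest u)) ≡ odd u
  par-rest u rewrite deg-rest u | par-+ (# (rest u)) (b2n (cov u)) = sym (go (par (# (rest u))) (cov u))
    where
    go : ∀ a c → (a xor par (b2n c)) xor c ≡ a
    go a true = trans (Bₚ.xor-assoc a true true) (Bₚ.xor-identityʳ a)
    go a false = trans (Bₚ.xor-identityʳ _) (Bₚ.xor-identityʳ a)

  -- Degree 1 at both ends would make the edge isolated. Hence every vertex with a neighbour of its
  -- own degree has a second neighbour.
  Same-2≤ : ∀ {u v} → Same u v → 2 ≤ deg G u
  Same-2≤ {u} {v} (a , d) = go (deg G u) refl
    where
    1≤ : 1 ≤ deg G u
    1≤ = subst (1 ≤_) (sym (trans (deg-# G u) (#-remove v a))) (s≤s z≤n)
    go : ∀ k → deg G u ≡ k → 2 ≤ k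
    go 0 e = ⊥-elim (ℕₚ.n≮0 (subst (1 ≤_) e 1≤))
    go 1 e = ⊥-elim (noiso u v a (e , trans (sym d) e))
    go (suc (suc k)) e = s≤s (s≤s z≤n)

  other-neighbour : ∀ {u v} → Same u v → ∀ y → ∃[ z ] (Adj G u z × z ≢ y)
  other-neighbour s y = #-other y (subst (2 ≤_) (deg-# G _) (Same-2≤ s))

  conn : Rel n
  conn x y = does (path? rest x y)

  conn-path : ∀ {x y} → conn x y ≡ true → Path rest x y
  conn-path {x} {y} = does-true (path? rest x y)

  path-conn : ∀ {x y} → Path rest x y → conn x y ≡ true
  path-conn {x} {y} = dec-true (path? rest x y)

  flipPath : ∀ {x y} → Path rest x y → Path rest y x
  flipPath = path-sym rest-sym

  conn-cong : ∀ {x y} → Path rest x y → ∀ r → conn x r ≡ conn y r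
  conn-cong p r = bool-ext (λ e → path-conn (path-trans (flipPath p) (conn-path e))) (λ e → path-conn (path-trans p (conn-path e)))

  firstUncovered firstA : Fin n → Maybe (Fin n)
  firstUncovered x = find (λ r → conn x r ∧ not (cov r))
  firstA x = find (λ r → conn x r ∧ side r)

  firstU-cong : ∀ {x y} → Path rest x y → firstUncovered x ≡ firstUncovered y
  firstU-cong p = find-cong (λ r → cong (_∧ not (cov r)) (conn-cong p r))

  firstA-cong : ∀ {x y} → Path rest x y → firstA x ≡ firstA y
  firstA-cong p = find-cong (λ r → cong (_∧ side r) (conn-cong p r))

  choose : Maybe (Fin n) → Maybe (Fin n) → Fin n → Fin n
  choose (just r) _ x = r
  choose nothing (just r) x = r
  choose nothing nothing x = x

  -- An unmatched vertex is preferred; only when the whole component is matched is a vertex of A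
  -- taken. Both choices depend on the component alone, and `some-A` shows that one of them
  -- succeeds.
  root : Fin n → Fin n
  root x = choose (firstUncovered x) (firstA x) x

  all-covered : ∀ {x} → firstUncovered x ≡ nothing → ∀ {y} → Path rest x y → cov y ≡ true
  all-covered {x} e {y} p with true⊎false (cov y)
  ... | inj₁ t = t
  ... | inj₂ f = ⊥-elim (true≢false (∧-intro (path-conn p) (not-false f)) (find-nothing _ e y))

  -- A matched vertex of B has a neighbour other than its partner; that neighbour lies in the same
  -- component and in A.
  some-A : ∀ {x} → firstUncovered x ≡ nothing → firstA x ≡ nothing → ⊥
  some-A {x} eU eA = go (true⊎false (side x))
    where
    go : side x ≡ true ⊎ side x ≡ false → ⊥
    go (inj₁ t) = true≢false (∧-intro (path-conn stop) t) (find-nothing _ eA x)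
    go (inj₂ f) with is-just-true (all-covered eU stop)
    ... | y , e with other-neighbour (m-adj e) y
    ... | z , a , z≢y = true≢false (∧-intro (path-conn (step stop (rest-intro a (λ k → z≢y (Mₚ.just-injective (trans (sym k) e))))))
            (Bₚ.¬-not (λ s → bip x z a (trans f (sym s))))) (find-nothing _ eA z)

  root-cases : ∀ x → firstUncovered x ≡ just (root x) ⊎ (firstUncovered x ≡ nothing × firstA x ≡ just (root x))
  root-cases x = go (firstUncovered x) (firstA x) refl refl
    where
    go : ∀ a b → firstUncovered x ≡ a → firstA x ≡ b → a ≡ just (choose a b x) ⊎ (a ≡ nothing × b ≡ just (choose a b x))
    go (just r) b e f = inj₁ refl
    go nothing (just r) e f = inj₂ (refl , refl)
    go nothing nothing e f = ⊥-elim (some-A e f)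

  root-path : ∀ x → Path rest x (root x)
  root-path x with root-cases x
  ... | inj₁ e = conn-path (proj₁ (∧-true (find-just _ e)))
  ... | inj₂ (_ , e) = conn-path (proj₁ (∧-true (find-just _ e)))

  root-cong : ∀ {x y} → Path rest x y → root x ≡ root y
  root-cong {x} {y} p with root-cases x | root-cases y
  ... | inj₁ e | inj₁ f = Mₚ.just-injective (trans (sym e) (trans (firstU-cong p) f))
  ... | inj₂ (_ , e) | inj₂ (_ , f) = Mₚ.just-injective (trans (sym e) (trans (firstA-cong p) f))
  ... | inj₁ e | inj₂ (f , _) = ⊥-elim (just≢nothing (trans (sym (firstU-cong p)) e) f)
  ... | inj₂ (e , _) | inj₁ f = ⊥-elim (just≢nothing (trans (firstU-cong p) f) e)

  root-idem : ∀ x → root (root x) ≡ root x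
  root-idem x = sym (root-cong (root-path x))

  root-covered : ∀ {x} → cov (root x) ≡ true → side (root x) ≡ true × (∀ {y} → Path rest x y → cov y ≡ true)
  root-covered {x} c with root-cases x
  ... | inj₁ e = ⊥-elim (true≢false c (not-true (proj₂ (∧-true {conn x (root x)} (find-just _ e)))))
  ... | inj₂ (e , f) = proj₂ (∧-true {conn x (root x)} (find-just _ f)) , all-covered e

  IsRoot : Fin n → Set
  IsRoot x = Even x × root x ≡ x

  isRoot? : ∀ x → Dec (IsRoot x)
  isRoot? x = even? x ×-dec (root x F.≟ x)

  -- Odd vertices can be free too: their parity rules out 0 and ±2, so ±1 is the only outcome left.
  base : Fin n → Bool
  base x = does (isRoot? x) ∨ odd x

  base-reachable : ∀ v → ∃[ r ] (Path rest v r × base r ≡ true)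
  base-reachable v with even? v
  ... | yes e = root v , root-path v , ∨-introˡ (dec-true (isRoot? (root v)) (Even-path (root-path v) e , root-idem v))
  ... | no ¬e with Fₚ.any? (λ x → path? rest v x ×-dec (odd x Bₚ.≟ true))
  ... | yes (x , p , o) = x , p , ∨-introʳ {does (isRoot? x)} o
  ... | no h = ⊥-elim (¬e (λ x p → ¬true (λ o → h (x , p , o))))

  Std : Fin n → ℕ → ℕ → Set
  Std v h k = if side v then Equal h k else Two h k

  par-double : ∀ a → par (a + a) ≡ false
  par-double a = trans (par-+ a a) (xor-same (par a))

  Two-even : ∀ {h k} → Two h k → par (h + k) ≡ false
  Two-even {k = k} (inj₁ refl) = trans (Bₚ.not-involutive _) (par-double k)
  Two-even {h} (inj₂ refl) = trans (cong par (ℕₚ.+-comm h (2 + h))) (trans (Bₚ.not-involutive _) (par-double h))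

  Equal-even : ∀ {h k} → Equal h k → par (h + k) ≡ false
  Equal-even {h} refl = par-double h

  One-odd : ∀ {h k} → One h k → par (h + k) ≡ true
  One-odd {k = k} (inj₁ refl) = cong not (par-double k)
  One-odd {h} (inj₂ refl) = trans (cong par (ℕₚ.+-comm h (1 + h))) (cong not (par-double h))

  Std-even : ∀ v {h k} → Std v h k → par (h + k) ≡ false
  Std-even v s with side v
  ... | true = Equal-even s
  ... | false = Two-even s

  SignSpec : Rel n → Set
  SignSpec x = ∀ v → let h = # (plus rest x v) ; k = # (minus rest x v) in
    (One h k ⊎ (if side v then Equal h k else Two h k)) ⊎ (base v ≡ true × (Equal h k ⊎ Two h k))

  exists-signing : Σ (Rel n) λ x → Symm x × SignSpec x
  exists-signing with order rest base base-reachable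
  ... | L , o , cover = sign-graph side rest rest-sym rest-bip o cover

-- Exchanging the two classes on components.

module Flipped {n} (G : Graph n) (side : Fin n → Bool) (bip : Bip side (adj G))
               (noiso : NoIsolatedEdge G) (fin : Matchings.Final G)
               (x₀ : Rel n) (x₀-sym : Symm x₀) (spec₀ : Signed.SignSpec G side bip noiso fin x₀) where

  open Matchings G
  open Signed G side bip noiso fin public

  private
    h₀ k₀ : Fin n → ℕ
    h₀ v = # (plus rest x₀ v)
    k₀ v = # (minus rest x₀ v)

    par₀ : ∀ v → par (h₀ v + k₀ v) ≡ odd v
    par₀ v = trans (cong par (plus-minus rest x₀ v)) (par-rest v)

    spec-odd : ∀ v → odd v ≡ true → One (h₀ v) (k₀ v)
    spec-odd v o with spec₀ v
    ... | inj₁ (inj₁ p) = p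
    ... | inj₁ (inj₂ s) = ⊥-elim (true≢false (trans (par₀ v) o) (Std-even v s))
    ... | inj₂ (_ , inj₁ s) = ⊥-elim (true≢false (trans (par₀ v) o) (Equal-even s))
    ... | inj₂ (_ , inj₂ s) = ⊥-elim (true≢false (trans (par₀ v) o) (Two-even s))

    spec-even : ∀ v → odd v ≡ false → Std v (h₀ v) (k₀ v) ⊎ (IsRoot v × (Equal (h₀ v) (k₀ v) ⊎ Two (h₀ v) (k₀ v)))
    spec-even v o with spec₀ v
    ... | inj₁ (inj₁ p) = ⊥-elim (true≢false (One-odd p) (trans (par₀ v) o))
    ... | inj₁ (inj₂ s) = inj₁ s
    ... | inj₂ (b , s) = inj₂ ([ does-true (isRoot? v) , (λ t → ⊥-elim (true≢false t o)) ]′ (∨-true {does (isRoot? v)} b) , s)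

    -- Equality of the differences h - k at w and y, written without subtraction.
    balanced : Fin n → Fin n → Bool
    balanced w y = does (h₀ w + k₀ y ℕₚ.≟ h₀ y + k₀ w)

    -- Exchanging the two classes on a whole component keeps the conditions away from its root, so
    -- at the root one unwanted outcome can be avoided.
    bad′ : Fin n → Maybe (Fin n) → Bool
    bad′ r (just y) = balanced r y
    bad′ r nothing = does (k₀ r ℕₚ.≟ 2 + h₀ r)

    bad : Fin n → Bool
    bad r = bad′ r (m r)

    bad-just : ∀ {r y} → m r ≡ just y → bad r ≡ balanced r y
    bad-just {r} e = cong (bad′ r) e

    bad-nothing : ∀ {r} → m r ≡ nothing → bad r ≡ does (k₀ r ℕₚ.≟ 2 + h₀ r)
    bad-nothing {r} e = cong (bad′ r) e

    f : Fin n → Bool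
    f u = does (even? u) ∧ bad (root u)

    f-cong : ∀ {u v} → Path rest u v → f u ≡ f v
    f-cong p = cong₂ _∧_ (bool-ext (λ e → dec-true (even? _) (Even-path p (does-true (even? _) e)))
      (λ e → dec-true (even? _) (Even-path (flipPath p) (does-true (even? _) e)))) (cong bad (root-cong p))

  x : Rel n
  -- The ends of an edge lie in one component, where f is constant; the conjunction makes x
  -- symmetric on all pairs.
  x u v = (f u ∧ f v) xor x₀ u v

  x-sym : Symm x
  x-sym u v = cong₂ _xor_ (Bₚ.∧-comm (f u) (f v)) (x₀-sym u v)

  h k : Fin n → ℕ
  h v = # (plus rest x v)
  k v = # (minus rest x v)

  h+k : ∀ v → h v + k v ≡ # (rest v)
  h+k = plus-minus rest x

  private
    on-edge : ∀ u v → rest u v ≡ true → x u v ≡ f u xor x₀ u v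
    on-edge u v e = cong (_xor x₀ u v) (trans (cong (f u ∧_) (sym (f-cong (step stop e)))) (Bₚ.∧-idem (f u)))

    restrict : ∀ u v (t : Bool → Bool) → rest u v ∧ t (x u v) ≡ rest u v ∧ t (f u xor x₀ u v)
    restrict u v t with true⊎false (rest u v)
    ... | inj₁ e rewrite on-edge u v e = refl
    ... | inj₂ e rewrite e = refl

    keep-h : ∀ u → f u ≡ false → h u ≡ h₀ u
    keep-h u e = #-cong (λ v → trans (restrict u v id) (cong (λ b → rest u v ∧ (b xor x₀ u v)) e))

    keep-k : ∀ u → f u ≡ false → k u ≡ k₀ u
    keep-k u e = #-cong (λ v → trans (restrict u v not) (cong (λ b → rest u v ∧ not (b xor x₀ u v)) e))

    flip-h : ∀ u → f u ≡ true → h u ≡ k₀ u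
    flip-h u e = #-cong (λ v → trans (restrict u v id) (cong (λ b → rest u v ∧ (b xor x₀ u v)) e))

    flip-k : ∀ u → f u ≡ true → k u ≡ h₀ u
    flip-k u e = #-cong (λ v → trans (restrict u v not) (trans (cong (λ b → rest u v ∧ not (b xor x₀ u v)) e)
      (cong (rest u v ∧_) (Bₚ.not-involutive _))))

    transfer : ∀ u (P : ℕ → ℕ → Set) → (∀ {a b} → P a b → P b a) → P (h₀ u) (k₀ u) → P (h u) (k u)
    transfer u P sw p with true⊎false (f u)
    ... | inj₁ e = subst (λ a → P a (k u)) (sym (flip-h u e)) (subst (P (k₀ u)) (sym (flip-k u e)) (sw p))
    ... | inj₂ e = subst (λ a → P a (k u)) (sym (keep-h u e)) (subst (P (h₀ u)) (sym (keep-k u e)) p)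

    swap-⊎ : ∀ {A B : Set} → A ⊎ B → B ⊎ A
    swap-⊎ = [ inj₂ , inj₁ ]′

    swap-Std : ∀ v {a b} → Std v a b → Std v b a
    swap-Std v s with side v
    ... | true = sym s
    ... | false = swap-⊎ s

  sign-odd : ∀ v → odd v ≡ true → One (h v) (k v)
  sign-odd v o = transfer v One swap-⊎ (spec-odd v o)

  sign-even : ∀ v → odd v ≡ false → ¬ IsRoot v → Std v (h v) (k v)
  sign-even v o nr = transfer v (Std v) (swap-Std v) ([ id , (λ (r , _) → ⊥-elim (nr r)) ]′ (spec-even v o))

  private
    root-0-2 : ∀ r → IsRoot r → Equal (h₀ r) (k₀ r) ⊎ Two (h₀ r) (k₀ r)
    root-0-2 r (e , q) with spec-even r (e r stop)
    ... | inj₂ (_ , s) = s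
    ... | inj₁ s with side r
    ... | true = inj₁ s
    ... | false = inj₂ s

    f-root : ∀ r → IsRoot r → f r ≡ bad r
    f-root r (e , q) rewrite q | dec-true (even? r) e = refl

  -- The exchange turns k = 2 + h into h = 2 + k. This preserves, at roots in A, the slack in the
  -- second class from which vertices of A take their colours.
  sign-uncovered-root : ∀ r → IsRoot r → m r ≡ nothing → Equal (h r) (k r) ⊎ h r ≡ 2 + k r
  sign-uncovered-root r ir e with k₀ r ℕₚ.≟ 2 + h₀ r
  ... | yes q = inj₂ (trans (flip-h r fr) (trans q (cong (2 +_) (sym (flip-k r fr)))))
    where
    fr : f r ≡ true
    fr = trans (f-root r ir) (trans (bad-nothing e) (dec-true (k₀ r ℕₚ.≟ 2 + h₀ r) q))
  ... | no q = [ (λ s → inj₁ (trans (keep-h r fr) (trans s (sym (keep-k r fr)))))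
               , [ (λ s → inj₂ (trans (keep-h r fr) (trans s (cong (2 +_) (sym (keep-k r fr)))))) , (λ s → ⊥-elim (q s)) ]′ ]′ (root-0-2 r ir)
    where
    fr : f r ≡ false
    fr = trans (f-root r ir) (trans (bad-nothing e) (dec-false (k₀ r ℕₚ.≟ 2 + h₀ r) q))

  -- w is the root of a component without odd vertices and without unmatched vertices; the
  -- matching edge w y will be coloured apart from the rest of the matching.
  record Solo (w y : Fin n) : Set where
    field
      is-root : IsRoot w
      matched : m w ≡ just y

    w-A : side w ≡ true
    w-A = subst (λ z → side z ≡ true) (proj₂ is-root)
            (proj₁ (root-covered {w} (trans (cong cov (proj₂ is-root)) (cong is-just matched))))

    y-B : side y ≡ false
    y-B = ¬true (λ s → bip w y (proj₁ (m-adj matched)) (trans w-A (sym s)))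

    around : ∀ {z} → Path rest w z → cov z ≡ true
    around = proj₂ (root-covered {w} (trans (cong cov (proj₂ is-root)) (cong is-just matched)))

    y-not-even : ¬ Even y
    y-not-even = t₁ w y matched (proj₁ is-root)

    w-even : odd w ≡ false
    w-even = proj₁ is-root w stop

    y-even : odd y ≡ false
    y-even = trans (sym (same-parity (proj₂ (m-adj matched))
      (trans (cong is-just matched) (sym (cong is-just (m-sym matched)))))) w-even

    y-two : Two (h y) (k y)
    y-two = subst (λ b → if b then Equal (h y) (k y) else Two (h y) (k y)) y-B (sign-even y y-even (y-not-even ∘ proj₁))

    w-0-2 : Equal (h w) (k w) ⊎ Two (h w) (k w)
    w-0-2 = transfer w (λ a b → Equal a b ⊎ Two a b) [ inj₁ ∘ sym , inj₂ ∘ swap-⊎ ]′ (root-0-2 w is-root)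

    f-y : f y ≡ false
    f-y = cong (_∧ bad (root y)) (dec-false (even? y) y-not-even)

    -- By `t₁` the vertex y is not in a component without odd vertices, so the exchange negates the
    -- difference at w and leaves the one at y. The latter is ±2 and cannot equal both a number and
    -- its negative.
    unequal : h w + k y ≢ h y + k w
    unequal eq with h₀ w + k₀ y ℕₚ.≟ h₀ y + k₀ w
    ... | no q = q (trans (sym (cong₂ _+_ (keep-h w fw) (keep-k y f-y))) (trans eq (cong₂ _+_ (keep-h y f-y) (keep-k w fw))))
      where
      fw : f w ≡ false
      fw = trans (f-root w is-root) (trans (bad-just matched) (dec-false (h₀ w + k₀ y ℕₚ.≟ h₀ y + k₀ w) q))
    ... | yes q = clash (subst (λ a → Two a (k₀ y)) (keep-h y f-y) (subst (Two (h y)) (keep-k y f-y) y-two))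
      where
      fw : f w ≡ true
      fw = trans (f-root w is-root) (trans (bad-just matched) (dec-true (h₀ w + k₀ y ℕₚ.≟ h₀ y + k₀ w) q))
      eq′ : k₀ w + k₀ y ≡ h₀ y + h₀ w
      eq′ = trans (sym (cong₂ _+_ (flip-h w fw) (keep-k y f-y))) (trans eq (cong₂ _+_ (keep-h y f-y) (flip-k w fw)))
      no-2 : ∀ {a b c} → a + c ≡ (2 + c) + b → b + c ≡ (2 + c) + a → ⊥
      no-2 {a} {b} {c} e e′ = ℕₚ.<-asym (below a b e) (below b a e′)
        where
        below : ∀ a b → a + c ≡ (2 + c) + b → b < a
        below a b e = ℕₚ.+-cancelʳ-< c b a (ℕₚ.≤-trans (s≤s (ℕₚ.n≤1+n (b + c))) (ℕₚ.≤-reflexive (trans (cong (2 +_) (ℕₚ.+-comm b c)) (sym e))))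
      clash : Two (h₀ y) (k₀ y) → ⊥
      clash (inj₁ t) = no-2 {h₀ w} {k₀ w} {k₀ y} (trans q (cong (_+ k₀ w) t)) (trans eq′ (cong (_+ h₀ w) t))
      clash (inj₂ t) = no-2 {k₀ w} {h₀ w} {h₀ y}
        (trans (ℕₚ.+-comm (k₀ w) (h₀ y)) (trans (sym q) (trans (cong (h₀ w +_) t) (ℕₚ.+-comm (h₀ w) _))))
        (trans (ℕₚ.+-comm (h₀ w) (h₀ y)) (trans (sym eq′) (trans (cong (k₀ w +_) t) (ℕₚ.+-comm (k₀ w) _))))

-- Total colourings from edge colourings

unite : ∀ {n} {R₁ R₂ : Rel n} {C₁ C₂ : Set} → Col R₁ C₁ → Col R₂ C₂ →
        (∀ u v → R₁ u v ≡ true → R₂ u v ≡ true → ⊥) → Col (R₁ ∪ R₂) (C₁ ⊎ C₂)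
unite {R₁ = R₁} φ₁ φ₂ dis = record
  { nb = λ u → [ nb φ₁ u , nb φ₂ u ]′
  ; nb-sym = λ { {c = inj₁ c} e → nb-sym φ₁ e ; {c = inj₂ c} e → nb-sym φ₂ e }
  ; sound = λ { {c = inj₁ c} e → ∨-introˡ (sound φ₁ e) ; {u} {v} {inj₂ c} e → ∨-introʳ {R₁ u v} (sound φ₂ e) }
  ; complete = λ {u} {v} e → [ (λ r → let (c , p) = complete φ₁ r in inj₁ c , p) , (λ r → let (c , p) = complete φ₂ r in inj₂ c , p) ]′ (∨-true {R₁ u v} e)
  ; unique = λ { {c = inj₁ c} {inj₁ d} e f → cong inj₁ (unique φ₁ e f) ; {c = inj₂ c} {inj₂ d} e f → cong inj₂ (unique φ₂ e f)
               ; {u} {v} {inj₁ c} {inj₂ d} e f → ⊥-elim (dis u v (sound φ₁ e) (sound φ₂ f))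
               ; {u} {v} {inj₂ c} {inj₁ d} e f → ⊥-elim (dis u v (sound φ₁ f) (sound φ₂ e)) } }

matchingCol : ∀ {n} (m : Fin n → Maybe (Fin n)) → (∀ {u v} → m u ≡ just v → m v ≡ just u) → Col (λ u v → is (m u) v) ⊤
matchingCol m sy = record { nb = λ u _ → m u ; nb-sym = sy ; sound = ≡-is ; complete = λ e → tt , is-≡ e ; unique = λ _ _ → refl }

-- No edge joins vertices of different index, so each index may use its own colouring.
glue : ∀ {n} {R : Rel n} {C I : Set} (Φ : I → Col R C) (s : Fin n → I) → (∀ a b → R a b ≡ true → s a ≡ s b) →
       Σ (Col R C) λ φ → ∀ a c → nb φ a c ≡ nb (Φ (s a)) a c
glue {n} {R} {C} Φ s same = record
  { nb = λ a → nb (Φ (s a)) a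
  ; nb-sym = λ {u} {v} {c} e → subst (λ i → nb (Φ i) v c ≡ just u) (same u v (sound (Φ (s u)) e)) (nb-sym (Φ (s u)) e)
  ; sound = λ {u} e → sound (Φ (s u)) e
  ; complete = λ {u} e → complete (Φ (s u)) e
  ; unique = λ {u} e f → unique (Φ (s u)) e f } , λ a c → refl

module Assemble {n} (G : Graph n) {C : Set} {K : ℕ} (inj : C → Fin K) (injective : ∀ {c d} → inj c ≡ inj d → c ≡ d)
                (c₀ : C) (φ : Col (adj G) C) where

  private
    colourOf : Fin n → Fin n → C
    colourOf u v = [ (λ e → proj₁ (complete φ e)) , (λ _ → c₀) ]′ (true⊎false (adj G u v))

    colour-nb : ∀ {u v} → Adj G u v → nb φ u (colourOf u v) ≡ just v
    colour-nb {u} {v} a with true⊎false (adj G u v)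
    ... | inj₁ e = proj₂ (complete φ e)
    ... | inj₂ f = ⊥-elim (true≢false a f)

    colouring : EdgeCol G K
    colouring = record
      { ec = λ u v → inj (colourOf u v)
      ; ec-sym = λ u v a → cong inj (unique φ (colour-nb a) (nb-sym φ (colour-nb (trans (adj-sym G v u) a)))) }

    proper : ProperEdge colouring
    proper u v w a b v≢w e = v≢w (Mₚ.just-injective (trans (sym (colour-nb a))
      (trans (cong (nb φ u) (injective e)) (colour-nb b))))

    in-seen : ∀ {u c} → InC colouring u (inj c) → seen φ u c ≡ true
    in-seen {u} (v , a , e) = cong is-just (trans (cong (nb φ u) (sym (injective e))) (colour-nb a))

    seen-in : ∀ {u c} → seen φ u c ≡ true → InC colouring u (inj c)
    seen-in s with is-just-true s
    ... | v , e = v , sound φ e , cong inj (unique φ (colour-nb (sound φ e)) e)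

    differ : ∀ u v → ¬ (∀ c → seen φ u c ≡ seen φ v c) → DiffSets colouring u v
    differ u v d same = d (λ c → bool-ext (λ s → in-seen (Equivalence.to (same (inj c)) (seen-in s)))
      (λ s → in-seen (Equivalence.from (same (inj c)) (seen-in s))))

  totalAVD : (side : Fin n → Bool) → Bip side (adj G) → (κ : Fin n → C) → (∀ u → nb φ u (κ u) ≡ nothing) →
             (∀ u v → Adj G u v → side u ≡ true → κ u ≢ κ v) →
             (∀ u v → Adj G u v → side u ≡ true → ¬ (∀ c → seen φ u c ≡ seen φ v c)) → TotalAVD G K
  totalAVD side bip κ free κ-proper dist = record
    { vc = inj ∘ κ ; edges = colouring
    ; vc-proper = λ u v a e → vcp u v a (injective e) (true⊎false (side u))
    ; ec-proper = proper
    ; ev-proper = λ u v a e → just≢nothing (trans (cong (nb φ u) (sym (injective e))) (colour-nb a)) (free u) }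
    , λ u v a → avd u v a (true⊎false (side u))
    where
    turn : ∀ {u v} → Adj G u v → side u ≡ false → side v ≡ true
    turn {u} {v} a f = Bₚ.¬-not (λ e → bip u v a (trans f (sym e)))
    vcp : ∀ u v → Adj G u v → κ u ≡ κ v → side u ≡ true ⊎ side u ≡ false → ⊥
    vcp u v a e (inj₁ t) = κ-proper u v a t e
    vcp u v a e (inj₂ f) = κ-proper v u (trans (adj-sym G v u) a) (turn a f) (sym e)
    avd : ∀ u v → Adj G u v → side u ≡ true ⊎ side u ≡ false → DiffSets colouring u v
    avd u v a (inj₁ t) = differ u v (dist u v a t)
    avd u v a (inj₂ f) = differ u v (λ eq → dist v u (trans (adj-sym G v u) a) (turn a f) (λ c → sym (eq c)))

join-injective : ∀ p q {x y : Fin p ⊎ Fin q} → F.join p q x ≡ F.join p q y → x ≡ y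
join-injective p q {x} {y} e = trans (sym (Fₚ.splitAt-join p q x)) (trans (cong (F.splitAt p) e) (Fₚ.splitAt-join p q y))

plus-one : ∀ {C : Set} {K} → (C → Fin K) → C ⊎ ⊤ → Fin (suc K)
plus-one i (inj₁ c) = suc (i c)
plus-one i (inj₂ tt) = zero

plus-one-injective : ∀ {C : Set} {K} (i : C → Fin K) → (∀ {c d} → i c ≡ i d → c ≡ d) →
                     ∀ {c d} → plus-one i c ≡ plus-one i d → c ≡ d
plus-one-injective i inj {inj₁ c} {inj₁ d} e = cong inj₁ (inj (Fₚ.suc-injective e))
plus-one-injective i inj {inj₂ tt} {inj₂ tt} e = refl

-- The second bound.

module _ {n} (G : Graph n) (side : Fin n → Bool) (bip : Bip side (adj G)) {s : ℕ}
         (c : EdgeCol G s) (pr : ProperEdge c) (vd : ∀ u v → u ≢ v → DiffSets c u v) where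

  private
    -- The given colouring presented by matchings, so that `missing` applies to it.
    φ : Col (adj G) (Fin s)
    φ = record
      { nb = nb′
      ; nb-sym = λ {u} {v} {a} e → let (r , q) = hit u a e in
          subst (λ d → nb′ v d ≡ just u) (trans (ec-sym c v u (trans (adj-sym G v u) r)) q) (full v u (trans (adj-sym G v u) r))
      ; sound = λ {u} {v} {a} e → proj₁ (hit u a e)
      ; complete = λ {u} {v} r → ec c u v , full u v r
      ; unique = λ {u} {v} {a} {b} e f → trans (sym (proj₂ (hit u a e))) (proj₂ (hit u b f)) }
      where
      nb′ : Fin n → Fin s → Maybe (Fin n)
      nb′ u a = find (λ v → adj G u v ∧ ec c u v == a)
      hit : ∀ u a {v} → nb′ u a ≡ just v → Adj G u v × ec c u v ≡ a
      hit u a {v} e = let (r , q) = ∧-true {adj G u v} (find-just _ e) in r , ==-≡ {i = ec c u v} {a} q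
      full : ∀ u v → Adj G u v → nb′ u (ec c u v) ≡ just v
      full u v r = go (nb′ u (ec c u v)) refl
        where
        go : ∀ m → nb′ u (ec c u v) ≡ m → nb′ u (ec c u v) ≡ just v
        go nothing e = ⊥-elim (true≢false (∧-intro r (==-refl (ec c u v))) (find-nothing _ e v))
        go (just w) e with w F.≟ v
        ... | yes refl = e
        ... | no w≢v = ⊥-elim (pr u w v (proj₁ (hit u _ e)) r w≢v (proj₂ (hit u _ e)))

    lift : ∀ j → EdgeCol G (s + j)
    lift j = record { ec = λ u v → ec c u v F.↑ˡ j ; ec-sym = λ u v a → cong (F._↑ˡ j) (ec-sym c u v a) }

    lift-in : ∀ j {u a} → InC c u a → InC (lift j) u (a F.↑ˡ j)
    lift-in j (v , r , e) = v , r , cong (F._↑ˡ j) e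

    in-lift : ∀ j {u a} → InC (lift j) u (a F.↑ˡ j) → InC c u a
    in-lift j (v , r , e) = v , r , Fₚ.↑ˡ-injective j _ _ e

    lift-differ : ∀ j u v → DiffSets c u v → DiffSets (lift j) u v
    lift-differ j u v d same = d (λ a → mk⇔ (λ p → in-lift j (Equivalence.to (same (a F.↑ˡ j)) (lift-in j p)))
      (λ p → in-lift j (Equivalence.from (same (a F.↑ˡ j)) (lift-in j p))))

    new≢old : ∀ {j} (a : Fin s) (b : Fin j) → a F.↑ˡ j ≢ s F.↑ʳ b
    new≢old {j} a b e with trans (sym (Fₚ.splitAt-↑ˡ s a j)) (trans (cong (F.splitAt s) e) (Fₚ.splitAt-↑ʳ s j b))
    ... | ()

    extend : ∀ j (κ : Fin n → Fin (s + j)) → (∀ u v → Adj G u v → side u ≡ true → κ u ≢ κ v) →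
             (∀ u v → Adj G u v → ec c u v F.↑ˡ j ≢ κ u) → TotalVD G (s + j)
    extend j κ pκ free = record
      { vc = κ ; edges = lift j
      ; vc-proper = λ u v a e → [ (λ t → pκ u v a t e)
          , (λ f → pκ v u (trans (adj-sym G v u) a) (Bₚ.¬-not (λ q → bip u v a (trans f (sym q)))) (sym e)) ]′ (true⊎false (side u))
      ; ec-proper = λ u v w a b v≢w e → pr u v w a b v≢w (Fₚ.↑ˡ-injective j _ _ e)
      ; ev-proper = free } , λ u v u≢v → lift-differ j u v (vd u v u≢v)

  two-new : TotalVD G (s + 2)
  two-new = extend 2 (λ u → s F.↑ʳ (if side u then zero else suc zero))
    (λ u v a t e → go u v a t (Fₚ.↑ʳ-injective s _ _ e)) (λ u v a e → new≢old _ _ e)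
    where
    go : ∀ u v → Adj G u v → side u ≡ true → (if side u then zero else suc zero) ≢ (if side v then zero else Fin.suc {1} zero)
    go u v a t e with side u | side v | bip u v a
    go u v a refl e | true | true | b = b refl
    go u v a refl () | true | false | b

  one-new : maxDeg G < s → TotalVD G (s + 1)
  one-new lt = extend 1 κ proper free
    where
    miss : ∀ u → ∃[ a ] nb φ u a ≡ nothing
    miss u = missing φ u (ℕₚ.≤-<-trans (subst (_≤ maxDeg G) (deg-# G u) (deg≤maxDeg G u)) lt)
    κ : Fin n → Fin (s + 1)
    κ u = if side u then proj₁ (miss u) F.↑ˡ 1 else s F.↑ʳ zero
    proper : ∀ u v → Adj G u v → side u ≡ true → κ u ≢ κ v
    proper u v a t e with side u | side v | bip u v a
    proper u v a refl e | true | true | b = b refl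
    proper u v a refl e | true | false | b = new≢old _ _ e
    free : ∀ u v → Adj G u v → ec c u v F.↑ˡ 1 ≢ κ u
    free u v a e with side u
    ... | true = just≢nothing (trans (cong (nb φ u) (sym (Fₚ.↑ˡ-injective 1 _ _ e))) (proj₂ (complete φ a))) (proj₂ (miss u))
    ... | false = new≢old _ _ e

close : ∀ d {a b} → a ≡ d + b ⊎ b ≡ d + a → a ≤ d + b × b ≤ d + a
close d {a} {b} (inj₁ e) = ℕₚ.≤-reflexive e , ℕₚ.≤-trans (ℕₚ.m≤n+m b d) (ℕₚ.≤-trans (ℕₚ.≤-reflexive (sym e)) (ℕₚ.m≤n+m a d))
close d (inj₂ e) = Product.swap (close d (inj₁ e))

wider : ∀ {a b} d → a ≤ d + b × b ≤ d + a → a ≤ suc d + b × b ≤ suc d + a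
wider d (p , q) = ℕₚ.m≤n⇒m≤1+n p , ℕₚ.m≤n⇒m≤1+n q

half : ∀ a t → a + a ≤ 1 + (t + t) → a ≤ t
half a t le with a ℕₚ.≤? t
... | yes p = p
... | no p = ⊥-elim (ℕₚ.<-irrefl refl (ℕₚ.≤-trans (ℕₚ.≤-trans (ℕₚ.≤-reflexive (cong suc (sym (ℕₚ.+-suc t t))))
               (ℕₚ.+-mono-≤ (ℕₚ.≰⇒> p) (ℕₚ.≰⇒> p))) le))

-- Since 2a ≤ d + (a + b) ≤ 2t + 1, integrality gives a ≤ t. The spare 1 is what makes the estimates
-- on class sizes suffice.
near-half : ∀ {a b} d t → a ≤ d + b → d + (a + b) ≤ 1 + (t + t) → a ≤ t
near-half {a} {b} d t le sum = half a t (ℕₚ.≤-trans (ℕₚ.+-monoʳ-≤ a le)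
  (subst (_≤ 1 + (t + t)) (trans (sym (ℕₚ.+-assoc d a b)) (trans (cong (_+ b) (ℕₚ.+-comm d a)) (ℕₚ.+-assoc a d b))) sum))

#-is : ∀ {n} {m : Maybe (Fin n)} {y} (t : Fin n → Bool) → m ≡ just y → # (λ v → is m v ∧ t v) ≡ b2n (t y)
#-is {m = m} {y} t e with true⊎false (t y)
... | inj₁ p rewrite p = #-unique y (∧-intro (≡-is e) p) (λ j q → Mₚ.just-injective (trans (sym (is-≡ (proj₁ (∧-true {is m j} q)))) e))
... | inj₂ p rewrite p = #-zero (λ j → ¬true λ q → true≢false (trans (cong t (sym (Mₚ.just-injective
      (trans (sym (is-≡ (proj₁ (∧-true {is m j} q)))) e)))) (proj₂ (∧-true {is m j} q))) p)

#-∪ : ∀ {n} (f g : Fin n → Bool) → (∀ i → f i ≡ true → g i ≡ true → ⊥) → # (λ i → f i ∨ g i) ≡ # f + # g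
#-∪ f g dis = trans (#-split (λ i → f i ∨ g i) f) (cong₂ _+_
  (#-cong (λ i → bool-ext (λ e → proj₂ (∧-true {f i ∨ g i} e)) (λ e → ∧-intro (∨-introˡ e) e)))
  (#-cong (λ i → bool-ext (λ e → let (p , q) = ∧-true {f i ∨ g i} e in
      [ (λ t → ⊥-elim (true≢false t (not-true q))) , id ]′ (∨-true {f i} p))
    (λ e → ∧-intro (∨-introʳ {f i} e) (not-false (¬true λ t → dis i t e))))))

is-sym : ∀ {n} (m : Fin n → Maybe (Fin n)) → (∀ {u v} → m u ≡ just v → m v ≡ just u) → ∀ u v → is (m u) v ≡ is (m v) u
is-sym m sy u v = bool-ext (λ e → ≡-is (sy (is-≡ {m = m u} e))) (λ e → ≡-is (sy (is-≡ {m = m v} e)))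

-- Matching edges at covered roots, and odd pairs.

module Solos {n} (G : Graph n) (side : Fin n → Bool) (bip : Bip side (adj G))
             (noiso : NoIsolatedEdge G) (fin : Matchings.Final G)
             (x₀ : Rel n) (x₀-sym : Symm x₀) (spec₀ : Signed.SignSpec G side bip noiso fin x₀) where

  open Matchings G using (Same; Same-sym) public
  open Flipped G side bip noiso fin x₀ x₀-sym spec₀ public

  opposite-B : ∀ {u v} → Adj G u v → side u ≡ true → side v ≡ false
  opposite-B a s = ¬true (λ t → bip _ _ a (trans s (sym t)))

  opposite-A : ∀ {u v} → Adj G u v → side u ≡ false → side v ≡ true
  opposite-A a s = Bₚ.¬-not (λ t → bip _ _ a (trans s (sym t)))

  soloA : Fin n → Bool
  soloA w = does (isRoot? w) ∧ cov w

  soloA-root : ∀ {w} → soloA w ≡ true → IsRoot w × cov w ≡ true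
  soloA-root {w} e = let (a , b) = ∧-true {does (isRoot? w)} e in does-true (isRoot? w) a , b

  root-soloA : ∀ {w} → IsRoot w → cov w ≡ true → soloA w ≡ true
  root-soloA {w} r c = ∧-intro (dec-true (isRoot? w) r) c

  soloA-side : ∀ {w} → soloA w ≡ true → side w ≡ true
  soloA-side {w} e = let ((ev , q) , c) = soloA-root e in
    subst (λ z → side z ≡ true) q (proj₁ (root-covered {w} (trans (cong cov q) c)))

  soloIn : Fin n → Maybe (Fin n) → Bool
  soloIn u (just v) = soloA u ∨ soloA v
  soloIn u nothing = false

  soloed : Fin n → Bool
  soloed u = soloIn u (m u)

  soloed-just : ∀ {u v} → m u ≡ just v → soloed u ≡ soloA u ∨ soloA v
  soloed-just {u} e = cong (soloIn u) e

  soloed-partner : ∀ {u v} → m u ≡ just v → soloed u ≡ soloed v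
  soloed-partner {u} {v} e = trans (soloed-just e) (trans (Bₚ.∨-comm (soloA u) (soloA v)) (sym (soloed-just (m-sym e))))

  soloed-match : ∀ {u} → soloed u ≡ true → ∃[ v ] (m u ≡ just v × (soloA u ≡ true ⊎ soloA v ≡ true))
  soloed-match {u} s = go (m u) refl
    where
    go : ∀ p → m u ≡ p → ∃[ v ] (m u ≡ just v × (soloA u ≡ true ⊎ soloA v ≡ true))
    go (just v) e = v , e , ∨-true (trans (sym (soloed-just e)) s)
    go nothing e = ⊥-elim (true≢false s (cong (soloIn u) e))

  solo-A : ∀ {u} → soloed u ≡ true → side u ≡ true → ∃[ y ] Solo u y
  solo-A s t with soloed-match s
  ... | y , e , inj₁ a = y , record { is-root = proj₁ (soloA-root a) ; matched = e }
  ... | y , e , inj₂ a = ⊥-elim (bip _ _ (proj₁ (m-adj e)) (trans t (sym (soloA-side a))))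

  solo-B : ∀ {v} → soloed v ≡ true → side v ≡ false → ∃[ w ] Solo w v
  solo-B s t with soloed-match s
  ... | w , e , inj₂ a = w , record { is-root = proj₁ (soloA-root a) ; matched = m-sym e }
  ... | w , e , inj₁ a = ⊥-elim (true≢false (soloA-side a) t)

  soloed-even : ∀ {u} → soloed u ≡ true → odd u ≡ false
  soloed-even {u} s with true⊎false (side u)
  ... | inj₁ t = Solo.w-even (proj₂ (solo-A s t))
  ... | inj₂ f = Solo.y-even (proj₂ (solo-B s f))

  odd-not-soloed : ∀ {u} → odd u ≡ true → soloed u ≡ false
  odd-not-soloed o = ¬true (λ s → true≢false o (soloed-even s))

  Solo-soloed : ∀ {w y} → Solo w y → soloed w ≡ true × soloed y ≡ true
  Solo-soloed {w} s = sw , trans (soloed-partner (m-sym (Solo.matched s))) sw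
    where
    sw : soloed w ≡ true
    sw = trans (soloed-just (Solo.matched s)) (∨-introˡ (root-soloA (Solo.is-root s) (cong is-just (Solo.matched s))))

  root-uncovered : ∀ {u} → soloed u ≡ false → IsRoot u → m u ≡ nothing
  root-uncovered {u} s r = go (m u) refl
    where
    go : ∀ p → m u ≡ p → m u ≡ nothing
    go nothing e = e
    go (just v) e = ⊥-elim (true≢false (trans (soloed-just e) (∨-introˡ (root-soloA r (cong is-just e)))) s)

  solo-neighbour : ∀ {u v} → soloed u ≡ true → side u ≡ true → Adj G u v → m u ≢ just v → Even v × cov v ≡ true
  solo-neighbour s t a h = let (y , S) = solo-A s t ; p = step stop (rest-intro a h) in
    Even-path p (proj₁ (Solo.is-root S)) , Solo.around S p

  -- If v is not the partner of u, it lies in the component of u, which has no odd vertices; but the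
  -- B-end of a solo edge never lies in such a component. For partners `Solo.unequal` decides.
  solo-clash : ∀ {u v} → Adj G u v → side u ≡ true → soloed u ≡ true → soloed v ≡ true → h u + k v ≡ h v + k u → ⊥
  solo-clash {u} {v} a t su sv eq with solo-A su t
  ... | y , S with y F.≟ v
  ... | yes refl = Solo.unequal S eq
  ... | no y≢v = Solo.y-not-even (proj₂ (solo-B sv (opposite-B a t)))
        (proj₁ (solo-neighbour su t a (λ e → y≢v (Mₚ.just-injective (trans (sym (Solo.matched S)) e)))))

  -- A root off the solo edges is unmatched, and then so is v; `t₂` forbids such a pair.
  not-root : ∀ {u v} → Same u v → cov u ≡ cov v → soloed u ≡ false → ¬ IsRoot u
  not-root {u} {v} s c su r = t₂ u v s mu (is-just-false (trans (sym c) (cong is-just mu))) (proj₁ r)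
    where
    mu = root-uncovered su r

  -- Neither end is a root, so the difference is 0 at u and ±2 at v.
  plain-clash : ∀ {u v} → Same u v → side u ≡ true → cov u ≡ cov v → soloed u ≡ false → soloed v ≡ false →
                odd u ≡ false → h u ≡ h v → k u ≡ k v → ⊥
  plain-clash {u} {v} s t c su sv o eh ek = go (std-v (sign-even v ov (not-root (Same-sym s) (sym c) sv)))
    where
    ov = trans (sym (same-parity (proj₂ s) c)) o
    std-u : h u ≡ k u
    std-u = subst (λ b → if b then Equal (h u) (k u) else Two (h u) (k u)) t (sign-even u o (not-root s c su))
    std-v : Std v (h v) (k v) → Two (h v) (k v)
    std-v = subst (λ b → if b then Equal (h v) (k v) else Two (h v) (k v)) (opposite-B (proj₁ s) t)
    hk : h v ≡ k v
    hk = trans (sym eh) (trans std-u ek)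
    go : Two (h v) (k v) → ⊥
    go (inj₁ e) = ℕₚ.m≢1+n+m (k v) {1} (trans (sym hk) e)
    go (inj₂ e) = ℕₚ.m≢1+n+m (h v) {1} (trans hk e)

  within-2 : ∀ u → h u ≤ 2 + k u × k u ≤ 2 + h u
  within-2 u with true⊎false (odd u)
  ... | inj₁ o = wider 1 (close 1 (sign-odd u o))
  ... | inj₂ o = [ (λ e → wider 1 (wider 0 (close 0 (inj₁ e)))) , close 2 ]′ (0-or-2 (isRoot? u))
    where
    std : ∀ {a b} → Std u a b → Equal a b ⊎ Two a b
    std s with side u
    ... | true = inj₁ s
    ... | false = inj₂ s
    0-or-2 : Dec (IsRoot u) → Equal (h u) (k u) ⊎ Two (h u) (k u)
    0-or-2 (no r) = std (sign-even u o r)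
    0-or-2 (yes r) = go (m u) refl
      where
      go : ∀ p → m u ≡ p → Equal (h u) (k u) ⊎ Two (h u) (k u)
      go nothing e = [ inj₁ , inj₂ ∘ inj₁ ]′ (sign-uncovered-root u r e)
      go (just y) e = Solo.w-0-2 {u} {y} (record { is-root = r ; matched = e })

  A-bound : ∀ {u} → side u ≡ true → soloed u ≡ false → k u ≤ 1 + h u
  A-bound {u} t su with true⊎false (odd u)
  ... | inj₁ o = proj₂ (close 1 (sign-odd u o))
  ... | inj₂ o with isRoot? u
  ... | no r = ℕₚ.≤-trans (ℕₚ.≤-reflexive (sym (subst (λ b → if b then Equal (h u) (k u) else Two (h u) (k u)) t (sign-even u o r)))) (ℕₚ.m≤n+m (h u) 1)
  ... | yes r = [ (λ e → proj₂ (wider 0 (close 0 (inj₁ e)))) , (λ e → ℕₚ.≤-trans (ℕₚ.m≤n+m (k u) 2) (ℕₚ.≤-trans (ℕₚ.≤-reflexive (sym e)) (ℕₚ.m≤n+m (h u) 1))) ]′ (sign-uncovered-root u r (root-uncovered su r))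

  A-equal : ∀ {z} → side z ≡ true → odd z ≡ false → ¬ Even z → h z ≡ k z
  A-equal {z} t o ne = subst (λ b → if b then Equal (h z) (k z) else Two (h z) (k z)) t (sign-even z o (ne ∘ proj₁))

  A-not-soloed : ∀ {z} → side z ≡ true → ¬ Even z → soloed z ≡ false
  A-not-soloed t ne = ¬true (λ s → ne (proj₁ (Solo.is-root (proj₂ (solo-A s t)))))

  OddPair : Fin n → Fin n → Set
  OddPair u v = side u ≡ true × OddConf u v

  oddPair? : ∀ u v → Dec (OddPair u v)
  oddPair? u v = (side u Bₚ.≟ true) ×-dec (Matchings.same? G u v ×-dec ((cov u Bₚ.≟ cov v) ×-dec (odd u Bₚ.≟ true)))

  module _ {u v : Fin n} (pr : OddPair u v) where
    private
      conf = proj₂ pr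
      s = proj₁ conf

    pair-odd : odd u ≡ true × odd v ≡ true
    pair-odd = proj₂ (proj₂ conf) , trans (sym (same-parity (proj₂ s) (proj₁ (proj₂ conf)))) (proj₂ (proj₂ conf))

    pair-B : side v ≡ false
    pair-B = opposite-B (proj₁ s) (proj₁ pr)

    pair-near : ∀ {z} → Path rest u z ⊎ Path rest v z → odd z ≡ true → z ≡ u ⊎ z ≡ v
    pair-near {z} p o = [ inj₁ , [ inj₂ , (λ e → ⊥-elim (true≢false o e)) ]′ ]′ (proj₂ (iso u v conf) z p)

    pair-match : ∀ {z} → m v ≡ just z → z ≡ u
    pair-match {z} e = [ (λ f → sym (Mₚ.just-injective (trans (sym (m-sym f)) e)))
      , (λ f → ⊥-elim (true≢false (cong is-just e) (trans (sym (proj₁ (proj₂ conf))) (cong is-just f)))) ]′ (proj₁ (iso u v conf))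

    neighbour : ∀ {z} → rest v z ≡ true → z ≡ u ⊎ (z ≢ u × side z ≡ true × odd z ≡ false × ¬ Even z)
    neighbour {z} r with z F.≟ u
    ... | yes e = inj₁ e
    ... | no z≢u = inj₂ (z≢u , zA , ¬true (λ o → [ z≢u , (λ { refl → true≢false zA pair-B }) ]′ (pair-near (inj₂ p) o))
          , λ e → true≢false (proj₂ pair-odd) (e v (flipPath p)))
      where
      p : Path rest v z
      p = step stop r
      zA = opposite-A (proj₁ (rest-elim r)) pair-B

    -- v has a neighbour z other than u. The edge v z is not in the matching, since v can only be
    -- matched to u. Hence z is in the component of v, where only u and v can be odd, and z is even
    -- without being a root.
    detour : ∃[ z ] (rest v z ≡ true × z ≢ u × side z ≡ true × odd z ≡ false × ¬ Even z)
    detour with other-neighbour (Same-sym s) u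
    ... | z , a , z≢u with rest-intro a (λ e → z≢u (pair-match e))
    ... | r = z , r , [ (λ e → ⊥-elim (z≢u e)) , id ]′ (neighbour r)

  pair-unique : ∀ {u u′ v} → OddPair u v → OddPair u′ v → u ≡ u′
  pair-unique {u} {u′} {v} p p′ with Mₚ.≡-dec F._≟_ (m v) (just u′)
  ... | yes e = sym (pair-match p e)
  ... | no e = [ sym , (λ q → ⊥-elim (true≢false (proj₁ p′) (trans (cong side q) (pair-B p)))) ]′
                 (pair-near p (inj₂ (step stop (rest-intro (proj₁ (Same-sym (proj₁ (proj₂ p′)))) e))) (proj₁ (pair-odd p′)))

  pair-unique-B : ∀ {u v v′} → OddPair u v → OddPair u v′ → v ≡ v′
  pair-unique-B {u} {v} {v′} p p′ with Mₚ.≡-dec F._≟_ (m u) (just v′)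
  ... | yes e = sym ([ (λ f → Mₚ.just-injective (trans (sym e) f)) , (λ f → ⊥-elim (just≢nothing e f)) ]′ (proj₁ (iso u v (proj₂ p))))
  ... | no e = [ (λ q → ⊥-elim (true≢false (proj₁ p) (trans (cong side (sym q)) (pair-B p′)))) , sym ]′
                 (pair-near p (inj₁ (step stop (rest-intro (proj₁ (proj₁ (proj₂ p′))) e))) (proj₂ (pair-odd p′)))

  -- This permits odd pairs to be treated independently, one component at a time.
  same-pair : ∀ {u v u′ v′} → OddPair u v → OddPair u′ v′ → Path rest v v′ ⊎ Path rest v u′ ⊎ Path rest u v′ ⊎ Path rest u u′ → v ≡ v′
  same-pair {u} {v} {u′} {v′} p p′ q = go q
    where
    B : v′ ≡ u ⊎ v′ ≡ v → v ≡ v′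
    B (inj₁ e) = ⊥-elim (true≢false (proj₁ p) (trans (cong side (sym e)) (pair-B p′)))
    B (inj₂ e) = sym e
    A : u′ ≡ u ⊎ u′ ≡ v → v ≡ v′
    A (inj₁ refl) = pair-unique-B p p′
    A (inj₂ e) = ⊥-elim (true≢false (proj₁ p′) (trans (cong side e) (pair-B p)))
    go : Path rest v v′ ⊎ Path rest v u′ ⊎ Path rest u v′ ⊎ Path rest u u′ → v ≡ v′
    go (inj₁ r) = B (pair-near p (inj₂ r) (proj₂ (pair-odd p′)))
    go (inj₂ (inj₁ r)) = A (pair-near p (inj₂ r) (proj₁ (pair-odd p′)))
    go (inj₂ (inj₂ (inj₁ r))) = B (pair-near p (inj₁ r) (proj₂ (pair-odd p′)))
    go (inj₂ (inj₂ (inj₂ r))) = A (pair-near p (inj₁ r) (proj₁ (pair-odd p′)))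

-- Even maximum degree

module EvenMaxDeg {n} (G : Graph n) (side : Fin n → Bool) (bip : Bip side (adj G))
                  (noiso : NoIsolatedEdge G) (fin : Matchings.Final G)
                  (x₀ : Rel n) (x₀-sym : Symm x₀) (spec₀ : Signed.SignSpec G side bip noiso fin x₀)
                  (t : ℕ) (deg≤ : ∀ u → deg G u ≤ t + t) where

  open Solos G side bip noiso fin x₀ x₀-sym spec₀

  -- Two classes with t + 1 colours and one matching colour make 2t + 3.
  q : ℕ
  q = suc t

  up : Fin n → Bool
  up y = does (h y ℕₚ.≟ 2 + k y)

  -- A solo edge joins the class that is larger at its end in B, read off from either end. There ±2
  -- becomes ±3, a difference that no vertex off the solo edges has.
  level : Fin n → Fin n → Bool
  level u v = if soloA u then up v else up u

  μ : Fin n → Maybe (Fin n)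
  μ u = if soloed u then nothing else m u

  soloH soloN H N : Rel n
  soloH u v = is (m u) v ∧ (soloed u ∧ level u v)
  soloN u v = is (m u) v ∧ (soloed u ∧ not (level u v))
  H u v = plus rest x u v ∨ soloH u v
  N u v = minus rest x u v ∨ soloN u v

  level-sym : ∀ {u v} → m u ≡ just v → soloed u ≡ true → level u v ≡ level v u
  level-sym {u} {v} e s with true⊎false (soloA u) | true⊎false (soloA v)
  ... | inj₁ a | inj₁ b = ⊥-elim (bip u v (proj₁ (m-adj e)) (trans (soloA-side a) (sym (soloA-side b))))
  ... | inj₁ a | inj₂ b rewrite a | b = refl
  ... | inj₂ a | inj₁ b rewrite a | b = refl
  ... | inj₂ a | inj₂ b = ⊥-elim (true≢false s (trans (soloed-just e) (cong₂ _∨_ a b)))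

  solo-rel-sym : (c : Bool → Bool) → Symm (λ u v → is (m u) v ∧ (soloed u ∧ c (level u v)))
  solo-rel-sym c u v = bool-ext (go u v) (go v u)
    where
    go : ∀ u v → is (m u) v ∧ (soloed u ∧ c (level u v)) ≡ true → is (m v) u ∧ (soloed v ∧ c (level v u)) ≡ true
    go u v e = let (i , s) = ∧-true {is (m u) v} e ; (su , l) = ∧-true {soloed u} s ; mu = is-≡ {m = m u} i in
      ∧-intro (≡-is (m-sym mu)) (∧-intro (trans (sym (soloed-partner mu)) su) (trans (cong c (sym (level-sym mu su))) l))

  class-sym : (c : Bool → Bool) → Symm (λ u v → rest u v ∧ c (x u v))
  class-sym c u v = cong₂ (λ r y → r ∧ c y) (rest-sym u v) (x-sym u v)

  H-sym : Symm H
  H-sym u v = cong₂ _∨_ (class-sym id u v) (solo-rel-sym id u v)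

  N-sym : Symm N
  N-sym u v = cong₂ _∨_ (class-sym not u v) (solo-rel-sym not u v)

  solo-cases : ∀ {u v} {b : Bool} → is (m u) v ∧ (soloed u ∧ b) ≡ true → m u ≡ just v × soloed u ≡ true × b ≡ true
  solo-cases {u} {v} e = let (i , s) = ∧-true {is (m u) v} e ; (su , l) = ∧-true {soloed u} s in is-≡ {m = m u} i , su , l

  H-cases : ∀ {u v} → H u v ≡ true → (rest u v ≡ true × x u v ≡ true) ⊎ (m u ≡ just v × soloed u ≡ true × level u v ≡ true)
  H-cases {u} {v} e = [ (λ p → inj₁ (∧-true {rest u v} p)) , (λ p → inj₂ (solo-cases {u} {v} p)) ]′ (∨-true {plus rest x u v} e)

  N-cases : ∀ {u v} → N u v ≡ true → (rest u v ≡ true × x u v ≡ false) ⊎ (m u ≡ just v × soloed u ≡ true × level u v ≡ false)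
  N-cases {u} {v} e = [ (λ p → let (a , b) = ∧-true {rest u v} p in inj₁ (a , not-true b))
                      , (λ p → let (a , b , c) = solo-cases {u} {v} p in inj₂ (a , b , not-true c)) ]′ (∨-true {minus rest x u v} e)

  rest-adj : ∀ {u v} → rest u v ≡ true → Adj G u v
  rest-adj r = proj₁ (rest-elim r)

  H-adj : ∀ {u v} → H u v ≡ true → Adj G u v
  H-adj = [ rest-adj ∘ proj₁ , (λ (e , _) → proj₁ (m-adj e)) ]′ ∘ H-cases

  N-adj : ∀ {u v} → N u v ≡ true → Adj G u v
  N-adj = [ rest-adj ∘ proj₁ , (λ (e , _) → proj₁ (m-adj e)) ]′ ∘ N-cases

  hc nc : Fin n → ℕ
  hc u = # (H u)
  nc u = # (N u)

  hc-split : ∀ u → hc u ≡ h u + # (soloH u)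
  hc-split u = #-∪ (plus rest x u) (soloH u) (λ i p s → proj₂ (rest-elim (proj₁ (∧-true {rest u i} p))) (proj₁ (solo-cases {u} {i} s)))

  nc-split : ∀ u → nc u ≡ k u + # (soloN u)
  nc-split u = #-∪ (minus rest x u) (soloN u) (λ i p s → proj₂ (rest-elim (proj₁ (∧-true {rest u i} p))) (proj₁ (solo-cases {u} {i} s)))

  none-solo : ∀ {u} (c : Fin n → Bool) → soloed u ≡ false → # (λ v → is (m u) v ∧ (soloed u ∧ c v)) ≡ 0
  none-solo {u} c s = #-zero (λ v → ¬true λ e → true≢false (proj₁ (proj₂ (solo-cases {u} {v} e))) s)

  hc-plain : ∀ {u} → soloed u ≡ false → hc u ≡ h u
  hc-plain {u} s = trans (hc-split u) (trans (cong (h u +_) (none-solo (level u) s)) (ℕₚ.+-identityʳ _))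

  nc-plain : ∀ {u} → soloed u ≡ false → nc u ≡ k u
  nc-plain {u} s = trans (nc-split u) (trans (cong (k u +_) (none-solo (not ∘ level u) s)) (ℕₚ.+-identityʳ _))

  module _ {w y} (S : Solo w y) where
    private
      sw = proj₁ (Solo-soloed S)
      sy = proj₂ (Solo-soloed S)
      aw : soloA w ≡ true
      aw = root-soloA (Solo.is-root S) (cong is-just (Solo.matched S))
      ay : soloA y ≡ false
      ay = ¬true (λ a → true≢false (soloA-side a) (Solo.y-B S))
      value : ∀ {u v} → m u ≡ just v → soloed u ≡ true → (c : Fin n → Bool) → # (λ v → is (m u) v ∧ (soloed u ∧ c v)) ≡ b2n (c v)
      value {u} {v} e s c = trans (#-is (λ v → soloed u ∧ c v) e) (cong (λ b → b2n (b ∧ c v)) s)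
      level-w : level w y ≡ up y
      level-w rewrite aw = refl
      level-y : level y w ≡ up y
      level-y rewrite ay = refl
      e = Solo.matched S

    hc-w : hc w ≡ h w + b2n (up y)
    hc-w = trans (hc-split w) (cong (h w +_) (trans (value e sw (level w)) (cong b2n level-w)))

    nc-w : nc w ≡ k w + b2n (not (up y))
    nc-w = trans (nc-split w) (cong (k w +_) (trans (value e sw (not ∘ level w)) (cong (b2n ∘ not) level-w)))

    hc-y : hc y ≡ h y + b2n (up y)
    hc-y = trans (hc-split y) (cong (h y +_) (trans (value (m-sym e) sy (level y)) (cong b2n level-y)))

    nc-y : nc y ≡ k y + b2n (not (up y))
    nc-y = trans (nc-split y) (cong (k y +_) (trans (value (m-sym e) sy (not ∘ level y)) (cong (b2n ∘ not) level-y)))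

    target-3 : hc y ≡ 3 + nc y ⊎ nc y ≡ 3 + hc y
    target-3 with Solo.y-two S
    ... | inj₁ p = inj₁ (trans hc-y (trans (cong₂ (λ a b → a + b2n b) p upy)
            (trans (ℕₚ.+-comm (2 + k y) 1) (cong (3 +_) (sym (trans nc-y (trans (cong (λ b → k y + b2n (not b)) upy) (ℕₚ.+-identityʳ _))))))))
      where
      upy : up y ≡ true
      upy = dec-true (h y ℕₚ.≟ 2 + k y) p
    ... | inj₂ p = inj₂ (trans nc-y (trans (cong₂ (λ a b → a + b2n (not b)) p upy)
            (trans (ℕₚ.+-comm (2 + h y) 1) (cong (3 +_) (sym (trans hc-y (trans (cong (λ b → h y + b2n b) upy) (ℕₚ.+-identityʳ _))))))))
      where
      upy : up y ≡ false
      upy = dec-false (h y ℕₚ.≟ 2 + k y) (λ f → ℕₚ.m≢1+n+m (k y) {3} (trans p (cong (2 +_) f)))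

    -- The bound nc ≤ 1 + hc could fail only if k = 2 + h held at both w and y, and `Solo.unequal`
    -- excludes that.
    solo-w-1 : hc w ≤ 3 + nc w × nc w ≤ 1 + hc w
    solo-w-1 with Solo.y-two S
    ... | inj₁ p = subst₂ (λ a b → a ≤ 3 + b × b ≤ 1 + a) (sym hw) (sym nw) (Product.map s≤s id (within-2 w))
      where
      upy : up y ≡ true
      upy = dec-true (h y ℕₚ.≟ 2 + k y) p
      hw : hc w ≡ 1 + h w
      hw = trans hc-w (trans (cong (λ b → h w + b2n b) upy) (ℕₚ.+-comm (h w) 1))
      nw : nc w ≡ k w
      nw = trans nc-w (trans (cong (λ b → k w + b2n (not b)) upy) (ℕₚ.+-identityʳ _))
    ... | inj₂ p = subst₂ (λ a b → a ≤ 3 + b × b ≤ 1 + a) (sym hw) (sym nw)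
        (ℕₚ.≤-trans (proj₁ (within-2 w)) (ℕₚ.+-mono-≤ (ℕₚ.n≤1+n 2) (ℕₚ.n≤1+n (k w))) , s≤s (k≤h (Solo.w-0-2 S)))
      where
      upy : up y ≡ false
      upy = dec-false (h y ℕₚ.≟ 2 + k y) (λ f → ℕₚ.m≢1+n+m (k y) {3} (trans p (cong (2 +_) f)))
      hw : hc w ≡ h w
      hw = trans hc-w (trans (cong (λ b → h w + b2n b) upy) (ℕₚ.+-identityʳ _))
      nw : nc w ≡ 1 + k w
      nw = trans nc-w (trans (cong (λ b → k w + b2n (not b)) upy) (ℕₚ.+-comm (k w) 1))
      k≤h : Equal (h w) (k w) ⊎ Two (h w) (k w) → k w ≤ h w
      k≤h (inj₁ f) = ℕₚ.≤-reflexive (sym f)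
      k≤h (inj₂ (inj₁ f)) = ℕₚ.≤-trans (ℕₚ.m≤n+m (k w) 2) (ℕₚ.≤-reflexive (sym f))
      k≤h (inj₂ (inj₂ f)) = ⊥-elim (Solo.unequal S (trans (cong (h w +_) p) (trans (ℕₚ.+-comm (h w) (2 + h y))
        (trans (cong (2 +_) (ℕₚ.+-comm (h y) (h w))) (trans (ℕₚ.+-comm (2 + h w) (h y)) (cong (h y +_) (sym f)))))))

  A-1 : ∀ {u} → side u ≡ true → nc u ≤ 1 + hc u
  A-1 {u} t with true⊎false (soloed u)
  ... | inj₁ s = proj₂ (solo-w-1 (proj₂ (solo-A s t)))
  ... | inj₂ f rewrite hc-plain f | nc-plain f = A-bound t f

  within-3 : ∀ u → hc u ≤ 3 + nc u × nc u ≤ 3 + hc u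
  within-3 u with true⊎false (soloed u)
  ... | inj₂ f rewrite hc-plain f | nc-plain f = wider 2 (within-2 u)
  ... | inj₁ s with true⊎false (side u)
  ... | inj₁ a = let (p , r) = solo-w-1 (proj₂ (solo-A s a)) in p , ℕₚ.≤-trans r (ℕₚ.+-monoˡ-≤ (hc u) (s≤s z≤n))
  ... | inj₂ b = close 3 (target-3 (proj₂ (solo-B s b)))

  μ-plain : ∀ {u} → soloed u ≡ false → is-just (μ u) ≡ cov u
  μ-plain f rewrite f = refl

  μ-soloed : ∀ {u} → soloed u ≡ true → is-just (μ u) ≡ false
  μ-soloed s rewrite s = refl

  deg-μ : ∀ u → hc u + nc u + b2n (is-just (μ u)) ≡ deg G u
  deg-μ u with true⊎false (soloed u)
  ... | inj₂ f = trans (cong₂ _+_ (cong₂ _+_ (hc-plain f) (nc-plain f)) (cong b2n (μ-plain f)))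
                   (trans (cong (_+ b2n (cov u)) (h+k u)) (sym (deg-rest u)))
  ... | inj₁ s = trans (cong (λ b → hc u + nc u + b2n b) (μ-soloed s))
                   (trans (ℕₚ.+-identityʳ _) (trans (go (soloed-match s)) (sym (deg-rest u))))
    where
    go : ∃[ v ] (m u ≡ just v × (soloA u ≡ true ⊎ soloA v ≡ true)) → hc u + nc u ≡ # (rest u) + b2n (cov u)
    go (v , e , _) = trans (cong₂ _+_ (hc-split u) (nc-split u)) (trans (lem (h u) (k u) _ _)
        (cong₂ _+_ (h+k u) (trans (cong₂ _+_ (val id) (val not)) (trans (bn (level u v)) (cong b2n (sym (cong is-just e)))))))
      where
      lem : ∀ a b c d → (a + c) + (b + d) ≡ (a + b) + (c + d)
      lem a b c d = trans (ℕₚ.+-assoc a c (b + d)) (trans (cong (a +_) (trans (sym (ℕₚ.+-assoc c b d))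
        (trans (cong (_+ d) (ℕₚ.+-comm c b)) (ℕₚ.+-assoc b c d)))) (sym (ℕₚ.+-assoc a b (c + d))))
      val : ∀ (c : Bool → Bool) → # (λ v → is (m u) v ∧ (soloed u ∧ c (level u v))) ≡ b2n (c (level u v))
      val c = trans (#-is (λ v → soloed u ∧ c (level u v)) e) (cong (λ b → b2n (b ∧ c (level u v))) s)
      bn : ∀ b → b2n b + b2n (not b) ≡ 1
      bn true = refl
      bn false = refl

  hc+nc≤ : ∀ u → hc u + nc u ≤ t + t
  hc+nc≤ u = ℕₚ.≤-trans (ℕₚ.m≤m+n _ (b2n (is-just (μ u)))) (subst (_≤ t + t) (sym (deg-μ u)) (deg≤ u))

  q+q : 1 + (q + q) ≡ 3 + (t + t)
  q+q = cong (2 +_) (ℕₚ.+-suc t t)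

  -- A difference of at most 3 and a sum of at most 2t give 2 hc ≤ 2t + 3, hence hc ≤ t + 1.
  H≤q : ∀ u → hc u ≤ q
  H≤q u = near-half 3 q (proj₁ (within-3 u)) (subst (3 + (hc u + nc u) ≤_) (sym q+q) (ℕₚ.+-monoʳ-≤ 3 (hc+nc≤ u)))

  N≤q : ∀ u → nc u ≤ q
  N≤q u = near-half 3 q (proj₂ (within-3 u)) (subst (3 + (nc u + hc u) ≤_) (sym q+q)
            (ℕₚ.+-monoʳ-≤ 3 (subst (_≤ t + t) (ℕₚ.+-comm (hc u) (nc u)) (hc+nc≤ u))))

  SameProfile : Fin n → Fin n → Set
  SameProfile u v = hc u ≡ hc v × nc u ≡ nc v × is-just (μ u) ≡ is-just (μ v)

  -- Off the solo edges `plain-clash` leaves only odd vertices. If both ends are soloed,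
  -- `solo-clash` applies. If only u is, its neighbours are all matched while the profile wants v
  -- unmatched. If only v is, u is unmatched and v matched with equal degrees, so u is odd with
  -- difference ±1, against ±3 at v.
  profile-pair : ∀ {u v} → Adj G u v → side u ≡ true → SameProfile u v → OddPair u v
  profile-pair {u} {v} a su (eh , en , eμ) = go (true⊎false (soloed u)) (true⊎false (soloed v))
    where
    d : deg G u ≡ deg G v
    d = trans (sym (deg-μ u)) (trans (cong₂ _+_ (cong₂ _+_ eh en) (cong b2n eμ)) (deg-μ v))
    go : soloed u ≡ true ⊎ soloed u ≡ false → soloed v ≡ true ⊎ soloed v ≡ false → OddPair u v
    go (inj₂ f) (inj₂ g) = [ (λ o → su , (a , d) , c , o)
                           , (λ o → ⊥-elim (plain-clash (a , d) su c f g o (trans (sym (hc-plain f)) (trans eh (hc-plain g)))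
                               (trans (sym (nc-plain f)) (trans en (nc-plain g))))) ]′ (true⊎false (odd u))
      where
      c : cov u ≡ cov v
      c = trans (sym (μ-plain f)) (trans eμ (μ-plain g))
    go (inj₁ s) (inj₁ r) = ⊥-elim (solo-clash a su s r clash)
      where
      clash : h u + k v ≡ h v + k u
      clash with solo-A s su
      ... | y , S with y F.≟ v
      ... | no y≢v = ⊥-elim (Solo.y-not-even (proj₂ (solo-B r (opposite-B a su)))
              (proj₁ (solo-neighbour s su a (λ e → y≢v (Mₚ.just-injective (trans (sym (Solo.matched S)) e))))))
      ... | yes refl = cong₂ _+_ (ℕₚ.+-cancelʳ-≡ _ (h u) (h y) (trans (sym (hc-w S)) (trans eh (hc-y S))))
                                        (sym (ℕₚ.+-cancelʳ-≡ _ (k u) (k y) (trans (sym (nc-w S)) (trans en (nc-y S)))))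
    go (inj₁ s) (inj₂ g) = ⊥-elim (true≢false (proj₂ (solo-neighbour s su a (λ e → true≢false (cong is-just (m-sym e)) cv))) cv)
      where
      cv : cov v ≡ false
      cv = trans (sym (μ-plain g)) (trans (sym eμ) (μ-soloed s))
    go (inj₂ f) (inj₁ r) = ⊥-elim (three (target-3 S) (sign-odd u ou))
      where
      S = proj₂ (solo-B r (opposite-B a su))
      cu : cov u ≡ false
      cu = trans (sym (μ-plain f)) (trans eμ (μ-soloed r))
      cv : cov v ≡ true
      cv = cong is-just (m-sym (Solo.matched S))
      ou : odd u ≡ true
      ou = trans (cong₂ (λ a b → par a xor b) d cu) (lem (par (deg G v)) (trans (cong (par (deg G v) xor_) (sym cv)) (Solo.y-even S)))
        where
        lem : ∀ p → p xor true ≡ false → p xor false ≡ true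
        lem true _ = refl
      three : hc v ≡ 3 + nc v ⊎ nc v ≡ 3 + hc v → One (h u) (k u) → ⊥
      three w o = contra w (subst₂ One (sym (trans (sym eh) (hc-plain f))) (sym (trans (sym en) (nc-plain f))) o)
        where
        contra : ∀ {a b} → a ≡ 3 + b ⊎ b ≡ 3 + a → One a b → ⊥
        contra {a} {b} (inj₁ p) (inj₁ r) = ℕₚ.m≢1+n+m (1 + b) {1} (trans (sym r) p)
        contra {a} {b} (inj₁ p) (inj₂ r) = ℕₚ.m≢1+n+m b {3} (trans r (cong suc p))
        contra {a} {b} (inj₂ p) (inj₁ r) = ℕₚ.m≢1+n+m a {3} (trans r (cong suc p))
        contra {a} {b} (inj₂ p) (inj₂ r) = ℕₚ.m≢1+n+m (1 + a) {1} (trans (sym r) p)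

-- Even maximum degree: gluing over components and colouring the vertices.

module EvenColouring {n} (G : Graph n) (side : Fin n → Bool) (bip : Bip side (adj G))
                     (noiso : NoIsolatedEdge G) (fin : Matchings.Final G)
                     (x₀ : Rel n) (x₀-sym : Symm x₀) (spec₀ : Signed.SignSpec G side bip noiso fin x₀)
                     (t : ℕ) (deg≤ : ∀ u → deg G u ≤ t + t) where

  open Solos G side bip noiso fin x₀ x₀-sym spec₀
  open EvenMaxDeg G side bip noiso fin x₀ x₀-sym spec₀ t deg≤

  -- An all-covered even component is attached, through the matching edge at its root, to another one.
  tgtOf : ∀ a → Dec (Even a) → Maybe (Fin n) → Fin n
  tgtOf a (yes _) (just y) = y
  tgtOf a (yes _) nothing = a
  tgtOf a (no _) _ = a

  tgt : Fin n → Fin n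
  tgt a = tgtOf a (even? a) (m (root a))

  tgt-not-even : ∀ {a} → ¬ Even a → tgt a ≡ a
  tgt-not-even {a} ne with even? a
  ... | yes e = ⊥-elim (ne e)
  ... | no _ = refl

  tgt-root : ∀ {w y} → IsRoot w → m w ≡ just y → tgt w ≡ y
  tgt-root {w} {y} (e , r) mw = trans (cong (λ z → tgtOf w (even? w) (m z)) r) (trans (cong (tgtOf w (even? w)) mw) (go (even? w)))
    where
    go : (d : Dec (Even w)) → tgtOf w d (just y) ≡ y
    go (yes _) = refl
    go (no ¬e) = ⊥-elim (¬e e)

  tgt-path : ∀ {a b} → Path rest a b → tgt a ≡ tgt b ⊎ Path rest (tgt a) (tgt b)
  tgt-path {a} {b} p rewrite root-cong p with even? a | even? b | m (root b)
  ... | yes _ | yes _ | just y = inj₁ refl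
  ... | yes _ | yes _ | nothing = inj₂ p
  ... | no _ | no _ | _ = inj₂ p
  ... | yes e | no ¬e | _ = ⊥-elim (¬e (Even-path p e))
  ... | no ¬e | yes e | _ = ⊥-elim (¬e (Even-path (flipPath p) e))

  Near : Fin n → Fin n → Set
  Near s v = ∃[ u ] (OddPair u v × (Path rest s v ⊎ Path rest s u))

  near? : ∀ s v → Dec (Near s v)
  near? s v = Fₚ.any? (λ u → oddPair? u v ×-dec (path? rest s v ⊎-dec path? rest s u))

  -- The odd pair whose colouring is used around a, named by its end in B. It is constant along the
  -- edges of `H` and `N`, solo edges included.
  sel : Fin n → Maybe (Fin n)
  sel a = find (λ v → does (near? (tgt a) v))

  sel-cong : ∀ {a b} → tgt a ≡ tgt b ⊎ Path rest (tgt a) (tgt b) → sel a ≡ sel b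
  sel-cong {a} {b} (inj₁ e) = cong (λ s → find (λ v → does (near? s v))) e
  sel-cong {a} {b} (inj₂ p) = find-cong (λ v → bool-ext (λ e → dec-true (near? (tgt b) v) (move (flipPath p) (does-true (near? (tgt a) v) e)))
      (λ e → dec-true (near? (tgt a) v) (move p (does-true (near? (tgt b) v) e))))
    where
    move : ∀ {s s′ v} → Path rest s s′ → Near s′ v → Near s v
    move p (u , pr , inj₁ r) = u , pr , inj₁ (path-trans p r)
    move p (u , pr , inj₂ r) = u , pr , inj₂ (path-trans p r)

  -- The root w is followed to y, and y stays put because its component has odd vertices;
  -- attachments do not chain.
  sel-solo : ∀ {w y} → Solo w y → sel w ≡ sel y
  sel-solo S = sel-cong (inj₁ (trans (tgt-root (Solo.is-root S) (Solo.matched S)) (sym (tgt-not-even (Solo.y-not-even S)))))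

  sel-matched : ∀ {u v} → m u ≡ just v → soloed u ≡ true → sel u ≡ sel v
  sel-matched {u} {v} e s with soloed-match s
  ... | z , f , inj₁ a = sel-solo (record { is-root = proj₁ (soloA-root a) ; matched = e })
  ... | z , f , inj₂ a = sym (sel-solo (record { is-root = subst IsRoot (Mₚ.just-injective (trans (sym f) e)) (proj₁ (soloA-root a)) ; matched = m-sym e }))

  sel-rest : ∀ {u v} → rest u v ≡ true → sel u ≡ sel v
  sel-rest r = sel-cong (tgt-path (step stop r))

  pair-sel : ∀ {u v} → OddPair u v → sel u ≡ just v × sel v ≡ just v
  pair-sel {u} {v} p = at u (inj₂ stop) (proj₁ (pair-odd p)) from-u , at v (inj₁ stop) (proj₂ (pair-odd p)) from-v
    where
    from-u : ∀ {u′ v′} → OddPair u′ v′ → Path rest u v′ ⊎ Path rest u u′ → v ≡ v′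
    from-u p′ q = same-pair p p′ (inj₂ (inj₂ q))
    from-v : ∀ {u′ v′} → OddPair u′ v′ → Path rest v v′ ⊎ Path rest v u′ → v ≡ v′
    from-v p′ q = same-pair p p′ ([ inj₁ , inj₂ ∘ inj₁ ]′ q)
    at : ∀ a → Path rest a v ⊎ Path rest a u → odd a ≡ true → (∀ {u′ v′} → OddPair u′ v′ → Path rest a v′ ⊎ Path rest a u′ → v ≡ v′) → sel a ≡ just v
    at a q o only = go (sel a) refl
      where
      ta : tgt a ≡ a
      ta = tgt-not-even (λ e → true≢false o (e a stop))
      here′ : Near (tgt a) v
      here′ = subst (λ s → Near s v) (sym ta) (u , p , q)
      go : ∀ r → sel a ≡ r → sel a ≡ just v
      go nothing e = ⊥-elim (true≢false (dec-true (near? (tgt a) v) here′) (find-nothing _ e v))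
      go (just v′) e with does-true (near? (tgt a) v′) (find-just _ e)
      ... | u′ , p′ , q′ = trans e (cong just (sym (only p′ (subst (λ s → Path rest s v′ ⊎ Path rest s u′) ta q′))))

  H-bip : Bip side H
  H-bip u v e = bip u v (H-adj e)

  N-bip : Bip side N
  N-bip u v e = bip u v (N-adj e)

  Both : Set
  Both = Col H (Fin q) × Col N (Fin q)

  Distinct : Both → Fin n → Fin n → Set
  Distinct (φ , ψ) u v = ¬ ((∀ c → seen φ u c ≡ seen φ v c) × (∀ c → seen ψ u c ≡ seen ψ v c))

  -- The pair is separated by inserting last an edge v z with z on the side of u.
  special : ∀ {u v} → OddPair u v → Σ Both λ Φ → Distinct Φ u v
  special {u} {v} p with detour p
  ... | z , r , z≢u , zA , oz , nz = go (true⊎false (x v z))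
    where
    ov = proj₂ (pair-odd p)
    fv = odd-not-soloed ov
    fz = A-not-soloed zA nz
    eqz = A-equal zA oz nz
    1+≤ : ∀ a b u → a + b ≡ # (rest u) → 1 + (a + b) ≤ 1 + (t + t)
    1+≤ a b u e = s≤s (ℕₚ.≤-trans (ℕₚ.≤-reflexive e) (ℕₚ.≤-trans (ℕₚ.m≤m+n _ (b2n (cov u))) (subst (_≤ t + t) (deg-rest u) (deg≤ u))))
    comm : ∀ u → k u + h u ≡ # (rest u)
    comm u = trans (ℕₚ.+-comm (k u) (h u)) (h+k u)
    -- The difference is ±1 at v and 0 at z, so both classes have at most t edges there: this is the
    -- slack that `koenig-distinct` asks for.
    hv : hc v < q
    hv = s≤s (subst (_≤ t) (sym (hc-plain fv)) (near-half 1 t (proj₁ (close 1 (sign-odd v ov))) (1+≤ (h v) (k v) v (h+k v))))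
    nv : nc v < q
    nv = s≤s (subst (_≤ t) (sym (nc-plain fv)) (near-half 1 t (proj₂ (close 1 (sign-odd v ov))) (1+≤ (k v) (h v) v (comm v))))
    hz : hc z < q
    hz = s≤s (subst (_≤ t) (sym (hc-plain fz)) (near-half 1 t (ℕₚ.≤-trans (ℕₚ.≤-reflexive eqz) (ℕₚ.m≤n+m _ 1)) (1+≤ (h z) (k z) z (h+k z))))
    nz′ : nc z < q
    nz′ = s≤s (subst (_≤ t) (sym (nc-plain fz)) (near-half 1 t (ℕₚ.≤-trans (ℕₚ.≤-reflexive (sym eqz)) (ℕₚ.m≤n+m _ 1)) (1+≤ (k z) (h z) z (comm z))))
    sides : side u ≡ side z
    sides = trans (proj₁ p) (sym zA)
    go : x v z ≡ true ⊎ x v z ≡ false → Σ Both λ Φ → Distinct Φ u v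
    via-H : Σ (Col H (Fin q)) (λ φ → ¬ (∀ c → seen φ u c ≡ seen φ v c)) → Σ Both λ Φ → Distinct Φ u v
    via-H (φ , d) = (φ , koenig side N N-sym N-bip N≤q) , d ∘ proj₁
    via-N : Σ (Col N (Fin q)) (λ ψ → ¬ (∀ c → seen ψ u c ≡ seen ψ v c)) → Σ Both λ Φ → Distinct Φ u v
    via-N (ψ , d) = (koenig side H H-sym H-bip H≤q , ψ) , d ∘ proj₂
    go (inj₁ e) = via-H (koenig-distinct side H H-sym H-bip H≤q u v z (∨-introˡ (∧-intro r e)) sides (z≢u ∘ sym) hv hz)
    go (inj₂ e) = via-N (koenig-distinct side N N-sym N-bip N≤q u v z (∨-introˡ (∧-intro r (not-false e))) sides (z≢u ∘ sym) nv nz′)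

  familyOf : ∀ {v} → Dec (∃[ u ] OddPair u v) → Both
  familyOf (yes (u , p)) = proj₁ (special p)
  familyOf (no _) = koenig side H H-sym H-bip H≤q , koenig side N N-sym N-bip N≤q

  family : Maybe (Fin n) → Both
  family (just v) = familyOf (Fₚ.any? (λ u → oddPair? u v))
  family nothing = koenig side H H-sym H-bip H≤q , koenig side N N-sym N-bip N≤q

  -- The family chooses its own partner of v in A; `pair-unique` identifies it with u.
  family-distinct : ∀ {u v} → OddPair u v → Distinct (family (just v)) u v
  family-distinct {u} {v} p = go (Fₚ.any? (λ u → oddPair? u v))
    where
    go : (d : Dec (∃[ u ] OddPair u v)) → Distinct (familyOf d) u v
    go (no h) = ⊥-elim (h (u , p))
    go (yes (u′ , p′)) = subst (λ u → Distinct (proj₁ (special p′)) u v) (pair-unique p′ p) (proj₂ (special p′))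

  H-colouring : Σ (Col H (Fin q)) λ φ → ∀ a c → nb φ a c ≡ nb (proj₁ (family (sel a))) a c
  H-colouring = glue (proj₁ ∘ family) sel (λ a b e → [ (λ (r , _) → sel-rest r) , (λ (f , s , _) → sel-matched f s) ]′ (H-cases e))

  N-colouring : Σ (Col N (Fin q)) λ φ → ∀ a c → nb φ a c ≡ nb (proj₂ (family (sel a))) a c
  N-colouring = glue (proj₂ ∘ family) sel (λ a b e → [ (λ (r , _) → sel-rest r) , (λ (f , s , _) → sel-matched f s) ]′ (N-cases e))

  μ-sym : ∀ {u v} → μ u ≡ just v → μ v ≡ just u
  μ-sym {u} {v} e with true⊎false (soloed u)
  ... | inj₁ s = ⊥-elim (just≢nothing e (cong (λ b → if b then nothing else m u) s))
  ... | inj₂ f = trans (cong (λ b → if b then nothing else m v) (trans (sym (soloed-partner mu)) f)) (m-sym mu)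
    where
    mu : m u ≡ just v
    mu = trans (sym (cong (λ b → if b then nothing else m u) f)) e

  μ-just : ∀ {u v} → μ u ≡ just v → m u ≡ just v × soloed u ≡ false
  μ-just {u} {v} e with true⊎false (soloed u)
  ... | inj₁ s = ⊥-elim (just≢nothing e (cong (λ b → if b then nothing else m u) s))
  ... | inj₂ f = trans (sym (cong (λ b → if b then nothing else m u) f)) e , f

  HN-disjoint : ∀ u v → H u v ≡ true → N u v ≡ true → ⊥
  HN-disjoint u v e f with H-cases e | N-cases f
  ... | inj₁ (_ , a) | inj₁ (_ , b) = true≢false a b
  ... | inj₂ (_ , _ , a) | inj₂ (_ , _ , b) = true≢false a b
  ... | inj₁ (r , _) | inj₂ (e′ , _) = proj₂ (rest-elim r) e′
  ... | inj₂ (e′ , _) | inj₁ (r , _) = proj₂ (rest-elim r) e′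

  μ-disjoint : ∀ u v → (H ∪ N) u v ≡ true → is (μ u) v ≡ true → ⊥
  μ-disjoint u v e f with μ-just (is-≡ {m = μ u} f)
  ... | mu , su = [ (λ a → [ (λ (r , _) → proj₂ (rest-elim r) mu) , (λ (_ , s , _) → true≢false s su) ]′ (H-cases a))
                  , (λ a → [ (λ (r , _) → proj₂ (rest-elim r) mu) , (λ (_ , s , _) → true≢false s su) ]′ (N-cases a)) ]′ (∨-true {H u v} e)

  covers : ∀ u v → ((H ∪ N) ∪ (λ u v → is (μ u) v)) u v ≡ adj G u v
  covers u v = bool-ext
    (λ e → [ (λ e → [ H-adj , N-adj ]′ (∨-true {H u v} e)) , (λ f → proj₁ (m-adj (proj₁ (μ-just (is-≡ {m = μ u} f))))) ]′ (∨-true {(H ∪ N) u v} e))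
    (λ a → classify a (Mₚ.≡-dec F._≟_ (m u) (just v)))
    where
    classify : Adj G u v → Dec (m u ≡ just v) → ((H ∪ N) ∪ (λ u v → is (μ u) v)) u v ≡ true
    classify a (no ne) = ∨-introˡ ([ (λ p → ∨-introˡ (∨-introˡ (∧-intro (rest-intro a ne) p)))
      , (λ p → ∨-introʳ {H u v} (∨-introˡ (∧-intro (rest-intro a ne) (not-false p)))) ]′ (true⊎false (x u v)))
    classify a (yes e) = [ (λ s → ∨-introˡ ([ (λ p → ∨-introˡ (∨-introʳ {plus rest x u v} (∧-intro (≡-is e) (∧-intro s p))))
        , (λ p → ∨-introʳ {H u v} (∨-introʳ {minus rest x u v} (∧-intro (≡-is e) (∧-intro s (not-false p))))) ]′ (true⊎false (level u v))))
      , (λ f → ∨-introʳ {(H ∪ N) u v} (≡-is (trans (cong (λ b → if b then nothing else m u) f) e))) ]′ (true⊎false (soloed u))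

  Colour : Set
  Colour = (Fin q ⊎ Fin q) ⊎ ⊤

  colouring : Col (adj G) Colour
  colouring = proj₁ (Col-resp covers (unite (unite (proj₁ H-colouring) (proj₁ N-colouring) HN-disjoint) (matchingCol μ μ-sym) μ-disjoint))

  -- From nc ≤ 1 + hc and hc + nc ≤ 2t follows nc ≤ t, one below q.
  A-missing : ∀ u → side u ≡ true → ∃[ c ] nb (proj₁ N-colouring) u c ≡ nothing
  A-missing u s = missing (proj₁ N-colouring) u (s≤s (near-half 1 t (A-1 s)
    (s≤s (subst (_≤ t + t) (ℕₚ.+-comm (hc u) (nc u)) (hc+nc≤ u)))))

  -- The matching edge leaves at most 2t - 1 edges for the two classes, so hc ≤ 2 + nc gives hc ≤ t.
  B-missing : ∀ v {w} → μ v ≡ just w → ∃[ c ] nb (proj₁ H-colouring) v c ≡ nothing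
  B-missing v {w} e = missing (proj₁ H-colouring) v (s≤s (near-half 2 t bound
      (s≤s (subst (_≤ t + t) (ℕₚ.+-comm (hc v + nc v) 1) (subst (λ b → hc v + nc v + b2n b ≤ t + t) (cong is-just e)
        (subst (_≤ t + t) (sym (deg-μ v)) (deg≤ v)))))))
    where
    f = proj₂ (μ-just e)
    bound : hc v ≤ 2 + nc v
    bound = subst₂ _≤_ (sym (hc-plain f)) (cong (2 +_) (sym (nc-plain f))) (proj₁ (within-2 v))

  -- A uses colours of `N` only, B the matching colour or colours of `H`, so adjacent vertices never
  -- agree.
  vertexOf : ∀ u (s : side u ≡ true ⊎ side u ≡ false) p → μ u ≡ p → Colour
  vertexOf u (inj₁ s) p e = inj₁ (inj₂ (proj₁ (A-missing u s)))
  vertexOf u (inj₂ s) nothing e = inj₂ tt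
  vertexOf u (inj₂ s) (just w) e = inj₁ (inj₁ (proj₁ (B-missing u e)))

  vertexOf-free : ∀ u s p e → nb colouring u (vertexOf u s p e) ≡ nothing
  vertexOf-free u (inj₁ s) p e = proj₂ (A-missing u s)
  vertexOf-free u (inj₂ s) nothing e = e
  vertexOf-free u (inj₂ s) (just w) e = proj₂ (B-missing u e)

  vertex-proper : ∀ u v (s : side u ≡ true) → side v ≡ false → ∀ su sv p p′ e e′ → vertexOf u su p e ≢ vertexOf v sv p′ e′
  vertex-proper u v s f (inj₂ s′) sv p p′ e e′ q = true≢false s s′
  vertex-proper u v s f (inj₁ s′) (inj₁ f′) p p′ e e′ q = true≢false f′ f
  vertex-proper u v s f (inj₁ s′) (inj₂ f′) p nothing e e′ ()
  vertex-proper u v s f (inj₁ s′) (inj₂ f′) p (just w) e e′ ()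

  -- Equal colour sets have equal sizes in every class, which leaves only an odd pair; around it the
  -- glued colouring is the member of the family that separates this pair.
  distinguishes : ∀ u v → Adj G u v → side u ≡ true → ¬ (∀ c → seen colouring u c ≡ seen colouring v c)
  distinguishes u v a s eq = family-distinct p (same {pick = proj₁} φ (proj₂ H-colouring) (λ c → eq (inj₁ (inj₁ c))) , same {pick = proj₂} ψ (proj₂ N-colouring) (λ c → eq (inj₁ (inj₂ c))))
    where
    φ = proj₁ H-colouring
    ψ = proj₁ N-colouring
    p : OddPair u v
    p = profile-pair a s
      ( trans (sym (#-seen φ u)) (trans (#-cong (λ c → eq (inj₁ (inj₁ c)))) (#-seen φ v))
      , trans (sym (#-seen ψ u)) (trans (#-cong (λ c → eq (inj₁ (inj₂ c)))) (#-seen ψ v))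
      , eq (inj₂ tt) )
    same : ∀ {R} {pick : Both → Col R (Fin q)} (χ : Col R (Fin q)) → (∀ a c → nb χ a c ≡ nb (pick (family (sel a))) a c) →
           (∀ c → seen χ u c ≡ seen χ v c) → ∀ c → seen (pick (family (just v))) u c ≡ seen (pick (family (just v))) v c
    same {pick = pick} χ h e c = trans (sym (at u (proj₁ (pair-sel p)))) (trans (e c) (at v (proj₂ (pair-sel p))))
      where
      at : ∀ a → sel a ≡ just v → seen χ a c ≡ seen (pick (family (just v))) a c
      at a e = cong is-just (trans (h a c) (cong (λ i → nb (pick (family i)) a c) e))

  avd : TotalAVD G (suc (q + q))
  avd = Assemble.totalAVD G (plus-one (F.join q q)) (plus-one-injective (F.join q q) (join-injective q q)) (inj₂ tt) colouring
    side (λ u v → bip u v) (λ u → vertexOf u (true⊎false (side u)) (μ u) refl) (λ u → vertexOf-free u (true⊎false (side u)) (μ u) refl)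
    (λ u v a s → vertex-proper u v s (opposite-B a s) _ _ _ _ refl refl)
    distinguishes

-- Odd maximum degree

module OddColouring {n} (G : Graph n) (side : Fin n → Bool) (bip : Bip side (adj G))
                    (noiso : NoIsolatedEdge G) (fin : Matchings.Final G)
                    (x₀ : Rel n) (x₀-sym : Symm x₀) (spec₀ : Signed.SignSpec G side bip noiso fin x₀)
                    (t : ℕ) (deg≤ : ∀ u → deg G u ≤ suc (t + t)) where

  open Solos G side bip noiso fin x₀ x₀-sym spec₀

  -- Two classes with t + 1 colours and one colour each for `μ` and `γ` make 2t + 4.
  q : ℕ
  q = suc t

  recOf : ∀ v → Dec (∃[ u ] OddPair u v) → Maybe (Fin n)
  recOf v (yes (u , p)) = just (proj₁ (detour p))
  recOf v (no _) = nothing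

  -- `γ` is a second matching: it takes the solo edges and, for every odd pair, the edge from v to
  -- its `detour`. `recA` reads `recB` from the other end.
  recB recA γ μ : Fin n → Maybe (Fin n)
  recB v = recOf v (Fₚ.any? (λ u → oddPair? u v))
  recA a = find (λ v → is (recB v) a)
  γ u = if soloed u then m u else (if side u then recA u else recB u)
  μ u = if soloed u then nothing else m u

  -- At the end v of each odd pair one edge v z is moved to the class γ, which breaks the tie.
  record Recoloured (v z : Fin n) : Set where
    field
      {u}      : Fin n
      pair     : OddPair u v
      z-rest   : rest v z ≡ true
      z-A      : side z ≡ true
      z-even   : odd z ≡ false
      z-other  : ¬ Even z

    v-odd : odd v ≡ true
    v-odd = proj₂ (pair-odd pair)

    v-B : side v ≡ false
    v-B = pair-B pair

    v-plain : soloed v ≡ false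
    v-plain = odd-not-soloed v-odd

    z-plain : soloed z ≡ false
    z-plain = A-not-soloed z-A z-other

  recoloured : ∀ {v z} → recB v ≡ just z → Recoloured v z
  recoloured {v} {z} = go (Fₚ.any? (λ u → oddPair? u v))
    where
    go : (d : Dec (∃[ u ] OddPair u v)) → recOf v d ≡ just z → Recoloured v z
    go (yes (u , p)) refl = let (z , r , _ , a , o , e) = detour p in
      record { pair = p ; z-rest = r ; z-A = a ; z-even = o ; z-other = e }

  pair-recoloured : ∀ {u v} → OddPair u v → ∃[ z ] recB v ≡ just z
  pair-recoloured {u} {v} p = go (Fₚ.any? (λ u → oddPair? u v))
    where
    go : (d : Dec (∃[ u ] OddPair u v)) → ∃[ z ] recOf v d ≡ just z
    go (yes (u′ , p′)) = _ , refl
    go (no h) = ⊥-elim (h (u , p))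

  γ-soloed : ∀ {u} → soloed u ≡ true → γ u ≡ m u
  γ-soloed {u} s = cong (λ b → if b then m u else (if side u then recA u else recB u)) s

  γ-A : ∀ {u} → soloed u ≡ false → side u ≡ true → γ u ≡ recA u
  γ-A {u} s a = trans (cong (λ b → if b then m u else (if side u then recA u else recB u)) s) (cong (if_then recA u else recB u) a)

  γ-B : ∀ {u} → soloed u ≡ false → side u ≡ false → γ u ≡ recB u
  γ-B {u} s a = trans (cong (λ b → if b then m u else (if side u then recA u else recB u)) s) (cong (if_then recA u else recB u) a)

  recA-just : ∀ {a v} → recA a ≡ just v → Recoloured v a
  recA-just {a} {v} e = recoloured (is-≡ {m = recB v} (find-just _ e))

  γ-cases : ∀ {u v} → γ u ≡ just v → (soloed u ≡ true × m u ≡ just v) ⊎ (soloed u ≡ false × (Recoloured v u ⊎ Recoloured u v))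
  γ-cases {u} {v} e with true⊎false (soloed u) | true⊎false (side u)
  ... | inj₁ s | _ = inj₁ (s , trans (sym (γ-soloed s)) e)
  ... | inj₂ f | inj₁ a = inj₂ (f , inj₁ (recA-just (trans (sym (γ-A f a)) e)))
  ... | inj₂ f | inj₂ b = inj₂ (f , inj₂ (recoloured (trans (sym (γ-B f b)) e)))

  -- Both pairs have z in their component, and a component has only one odd pair. Hence recoloured
  -- edges never meet at z and `γ` is a matching.
  same-recoloured : ∀ {v v′ z} → Recoloured v z → Recoloured v′ z → v ≡ v′
  same-recoloured {v} {v′} {z} r r′ = same-pair (Recoloured.pair r) (Recoloured.pair r′)
    (inj₁ (step (step stop (Recoloured.z-rest r)) (trans (rest-sym z v′) (Recoloured.z-rest r′))))

  γ-sym : ∀ {u v} → γ u ≡ just v → γ v ≡ just u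
  γ-sym {u} {v} e with true⊎false (soloed u) | true⊎false (side u)
  ... | inj₁ s | _ = let mu = trans (sym (γ-soloed s)) e in trans (γ-soloed (trans (sym (soloed-partner mu)) s)) (m-sym mu)
  ... | inj₂ f | inj₁ a = let e′ = trans (sym (γ-A f a)) e ; r = recA-just e′ in
    trans (γ-B (Recoloured.v-plain r) (Recoloured.v-B r)) (is-≡ {m = recB v} (find-just _ e′))
  ... | inj₂ f | inj₂ b = trans (γ-A (Recoloured.z-plain r) (Recoloured.z-A r)) (go (recA v) refl)
    where
    e′ : recB u ≡ just v
    e′ = trans (sym (γ-B f b)) e
    r = recoloured e′
    go : ∀ p → recA v ≡ p → recA v ≡ just u
    go nothing k = ⊥-elim (true≢false (≡-is e′) (find-nothing _ k u))
    go (just u′) k = trans k (cong just (same-recoloured (recA-just k) r))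

  H N : Rel n
  H u v = plus rest x u v ∧ not (is (γ u) v)
  N u v = minus rest x u v ∧ not (is (γ u) v)

  class-sym : (c : Bool → Bool) → Symm (λ u v → (rest u v ∧ c (x u v)) ∧ not (is (γ u) v))
  class-sym c u v = cong₂ _∧_ (cong₂ (λ r y → r ∧ c y) (rest-sym u v) (x-sym u v)) (cong not (is-sym γ γ-sym u v))

  H-cases : ∀ {u v} → H u v ≡ true → rest u v ≡ true × x u v ≡ true × γ u ≢ just v
  H-cases {u} {v} e = let (p , g) = ∧-true {plus rest x u v} e ; (r , y) = ∧-true {rest u v} p in
    r , y , λ k → true≢false (≡-is k) (not-true g)

  N-cases : ∀ {u v} → N u v ≡ true → rest u v ≡ true × x u v ≡ false × γ u ≢ just v
  N-cases {u} {v} e = let (p , g) = ∧-true {minus rest x u v} e ; (r , y) = ∧-true {rest u v} p in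
    r , not-true y , λ k → true≢false (≡-is k) (not-true g)

  hc nc : Fin n → ℕ
  hc u = # (H u)
  nc u = # (N u)

  hc≤h : ∀ u → hc u ≤ h u
  hc≤h u = #-mono {f = H u} {plus rest x u} (λ v e → proj₁ (∧-true e))

  nc≤k : ∀ u → nc u ≤ k u
  nc≤k u = #-mono {f = N u} {minus rest x u} (λ v e → proj₁ (∧-true e))

  Apart : Fin n → Set
  Apart u = ∀ v → rest u v ≡ true → γ u ≢ just v

  soloed-apart : ∀ {u} → soloed u ≡ true → Apart u
  soloed-apart s v r e = proj₂ (rest-elim r) (trans (sym (γ-soloed s)) e)

  hc-apart : ∀ {u} → Apart u → hc u ≡ h u
  hc-apart {u} ap = #-cong (λ v → bool-ext (λ e → proj₁ (∧-true e)) (λ e → ∧-intro e (not-false (≢-is (ap v (proj₁ (∧-true {rest u v} e)))))))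

  nc-apart : ∀ {u} → Apart u → nc u ≡ k u
  nc-apart {u} ap = #-cong (λ v → bool-ext (λ e → proj₁ (∧-true e)) (λ e → ∧-intro e (not-false (≢-is (ap v (proj₁ (∧-true {rest u v} e)))))))

  rest≤ : ∀ u → h u + k u ≤ suc (t + t)
  rest≤ u = ℕₚ.≤-trans (ℕₚ.≤-reflexive (h+k u)) (ℕₚ.≤-trans (ℕₚ.m≤m+n _ (b2n (cov u))) (subst (_≤ suc (t + t)) (deg-rest u) (deg≤ u)))

  rest-covered≤ : ∀ {u} → cov u ≡ true → h u + k u ≤ t + t
  rest-covered≤ {u} c = ℕ.s≤s⁻¹ (subst (_≤ suc (t + t)) (ℕₚ.+-comm (h u + k u) 1)
    (subst₂ (λ a b → a + b2n b ≤ suc (t + t)) (sym (h+k u)) c (subst (_≤ suc (t + t)) (deg-rest u) (deg≤ u))))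

  q+q : 1 + (q + q) ≡ 2 + suc (t + t)
  q+q = cong (2 +_) (ℕₚ.+-suc t t)

  H≤q : ∀ u → hc u ≤ q
  H≤q u = ℕₚ.≤-trans (hc≤h u) (near-half 2 q (proj₁ (within-2 u)) (subst (2 + (h u + k u) ≤_) (sym q+q) (ℕₚ.+-monoʳ-≤ 2 (rest≤ u))))

  N≤q : ∀ u → nc u ≤ q
  N≤q u = ℕₚ.≤-trans (nc≤k u) (near-half 2 q (proj₂ (within-2 u)) (subst (2 + (k u + h u) ≤_) (sym q+q)
    (ℕₚ.+-monoʳ-≤ 2 (subst (_≤ suc (t + t)) (ℕₚ.+-comm (h u) (k u)) (rest≤ u)))))

  μ-just : ∀ {u v} → μ u ≡ just v → m u ≡ just v × soloed u ≡ false
  μ-just {u} {v} e with true⊎false (soloed u)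
  ... | inj₁ s = ⊥-elim (just≢nothing e (cong (λ b → if b then nothing else m u) s))
  ... | inj₂ f = trans (sym (cong (λ b → if b then nothing else m u) f)) e , f

  μ-plain : ∀ {u} → soloed u ≡ false → μ u ≡ m u
  μ-plain {u} f = cong (λ b → if b then nothing else m u) f

  μ-soloed : ∀ {u} → soloed u ≡ true → μ u ≡ nothing
  μ-soloed {u} s = cong (λ b → if b then nothing else m u) s

  μ-sym : ∀ {u v} → μ u ≡ just v → μ v ≡ just u
  μ-sym {u} {v} e = let (mu , f) = μ-just e in trans (μ-plain (trans (sym (soloed-partner mu)) f)) (m-sym mu)

  γ-adj : ∀ {u v} → γ u ≡ just v → Adj G u v
  γ-adj {u} {v} e = [ (λ (_ , mu) → proj₁ (m-adj mu))
    , (λ (_ , r) → [ (λ r → trans (adj-sym G u v) (proj₁ (rest-elim (Recoloured.z-rest r)))) , (λ r → proj₁ (rest-elim (Recoloured.z-rest r))) ]′ r) ]′ (γ-cases e)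

  HN-disjoint : ∀ u v → H u v ≡ true → N u v ≡ true → ⊥
  HN-disjoint u v e f = true≢false (proj₁ (proj₂ (H-cases e))) (proj₁ (proj₂ (N-cases f)))

  HN-rest : ∀ {u v} → (H ∪ N) u v ≡ true → rest u v ≡ true × γ u ≢ just v
  HN-rest {u} {v} e = [ (λ a → let (r , _ , g) = H-cases a in r , g) , (λ a → let (r , _ , g) = N-cases a in r , g) ]′ (∨-true {H u v} e)

  μ-disjoint : ∀ u v → (H ∪ N) u v ≡ true → is (μ u) v ≡ true → ⊥
  μ-disjoint u v e f = proj₂ (rest-elim (proj₁ (HN-rest e))) (proj₁ (μ-just (is-≡ {m = μ u} f)))

  HNμ : Rel n
  HNμ = (H ∪ N) ∪ (λ u v → is (μ u) v)

  γ-disjoint : ∀ u v → HNμ u v ≡ true → is (γ u) v ≡ true → ⊥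
  γ-disjoint u v e f = [ (λ a → proj₂ (HN-rest a) g) , (λ a → clash (μ-just (is-≡ {m = μ u} a))) ]′ (∨-true {(H ∪ N) u v} e)
    where
    g : γ u ≡ just v
    g = is-≡ {m = γ u} f
    clash : m u ≡ just v × soloed u ≡ false → ⊥
    clash (mu , f) = [ (λ (s , _) → true≢false s f)
      , (λ (_ , r) → [ (λ r → proj₂ (rest-elim (Recoloured.z-rest r)) (m-sym mu)) , (λ r → proj₂ (rest-elim (Recoloured.z-rest r)) mu) ]′ r) ]′ (γ-cases g)

  covers : ∀ u v → (HNμ ∪ (λ u v → is (γ u) v)) u v ≡ adj G u v
  covers u v = bool-ext
    (λ e → [ (λ e → [ (λ e → proj₁ (rest-elim (proj₁ (HN-rest e)))) , (λ f → proj₁ (m-adj (proj₁ (μ-just (is-≡ {m = μ u} f))))) ]′ (∨-true {(H ∪ N) u v} e))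
           , (λ f → γ-adj (is-≡ {m = γ u} f)) ]′ (∨-true {HNμ u v} e))
    (λ a → classify a (Mₚ.≡-dec F._≟_ (m u) (just v)) (true⊎false (is (γ u) v)))
    where
    classify : Adj G u v → Dec (m u ≡ just v) → is (γ u) v ≡ true ⊎ is (γ u) v ≡ false → (HNμ ∪ (λ u v → is (γ u) v)) u v ≡ true
    classify a d (inj₁ g) = ∨-introʳ {HNμ u v} g
    classify a (no ne) (inj₂ g) = ∨-introˡ (∨-introˡ ([ (λ p → ∨-introˡ (∧-intro (∧-intro (rest-intro a ne) p) (not-false g)))
      , (λ p → ∨-introʳ {H u v} (∧-intro (∧-intro (rest-intro a ne) (not-false p)) (not-false g))) ]′ (true⊎false (x u v))))
    classify a (yes e) (inj₂ g) = ∨-introˡ (∨-introʳ {(H ∪ N) u v} (≡-is (trans (μ-plain (¬true λ s → true≢false (≡-is (trans (γ-soloed s) e)) g)) e)))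

  deg-profile : ∀ u → deg G u ≡ ((hc u + nc u) + b2n (is-just (μ u))) + b2n (is-just (γ u))
  deg-profile u = trans (deg-# G u) (trans (#-cong (λ v → sym (covers u v)))
    (trans (#-∪ (HNμ u) (is (γ u)) (γ-disjoint u)) (cong₂ _+_
      (trans (#-∪ ((H ∪ N) u) (is (μ u)) (μ-disjoint u)) (cong₂ _+_ (#-∪ (H u) (N u) (HN-disjoint u)) (#-is-just (μ u)))) (#-is-just (γ u)))))

  SameProfile : Fin n → Fin n → Set
  SameProfile u v = hc u ≡ hc v × nc u ≡ nc v × is-just (μ u) ≡ is-just (μ v) × is-just (γ u) ≡ is-just (γ v)

  recoloured-B : ∀ {v} → soloed v ≡ false → side v ≡ false → is-just (γ v) ≡ true → ∃[ z ] Recoloured v z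
  recoloured-B f b j = let (z , e) = is-just-true j in z , recoloured (trans (sym (γ-B f b)) e)

  recoloured-A : ∀ {u} → soloed u ≡ false → side u ≡ true → is-just (γ u) ≡ true → ∃[ v ] Recoloured v u
  recoloured-A f a j = let (v , e) = is-just-true j in v , recA-just (trans (sym (γ-A f a)) e)

  -- Membership in `γ` decides. If only u is soloed, v would be the odd end of a recoloured edge
  -- inside a component without odd vertices. If only v is, u would be the even end of one, hence
  -- matched by parity, while `μ` omits v. Off the solo edges an odd u would have to be such an even
  -- end, since v is recoloured; an even u leaves both ends out of `γ`, and `plain-clash` applies.
  profile-differs : ∀ {u v} → Adj G u v → side u ≡ true → ¬ SameProfile u v
  profile-differs {u} {v} a su (eh , en , eμ , eγ) = go (true⊎false (soloed u)) (true⊎false (soloed v))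
    where
    sv = opposite-B a su
    d : deg G u ≡ deg G v
    d = trans (deg-profile u) (trans (cong₂ _+_ (cong₂ _+_ (cong₂ _+_ eh en) (cong b2n eμ)) (cong b2n eγ)) (sym (deg-profile v)))
    equal : Apart u → Apart v → h u ≡ h v × k u ≡ k v
    equal au av = trans (sym (hc-apart au)) (trans eh (hc-apart av)) , trans (sym (nc-apart au)) (trans en (nc-apart av))
    go : soloed u ≡ true ⊎ soloed u ≡ false → soloed v ≡ true ⊎ soloed v ≡ false → ⊥
    go (inj₁ s) (inj₁ r) = let (p , w) = equal (soloed-apart s) (soloed-apart r) in solo-clash a su s r (cong₂ _+_ p (sym w))
    go (inj₁ s) (inj₂ g) = true≢false (Recoloured.v-odd (proj₂ rec)) (proj₁ near v stop)
      where
      near = solo-neighbour s su a (λ e → true≢false (trans (sym (soloed-partner e)) s) g)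
      γu : is-just (γ u) ≡ true
      γu = let (y , e , _) = soloed-match s in cong is-just (trans (γ-soloed s) e)
      rec = recoloured-B g sv (trans (sym eγ) γu)
    go (inj₂ f) (inj₁ r) = true≢false cu (trans (sym (cong is-just (μ-plain f))) (trans eμ (cong is-just (μ-soloed r))))
      where
      mv = soloed-match r
      γv : is-just (γ v) ≡ true
      γv = cong is-just (trans (γ-soloed r) (proj₁ (proj₂ mv)))
      rec = proj₂ (recoloured-A f su (trans eγ γv))
      cu : cov u ≡ true
      cu = lem (par (deg G u)) (cov u) (cov v) (cong is-just (proj₁ (proj₂ mv)))
             (trans (Recoloured.z-even rec) (sym (trans (cong (λ k → par k xor cov v) d) (soloed-even r))))
        where
        lem : ∀ p a b → b ≡ true → p xor a ≡ p xor b → a ≡ true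
        lem true true b _ _ = refl
        lem true false b refl ()
        lem false a b e f = trans f e
    go (inj₂ f) (inj₂ g) = [ odd-case , even-case ]′ (true⊎false (odd u))
      where
      c : cov u ≡ cov v
      c = trans (sym (cong is-just (μ-plain f))) (trans eμ (cong is-just (μ-plain g)))
      odd-case : odd u ≡ true → ⊥
      odd-case o = true≢false o (Recoloured.z-even (proj₂ (recoloured-A f su (trans eγ γv))))
        where
        γv : is-just (γ v) ≡ true
        γv = cong is-just (trans (γ-B g sv) (proj₂ (pair-recoloured (su , (a , d) , c , o))))
      even-case : odd u ≡ false → ⊥
      even-case o = let (p , w) = equal (none γu) (none γv) in plain-clash (a , d) su c f g o p w
        where
        γv : is-just (γ v) ≡ false
        γv = ¬true (λ j → true≢false (Recoloured.v-odd (proj₂ (recoloured-B g sv j))) (trans (sym (same-parity d c)) o))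
        γu : is-just (γ u) ≡ false
        γu = trans eγ γv
        none : ∀ {w} → is-just (γ w) ≡ false → Apart w
        none j z r e = just≢nothing e (is-just-false j)

  H-colouring : Col H (Fin q)
  H-colouring = koenig side H (class-sym id) (λ u v e → bip u v (proj₁ (rest-elim (proj₁ (H-cases e))))) H≤q

  N-colouring : Col N (Fin q)
  N-colouring = koenig side N (class-sym not) (λ u v e → bip u v (proj₁ (rest-elim (proj₁ (N-cases e))))) N≤q

  Colour : Set
  Colour = ((Fin q ⊎ Fin q) ⊎ ⊤) ⊎ ⊤

  colouring : Col (adj G) Colour
  colouring = proj₁ (Col-resp covers (unite (unite (unite H-colouring N-colouring HN-disjoint) (matchingCol μ μ-sym) μ-disjoint)
    (matchingCol γ γ-sym) γ-disjoint))

  -- At most 2t + 1 edges lie in the two classes, so nc ≥ t + 1 leaves hc ≤ t.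
  A-missing : ∀ u → ¬ (nc u < q) → ∃[ c ] nb H-colouring u c ≡ nothing
  A-missing u no-n = missing H-colouring u (ℕₚ.≰⇒> λ le → ℕₚ.<-irrefl refl (ℕₚ.≤-trans
      (ℕₚ.≤-reflexive (cong suc (sym (ℕₚ.+-suc t t)))) (ℕₚ.≤-trans (ℕₚ.+-mono-≤ le (ℕₚ.≮⇒≥ no-n))
      (ℕₚ.≤-trans (ℕₚ.+-mono-≤ (hc≤h u) (nc≤k u)) (rest≤ u)))))

  -- These are the vertices of B that meet both matching colours. They must take a colour of `H`, so
  -- their neighbours have to take theirs from `N`.
  module Crowded {v w z} (eμ : μ v ≡ just w) (r : Recoloured v z) where
    open Recoloured r using (u; pair; v-odd)

    v-covered : cov v ≡ true
    v-covered = cong is-just (proj₁ (μ-just eμ))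

    B-missing : ∃[ c ] nb H-colouring v c ≡ nothing
    B-missing = missing H-colouring v (s≤s (ℕₚ.≤-trans (hc≤h v) (near-half 1 t (proj₁ (close 1 (sign-odd v v-odd))) (s≤s (rest-covered≤ v-covered)))))

    -- A neighbour of v is u, which is odd and matched like v, or a vertex of difference 0. Either
    -- way k ≤ t.
    N-free : ∀ {a} → Adj G a v → nc a < q
    N-free {a} adj-av = s≤s (ℕₚ.≤-trans (nc≤k a) (go (Mₚ.≡-dec F._≟_ (m v) (just a))))
      where
      at-u : k u ≤ t
      at-u = near-half 1 t (proj₂ (close 1 (sign-odd u (proj₁ (pair-odd pair))))) (s≤s (subst (_≤ t + t) (ℕₚ.+-comm (h u) (k u))
        (rest-covered≤ (trans (proj₁ (proj₂ (proj₂ pair))) v-covered))))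
      go : Dec (m v ≡ just a) → k a ≤ t
      go (yes e) = subst (λ b → k b ≤ t) (sym (pair-match pair e)) at-u
      go (no ne) with neighbour pair (rest-intro (trans (adj-sym G v a) adj-av) ne)
      ... | inj₁ e = subst (λ b → k b ≤ t) (sym e) at-u
      ... | inj₂ (_ , aA , oa , na) = near-half 0 t (ℕₚ.≤-reflexive (sym (A-equal aA oa na)))
              (subst (_≤ suc (t + t)) (ℕₚ.+-comm (h a) (k a)) (rest≤ a))

  private
    -- Colours of `H` are only a fallback, so a vertex with a free colour in `N` cannot clash with a
    -- crowded neighbour.
    vertex-A : ∀ u → Dec (nc u < q) → Colour
    vertex-A u (yes p) = inj₁ (inj₁ (inj₂ (proj₁ (missing N-colouring u p))))
    vertex-A u (no p) = inj₁ (inj₁ (inj₁ (proj₁ (A-missing u p))))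

    vertex-A-free : ∀ u d → nb colouring u (vertex-A u d) ≡ nothing
    vertex-A-free u (yes p) = proj₂ (missing N-colouring u p)
    vertex-A-free u (no p) = proj₂ (A-missing u p)

    crowded : ∀ {v z w} → side v ≡ false → γ v ≡ just z → μ v ≡ just w → Recoloured v z
    crowded {v} b g e = recoloured (trans (sym (γ-B (proj₂ (μ-just e)) b)) g)

    vertex-B : ∀ v → side v ≡ false → ∀ g p → γ v ≡ g → μ v ≡ p → Colour
    vertex-B v b nothing p eg em = inj₂ tt
    vertex-B v b (just z) nothing eg em = inj₁ (inj₂ tt)
    vertex-B v b (just z) (just w) eg em = inj₁ (inj₁ (inj₁ (proj₁ (Crowded.B-missing em (crowded b eg em)))))

    vertex-B-free : ∀ v b g p eg em → nb colouring v (vertex-B v b g p eg em) ≡ nothing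
    vertex-B-free v b nothing p eg em = eg
    vertex-B-free v b (just z) nothing eg em = em
    vertex-B-free v b (just z) (just w) eg em = proj₂ (Crowded.B-missing em (crowded b eg em))

    vertex : ∀ u → side u ≡ true ⊎ side u ≡ false → Colour
    vertex u (inj₁ a) = vertex-A u (nc u ℕₚ.<? q)
    vertex u (inj₂ b) = vertex-B u b (γ u) (μ u) refl refl

    vertex-free : ∀ u s → nb colouring u (vertex u s) ≡ nothing
    vertex-free u (inj₁ a) = vertex-A-free u (nc u ℕₚ.<? q)
    vertex-free u (inj₂ b) = vertex-B-free u b (γ u) (μ u) refl refl

    AB-proper : ∀ u v → Adj G u v → ∀ d b g p eg em → vertex-A u d ≢ vertex-B v b g p eg em
    AB-proper u v a (yes _) b nothing p eg em ()
    AB-proper u v a (no _) b nothing p eg em ()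
    AB-proper u v a (yes _) b (just z) nothing eg em ()
    AB-proper u v a (no _) b (just z) nothing eg em ()
    AB-proper u v a (yes _) b (just z) (just w) eg em ()
    AB-proper u v a (no ne) b (just z) (just w) eg em e = ne (Crowded.N-free em (crowded b eg em) a)

    vertex-proper : ∀ u v → Adj G u v → side u ≡ true → ∀ s s′ → vertex u s ≢ vertex v s′
    vertex-proper u v a su (inj₂ f) s′ e = true≢false su f
    vertex-proper u v a su (inj₁ _) (inj₁ f) e = bip u v a (trans su (sym f))
    vertex-proper u v a su (inj₁ _) (inj₂ b) e = AB-proper u v a (nc u ℕₚ.<? q) b (γ v) (μ v) refl refl e

    distinguishes : ∀ u v → Adj G u v → side u ≡ true → ¬ (∀ c → seen colouring u c ≡ seen colouring v c)
    distinguishes u v a s eq = profile-differs a s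
      ( trans (sym (#-seen H-colouring u)) (trans (#-cong (λ c → eq (inj₁ (inj₁ (inj₁ c))))) (#-seen H-colouring v))
      , trans (sym (#-seen N-colouring u)) (trans (#-cong (λ c → eq (inj₁ (inj₁ (inj₂ c))))) (#-seen N-colouring v))
      , eq (inj₁ (inj₂ tt)) , eq (inj₂ tt) )

  avd : TotalAVD G (suc (suc (q + q)))
  avd = Assemble.totalAVD G (plus-one (plus-one (F.join q q)))
    (plus-one-injective (plus-one (F.join q q)) (plus-one-injective (F.join q q) (join-injective q q))) (inj₂ tt) colouring
    side (λ u v → bip u v) (λ u → vertex u (true⊎false (side u))) (λ u → vertex-free u (true⊎false (side u)))
    (λ u v a s → vertex-proper u v a s (true⊎false (side u)) (true⊎false (side v))) distinguishes

-- Both parities together, and the theorem.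

halved : ∀ d → ∃[ t ] (d ≡ t + t ⊎ d ≡ suc (t + t))
halved zero = zero , inj₁ refl
halved (suc d) with halved d
... | t , inj₁ refl = t , inj₂ refl
... | t , inj₂ refl = suc t , inj₁ (cong suc (sym (ℕₚ.+-suc t t)))

avd-bound : ∀ {n} (G : Graph n) (side : Fin n → Bool) (bip : Bip side (adj G))
            (noiso : NoIsolatedEdge G) (fin : Matchings.Final G) →
            (Σ (Rel n) λ x → Symm x × Signed.SignSpec G side bip noiso fin x) → χ''as≤ G (maxDeg G + 3)
avd-bound {n} G side bip noiso fin (x , x-sym , spec) = go (halved (maxDeg G))
  where
  room : ∀ t → 3 + (t + t) ≡ suc (suc t + suc t)
  room t = cong (2 +_) (sym (ℕₚ.+-suc t t))
  go : ∃[ t ] (maxDeg G ≡ t + t ⊎ maxDeg G ≡ suc (t + t)) → χ''as≤ G (maxDeg G + 3)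
  go (t , inj₁ e) = suc (suc t + suc t) , ℕₚ.≤-reflexive (trans (sym (room t)) (trans (cong (3 +_) (sym e)) (ℕₚ.+-comm 3 (maxDeg G))))
    , EvenColouring.avd G side bip noiso fin x x-sym spec t (λ u → subst (deg G u ≤_) e (deg≤maxDeg G u))
  go (t , inj₂ e) = suc (suc (suc t + suc t)) , ℕₚ.≤-reflexive (trans (cong suc (sym (room t))) (trans (cong (3 +_) (sym e)) (ℕₚ.+-comm 3 (maxDeg G))))
    , OddColouring.avd G side bip noiso fin x x-sym spec t (λ u → subst (deg G u ≤_) e (deg≤maxDeg G u))

vd-bound : ∀ {n} (G : Graph n) (side : Fin n → Bool) → Bip side (adj G) →
           ∀ s → EdgeVD G s → χ''s≤ G (s + eps s (maxDeg G))
vd-bound G side bip s (c , pr , vd) with maxDeg G ℕ.<ᵇ s in eq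
... | true = s + 1 , ℕₚ.≤-refl , one-new G side bip c pr vd (ℕₚ.<ᵇ⇒< (maxDeg G) s (subst T (sym eq) tt))
... | false = s + 2 , ℕₚ.≤-refl , two-new G side bip c pr vd

theorem6 : ∀ {n} (G : Graph n) → InF3s G → Bipartite G →
    χ''as≤ G (maxDeg G + 3)
    × (∀ s → IsLeast (EdgeVD G) s → χ''s≤ G (s + eps s (maxDeg G)))
theorem6 G (_ , noiso , _) (side , bip) =
  avd-bound G side bip noiso (Matchings.final G) (Signed.exists-signing G side bip noiso (Matchings.final G))
  , λ s (vd , _) → vd-bound G side bip s vd
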